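{- Let $n = p_1^{\alpha_1}\cdots p_r^{\alpha_r}$ be the prime factorisation of a positive integer $n$ (distinct primes, $\alpha_i>0$). Then \[\det(A_n) = \prod_{\substack{d_1, d_2 \mid n\\ 1 \le d_1 < d_2 \le n}} \mathcal{R}(\Phi_{d_2}, \Phi_{d_1}) = (-1)^{n-1}\prod_{i=1}^r p_i^{\frac{n(1-p_i^{ -\alpha_i})}{p_i-1}}.\]
   Context: $\Phi_d$ is the $d$th cyclotomic polynomial. $\Psi_n : \mathbf{Z}[X]/(X^n-1) \to \bigoplus_{d \mid n} \mathbf{Z}[X]/(\Phi_d(X))$ is the natural map $f\bmod(X^n-1)\mapsto\bigoplus_{d\mid n}f\bmod\Phi_d(X)$, and $A_n$ is its matrix with respect to the basis $(1,\overline{X},\dots,\overline{X}^{n-1})$ of the domain and the bases $(1,\overline{X},\dots,\overline{X}^{\phi(d)-1})$ of the summands, with summands ordered by increasing $d$ (the $j$th column of $A_n$ is the coordinate vector of $\Psi_n(\overline{X}^j)$). For monic polynomials $f,g$, the resultant is $\mathcal{R}(f,g) = \prod_{\alpha}\prod_{\beta}(\alpha-\beta)$, the product over the roots $\alpha$ of $f$ and $\beta$ of $g$ (with multiplicity) in an algebraic closure. -}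

module Defs where

open import Level using (Level; _⊔_) renaming (suc to lsuc)
open import Algebra.Apartness.Bundles using (HeytingField; HeytingCommutativeRing)
open import Algebra.Bundles using (CommutativeRing)
open import Algebra.Morphism.Structures using (module RingMorphisms)
open import Data.Bool.Base using (if_then_else_; true; false)
open import Data.Fin.Base using (Fin; toℕ; cast)
open import Data.Fin.Properties using (toℕ<n)
open import Data.Integer.Base as ℤ using (ℤ)
import Data.Integer.Properties as ℤ
open import Data.List.Base
  using (List; []; _∷_; [_]; _++_; map; replicate; length; take; foldr; filter; tabulate; lookup;
         upTo; applyUpTo; concatMap; cartesianProduct)
open import Data.List.Properties using (length-++; length-map; length-upTo)
open import Data.Nat.Base as ℕ using (ℕ; zero; suc; pred; _∸_; _≤_; _<_; s≤s; z≤n; NonZero)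
open import Data.Nat.Coprimality using (coprime?; coprime⇒gcd≡1; gcd≡1⇒coprime)
open import Data.Nat.Divisibility using (_∣_; _∣?_; divides; ∣⇒≤)
open import Data.Nat.GCD using (gcd; gcd[m,n]∣m; gcd[m,n]∣n; gcd-comm; c*gcd[m,n]≡gcd[cm,cn])
open import Data.Nat.Induction using (<-rec)
open import Data.Nat.Primality using (Prime; prime⇒nonZero; prime⇒nonTrivial)
import Data.Nat.Properties as ℕ
open import Data.Product.Base using (∃-syntax; _×_; _,_; proj₁; proj₂)
open import Data.Rational.Base as ℚ using (ℚ)
import Data.Rational.Properties as ℚ
open import Data.Vec.Functional as Vector using (Vector)
open import Function.Base using (_∘_; id)
open import Relation.Binary.PropositionalEquality
  using (_≡_; _≢_; refl; sym; trans; cong; cong₂; subst; module ≡-Reasoning)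
open import Relation.Nullary using (Dec; yes; no; does; ¬_; contradiction)

module Polynomial {c ℓ} (R : CommutativeRing c ℓ) where
  open CommutativeRing R

  infix  4 _≋_
  infixl 6 _⊕_
  infixl 7 _⊗_ _⊗ᵐ_ _÷ᵐ_
  infixr 7 _·_

  -- Coefficient lists, constant term first; trailing zeros are allowed, so
  -- equality of polynomials is _≋_.
  Poly : Set c
  Poly = List Carrier

  coeff : Poly → ℕ → Carrier
  coeff []      _       = 0#
  coeff (a ∷ _) zero    = a
  coeff (_ ∷ p) (suc i) = coeff p i

  _≋_ : Poly → Poly → Set ℓ
  p ≋ q = ∀ i → coeff p i ≈ coeff q i

  _⊕_ : Poly → Poly → Poly
  []      ⊕ q       = q
  (a ∷ p) ⊕ []      = a ∷ p
  (a ∷ p) ⊕ (b ∷ q) = (a + b) ∷ (p ⊕ q)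

  _·_ : Carrier → Poly → Poly
  a · p = map (a *_) p

  _⊗_ : Poly → Poly → Poly
  []      ⊗ q = []
  (a ∷ p) ⊗ q = (a · q) ⊕ (0# ∷ p ⊗ q)

  eval : Poly → Carrier → Carrier
  eval []      x = 0#
  eval (a ∷ p) x = a + x * eval p x

  X^ : ℕ → Poly
  X^ n = replicate n 0# ++ [ 1# ]

  -- monic c₀ … cₘ₋₁ is the monic polynomial Xᵐ + cₘ₋₁Xᵐ⁻¹ + … + c₀.
  record Monic : Set c where
    constructor monic
    field lower : List Carrier

    degree : ℕ
    degree = length lower

    ⟦_⟧ : Poly
    ⟦_⟧ = lower ++ [ 1# ]

  open Monic public

  1ᵐ : Monic
  1ᵐ = monic []

  X-_ : Carrier → Monic
  X- a = monic [ - a ]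

  -- (p + Xᵐ)(q + Xᵏ) = p(q + Xᵏ) + Xᵐq + Xᵐ⁺ᵏ
  _⊗ᵐ_ : Monic → Monic → Monic
  f ⊗ᵐ g = monic ((lower f ⊗ ⟦ g ⟧) ⊕ (replicate (degree f) 0# ++ lower g))

  ∏ᵐ : List Monic → Monic
  ∏ᵐ = foldr _⊗ᵐ_ 1ᵐ

  -- Quotient and remainder. If f = q g + r with deg r < m = deg g, then
  -- a + X f = (c + X q) g + (a + X r - c g), where c is the Xᵐ-coefficient of
  -- a + X r. The remainder is always a list of length m.
  divMod : Poly → Monic → Poly × Poly
  divMod []      g = [] , replicate (degree g) 0#
  divMod (a ∷ f) g =
    let q , r = divMod f g
        s     = a ∷ r
        lead  = coeff s (degree g)
    in  lead ∷ q , take (degree g) (s ⊕ (- lead) · ⟦ g ⟧)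

  _mod_ : Poly → Monic → Poly
  f mod g = proj₂ (divMod f g)

  -- The quotient of a monic polynomial by a monic polynomial of smaller or
  -- equal degree is monic of degree deg f - deg g.
  _÷ᵐ_ : Monic → Monic → Monic
  f ÷ᵐ g = monic (take (degree f ∸ degree g) (proj₁ (divMod ⟦ f ⟧ g)))

module Determinant {c ℓ} (R : CommutativeRing c ℓ) where
  open CommutativeRing R
  open import Algebra.Properties.Monoid.Sum +-monoid using (sum)
  open import Algebra.Properties.Semiring.Exp semiring using (_^_)

  Matrix : ℕ → ℕ → Set c
  Matrix m n = Vector (Vector Carrier n) m

  det : ∀ {n} → Matrix n n → Carrier
  det {zero}  A = 1#
  det {suc n} A = sum λ j →
    (- 1#) ^ toℕ j * A Fin.zero j * det (λ i → Vector.removeAt (A (Fin.suc i)) j)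

module ℤ[X] = Polynomial ℤ.+-*-commutativeRing
module ℚ[X] = Polynomial ℚ.+-*-commutativeRing

open ℤ[X] using (⟦_⟧; monic; _÷ᵐ_; ∏ᵐ; 1ᵐ; _mod_; coeff; X^)
open Determinant ℤ.+-*-commutativeRing public using (Matrix; det)

Xⁿ-1 : ℕ → ℤ[X].Monic
Xⁿ-1 zero    = 1ᵐ  -- junk value
Xⁿ-1 (suc n) = monic (ℤ.-1ℤ ∷ replicate n ℤ.0ℤ)

-- Cyclotomic polynomials, by Φₙ = (Xⁿ - 1) / ∏ { Φ_d : d ∣ n , d < n }.
Φ : ℕ → ℤ[X].Monic
Φ = <-rec (λ _ → ℤ[X].Monic) λ n rec →
  Xⁿ-1 n ÷ᵐ ∏ᵐ (tabulate λ (d : Fin n) → if does (toℕ d ∣? n) then rec (toℕ<n d) else 1ᵐ)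

-- The positive divisors of n, in increasing order.
divisors : ℕ → List ℕ
divisors n = filter (_∣? n) (applyUpTo suc n)

φ : ℕ → ℕ
φ n = length (filter (coprime? n) (applyUpTo suc n))

-- The basis of ⨁_{d ∣ n} ℤ[X]/(Φ_d): the pair (d , k) stands for the class of
-- Xᵏ in the summand ℤ[X]/(Φ_d).
basis : ℕ → List (ℕ × ℕ)
basis n = concatMap (λ d → map (d ,_) (upTo (φ d))) (divisors n)

private
  ∑< : ℕ → (ℕ → ℕ) → ℕ
  ∑< zero    f = 0
  ∑< (suc n) f = f 0 ℕ.+ ∑< n (f ∘ suc)

  ind : ∀ {p} {P : Set p} → Dec P → ℕ
  ind P? = if does P? then 1 else 0

  ind-yes : ∀ {p} {P : Set p} (P? : Dec P) → P → ind P? ≡ 1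
  ind-yes (yes _) _ = refl
  ind-yes (no ¬p) p = contradiction p ¬p

  ind-no : ∀ {p} {P : Set p} (P? : Dec P) → ¬ P → ind P? ≡ 0
  ind-no (yes p) ¬p = contradiction p ¬p
  ind-no (no _)  _  = refl

  ind-⇔ : ∀ {p q} {P : Set p} {Q : Set q} (P? : Dec P) (Q? : Dec Q) →
          (P → Q) → (Q → P) → ind P? ≡ ind Q?
  ind-⇔ (yes p) Q? to from = sym (ind-yes Q? (to p))
  ind-⇔ (no ¬p) Q? to from = sym (ind-no Q? (¬p ∘ from))

  ∑-cong : ∀ n {f g : ℕ → ℕ} → (∀ i → f i ≡ g i) → ∑< n f ≡ ∑< n g
  ∑-cong zero    eq = refl
  ∑-cong (suc n) eq = cong₂ ℕ._+_ (eq 0) (∑-cong n (eq ∘ suc))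

  ∑-zero : ∀ n {f : ℕ → ℕ} → (∀ i → i < n → f i ≡ 0) → ∑< n f ≡ 0
  ∑-zero zero    eq = refl
  ∑-zero (suc n) eq = cong₂ ℕ._+_ (eq 0 (s≤s z≤n)) (∑-zero n λ i → eq (suc i) ∘ s≤s)

  ∑-const1 : ∀ n → ∑< n (λ _ → 1) ≡ n
  ∑-const1 zero    = refl
  ∑-const1 (suc n) = cong suc (∑-const1 n)

  ∑-+ : ∀ n (f g : ℕ → ℕ) → ∑< n (λ i → f i ℕ.+ g i) ≡ ∑< n f ℕ.+ ∑< n g
  ∑-+ zero    f g = refl
  ∑-+ (suc n) f g = trans (cong (f 0 ℕ.+ g 0 ℕ.+_) (∑-+ n (f ∘ suc) (g ∘ suc)))
    (interchange (f 0) (g 0) (∑< n (f ∘ suc)) (∑< n (g ∘ suc)))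
    where open import Algebra.Properties.CommutativeSemigroup ℕ.+-commutativeSemigroup
            using (interchange)

  ∑-swap : ∀ m n (f : ℕ → ℕ → ℕ) → ∑< m (λ i → ∑< n (f i)) ≡ ∑< n (λ j → ∑< m (λ i → f i j))
  ∑-swap zero    n f = sym (∑-zero n λ _ _ → refl)
  ∑-swap (suc m) n f = trans (cong (∑< n (f 0) ℕ.+_) (∑-swap m n (f ∘ suc)))
    (sym (∑-+ n (f 0) λ j → ∑< m (λ i → f (suc i) j)))

  ∑-split : ∀ m n (f : ℕ → ℕ) → ∑< (m ℕ.+ n) f ≡ ∑< m f ℕ.+ ∑< n (λ i → f (m ℕ.+ i))
  ∑-split zero    n f = refl
  ∑-split (suc m) n f = trans (cong (f 0 ℕ.+_) (∑-split m n (f ∘ suc)))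
    (sym (ℕ.+-assoc (f 0) _ _))

  ∑-single : ∀ n (f : ℕ → ℕ) a → a < n → (∀ i → i ≢ a → f i ≡ 0) → ∑< n f ≡ f a
  ∑-single (suc n) f zero    a<n off =
    trans (cong (f 0 ℕ.+_) (∑-zero n λ i _ → off (suc i) λ ())) (ℕ.+-identityʳ (f 0))
  ∑-single (suc n) f (suc a) (s≤s a<n) off = trans (cong (ℕ._+ ∑< n (f ∘ suc)) (off 0 λ ()))
    (∑-single n (f ∘ suc) a a<n λ i i≢a → off (suc i) (i≢a ∘ ℕ.suc-injective))

  ∑-last : ∀ m (f : ℕ → ℕ) → (∀ i → i < m → f i ≡ 0) → ∑< (suc m) f ≡ f m
  ∑-last zero    f off = ℕ.+-identityʳ (f 0)
  ∑-last (suc m) f off = trans (cong (ℕ._+ ∑< (suc m) (f ∘ suc)) (off 0 (s≤s z≤n)))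
    (∑-last m (f ∘ suc) λ i → off (suc i) ∘ s≤s)

  ∑-multiples : ∀ e .{{_ : NonZero e}} d (f : ℕ → ℕ) → (∀ k → ¬ e ∣ k → f k ≡ 0) →
                ∑< (d ℕ.* e) (f ∘ suc) ≡ ∑< d (λ k → f (suc k ℕ.* e))
  ∑-multiples e        zero    f off = refl
  ∑-multiples e@(suc e′) (suc d) f off = trans (∑-split e (d ℕ.* e) (f ∘ suc)) (cong₂ ℕ._+_
    (trans (∑-last e′ (f ∘ suc) λ i i<e′ → off (suc i) λ e∣i → ℕ.<⇒≱ i<e′ (ℕ.s≤s⁻¹ (∣⇒≤ e∣i)))
           (cong f (sym (ℕ.+-identityʳ e))))
    (trans (∑-cong (d ℕ.* e) λ i → cong f (sym (ℕ.+-suc e i)))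
           (∑-multiples e d (λ k → f (e ℕ.+ k)) λ k ¬e∣k → off (e ℕ.+ k) λ e∣e+k →
             ¬e∣k (∣m+n∣m⇒∣n e∣e+k ∣-refl))))
    where open import Data.Nat.Divisibility using (∣m+n∣m⇒∣n; ∣-refl)

  length-filter : ∀ {p} {P : ℕ → Set p} (P? : ∀ k → Dec (P k)) (g : ℕ → ℕ) n →
                  length (filter P? (applyUpTo g n)) ≡ ∑< n (ind ∘ P? ∘ g)
  length-filter P? g zero    = refl
  length-filter P? g (suc n) with does (P? (g 0))
  ... | true  = cong suc (length-filter P? (g ∘ suc) n)
  ... | false = length-filter P? (g ∘ suc) n

  length-concatMap-filter :
    ∀ {p a} {P : ℕ → Set p} {A : Set a} (P? : ∀ k → Dec (P k)) (h : ℕ → List A) (g : ℕ → ℕ) n →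
    length (concatMap h (filter P? (applyUpTo g n))) ≡
    ∑< n (λ k → if does (P? (g k)) then length (h (g k)) else 0)
  length-concatMap-filter P? h g zero    = refl
  length-concatMap-filter P? h g (suc n) with does (P? (g 0))
  ... | true  = trans (length-++ (h (g 0)))
                  (cong (length (h (g 0)) ℕ.+_) (length-concatMap-filter P? h (g ∘ suc) n))
  ... | false = length-concatMap-filter P? h (g ∘ suc) n

  if-dec : ∀ {p a} {P : Set p} {A : Set a} (P? : Dec P) {x y z : A} →
           (P → x ≡ z) → (¬ P → y ≡ z) → (if does P? then x else y) ≡ z
  if-dec (yes p) t f = t p
  if-dec (no ¬p) t f = f ¬p

  φ-count-∣ : ∀ a e .{{_ : NonZero e}} → let d = suc a; n = e ℕ.* d in
    φ d ≡ ∑< n (λ b → ind (gcd (suc b) n ℕ.* d ℕ.≟ n))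
  φ-count-∣ a e = begin
    length (filter (coprime? d) (applyUpTo suc d))  ≡⟨ length-filter (coprime? d) suc d ⟩
    ∑< d (λ k → ind (coprime? d (suc k)))           ≡⟨ ∑-cong d on ⟩
    ∑< d (λ k → F (suc k ℕ.* e))                    ≡⟨ ∑-multiples e d F off ⟨
    ∑< (d ℕ.* e) (F ∘ suc)                          ≡⟨ cong (λ m → ∑< m (F ∘ suc)) (ℕ.*-comm d e) ⟩
    ∑< (e ℕ.* d) (F ∘ suc)                          ∎
    where
    open ≡-Reasoning
    d = suc a
    F : ℕ → ℕ
    F c = ind (gcd c (e ℕ.* d) ℕ.* d ℕ.≟ e ℕ.* d)

    gcd-multiple : ∀ k → gcd (k ℕ.* e) (e ℕ.* d) ≡ e ℕ.* gcd d k
    gcd-multiple k = begin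
      gcd (k ℕ.* e) (e ℕ.* d)  ≡⟨ gcd-comm (k ℕ.* e) (e ℕ.* d) ⟩
      gcd (e ℕ.* d) (k ℕ.* e)  ≡⟨ cong (gcd (e ℕ.* d)) (ℕ.*-comm k e) ⟩
      gcd (e ℕ.* d) (e ℕ.* k)  ≡⟨ c*gcd[m,n]≡gcd[cm,cn] e d k ⟨
      e ℕ.* gcd d k            ∎

    on : ∀ k → ind (coprime? d (suc k)) ≡ F (suc k ℕ.* e)
    on k = ind-⇔ (coprime? d (suc k)) (_ ℕ.≟ _)
      (λ cop → cong (ℕ._* d) (trans (gcd-multiple (suc k))
        (trans (cong (e ℕ.*_) (coprime⇒gcd≡1 cop)) (ℕ.*-identityʳ e))))
      (λ eq → gcd≡1⇒coprime (ℕ.*-cancelˡ-≡ _ 1 e (trans (sym (gcd-multiple (suc k)))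
        (trans (ℕ.*-cancelʳ-≡ _ e d eq) (sym (ℕ.*-identityʳ e))))))

    off : ∀ k → ¬ e ∣ k → F k ≡ 0
    off k ¬e∣k = ind-no (_ ℕ.≟ _) λ eq →
      ¬e∣k (subst (_∣ k) (ℕ.*-cancelʳ-≡ _ e d eq) (gcd[m,n]∣m k (e ℕ.* d)))

  φ-count : ∀ n .{{_ : NonZero n}} a →
    (if does (suc a ∣? n) then φ (suc a) else 0) ≡
    ∑< n (λ b → ind (gcd (suc b) n ℕ.* suc a ℕ.≟ n))
  φ-count n a = if-dec (suc a ∣? n) count λ ¬d∣n → sym (∑-zero n λ b _ →
    ind-no (gcd (suc b) n ℕ.* suc a ℕ.≟ n) λ eq → ¬d∣n (divides (gcd (suc b) n) (sym eq)))
    where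
    count : suc a ∣ n → φ (suc a) ≡ ∑< n (λ b → ind (gcd (suc b) n ℕ.* suc a ℕ.≟ n))
    count (divides zero eq)      = contradiction eq (ℕ.≢-nonZero⁻¹ n)
    count (divides e@(suc _) eq) =
      subst (λ m → φ (suc a) ≡ ∑< m (λ b → ind (gcd (suc b) m ℕ.* suc a ℕ.≟ m)))
            (sym eq) (φ-count-∣ a e)

  cofactor : ∀ n .{{_ : NonZero n}} b → ∑< n (λ a → ind (gcd (suc b) n ℕ.* suc a ℕ.≟ n)) ≡ 1
  cofactor n b with gcd (suc b) n | gcd[m,n]∣n (suc b) n
  ... | g | divides zero    eq = contradiction eq (ℕ.≢-nonZero⁻¹ n)
  ... | zero | divides (suc q) eq =
    contradiction (trans eq (ℕ.*-zeroʳ q)) (ℕ.≢-nonZero⁻¹ n)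
  ... | g@(suc _) | divides (suc q) eq = trans
    (∑-single n _ q (subst (suc q ≤_) (sym eq) (ℕ.m≤m*n (suc q) g)) λ a a≢q →
      ind-no (g ℕ.* suc a ℕ.≟ n) λ eq′ → a≢q (ℕ.suc-injective
        (ℕ.*-cancelˡ-≡ _ _ g (trans eq′ (trans eq (ℕ.*-comm (suc q) g))))))
    (ind-yes (g ℕ.* suc q ℕ.≟ n) (trans (ℕ.*-comm g (suc q)) (sym eq)))

-- ∑_{d ∣ n} φ(d) = n
length-basis : ∀ n → length (basis n) ≡ n
length-basis zero      = refl
length-basis n@(suc _) = begin
  length (basis n)
    ≡⟨ length-concatMap-filter (_∣? n) block suc n ⟩
  ∑< n (λ a → if does (suc a ∣? n) then length (block (suc a)) else 0)
    ≡⟨ ∑-cong n (λ a → cong (λ l → if does (suc a ∣? n) then l else 0) (length-block (suc a))) ⟩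
  ∑< n (λ a → if does (suc a ∣? n) then φ (suc a) else 0)
    ≡⟨ ∑-cong n (φ-count n) ⟩
  ∑< n (λ a → ∑< n (λ b → ind (gcd (suc b) n ℕ.* suc a ℕ.≟ n)))
    ≡⟨ ∑-swap n n (λ a b → ind (gcd (suc b) n ℕ.* suc a ℕ.≟ n)) ⟩
  ∑< n (λ b → ∑< n (λ a → ind (gcd (suc b) n ℕ.* suc a ℕ.≟ n)))
    ≡⟨ ∑-cong n (cofactor n) ⟩
  ∑< n (λ _ → 1)
    ≡⟨ ∑-const1 n ⟩
  n ∎
  where
  open ≡-Reasoning
  block : ℕ → List (ℕ × ℕ)
  block d = map (d ,_) (upTo (φ d))

  length-block : ∀ d → length (block d) ≡ φ d
  length-block d = trans (length-map (d ,_) (upTo (φ d))) (length-upTo (φ d))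

-- The component at d of the image of (the class of) f under
-- Ψₙ : ℤ[X]/(Xⁿ - 1) → ⨁_{d ∣ n} ℤ[X]/(Φ_d), as a reduced representative.
Ψ : ℤ[X].Poly → ℕ → ℤ[X].Poly
Ψ f d = f mod Φ d

-- The matrix Aₙ of Ψₙ: the row of (d , k) and the column of Xʲ meet in the
-- coordinate of Ψₙ(Xʲ) at the basis element (d , k).
A : ∀ n → Matrix n n
A n i j =
  let d , k = lookup (basis n) (cast (sym (length-basis n)) i)
  in  coeff (Ψ (X^ (toℕ j)) d) k

record AlgebraicClosureOfℚ c ℓ₁ ℓ₂ : Set (lsuc (c ⊔ ℓ₁ ⊔ ℓ₂)) where
  field
    heytingField : HeytingField c ℓ₁ ℓ₂

  open HeytingField heytingField public using (Carrier; _≈_; _+_; _*_; -_; 0#; 1#; heytingCommutativeRing)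

  commutativeRing : CommutativeRing c ℓ₁
  commutativeRing = HeytingCommutativeRing.commutativeRing heytingCommutativeRing

  open CommutativeRing commutativeRing public using (_-_; rawRing)
  open Polynomial commutativeRing public
    using (Monic; _≋_; eval; X-_) renaming (⟦_⟧ to ⟦_⟧ᴷ; ∏ᵐ to ∏ᴷ)

  field
    ι                  : ℚ → Carrier
    ι-isHomomorphism   : RingMorphisms.IsRingHomomorphism ℚ.+-*-rawRing rawRing ι
    algebraic          : ∀ x → ∃[ f ] eval (map ι (ℚ[X].⟦ f ⟧)) x ≈ 0#
    splits             : ∀ (f : Monic) → ∃[ αs ] ⟦ f ⟧ᴷ ≋ ⟦ ∏ᴷ (map X-_ αs) ⟧ᴷ

  ιℤ : ℤ → Carrier
  ιℤ i = ι (i ℚ./ 1)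

  -- With multiplicity.
  roots : ℤ[X].Monic → List Carrier
  roots f = proj₁ (splits (record { lower = map ιℤ (ℤ[X].lower f) }))

  ∏ : List Carrier → Carrier
  ∏ = foldr _*_ 1#

  resultant : ℤ[X].Monic → ℤ[X].Monic → Carrier
  resultant f g = ∏ (map (λ α → ∏ (map (λ β → α - β) (roots g))) (roots f))

-- The pairs (d₁ , d₂) of divisors of n with d₁ < d₂.
divisorPairs : ℕ → List (ℕ × ℕ)
divisorPairs n = filter (λ (d₁ , d₂) → d₁ ℕ.<? d₂) (cartesianProduct (divisors n) (divisors n))

-- n (1 - p⁻ᵅ) / (p - 1), for a prime p with pᵅ ∣ n. Both divisions are then
-- exact: n - n / pᵅ = (n / pᵅ)(pᵅ - 1), and p - 1 divides pᵅ - 1.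
exponent : (n p α : ℕ) → Prime p → ℕ
exponent n p α p-prime = (n ∸ n ℕ./ p ℕ.^ α) ℕ./ pred p
  where instance
    _ = prime⇒nonZero p-prime
    _ = ℕ.m^n≢0 p α
    _ = ℕ.>-nonZero (ℕ.pred-mono-< (ℕ.nonTrivial⇒n>1 p {{prime⇒nonTrivial p-prime}}))

{-# OPTIONS --safe #-}

-- The norm of g modulo a monic polynomial f is the determinant of multiplication
-- by g on R[X]/(f). For monic g it is the resultant of f and g; it is multiplicative
-- in f and g and, up to sign, symmetric. With respect to the basis 1, X, …, f₁, f₁X,
-- …, f₁f₂, … of the domain, the matrix of R[X]/(f₁ ⋯ fₛ) → ∏ R[X]/(fᵢ) is block
-- triangular, so its determinant is the product of the norms of fᵢ modulo fⱼ over
-- i < j. Over ℤ this gives det Aₙ, and over the algebraic closure the resultants.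
--
-- Let W(n) be this product for the divisors of n, and let p be a prime with p ∤ m.
-- If p is odd and d ≠ e are prime to p, the norms of Φ(pʲd) modulo Φ(pⁱe) can be
-- extracted from those of Φ_d(X^pʲ) = ∏_{k ≤ j} Φ(pᵏd) modulo Φₑ(X^pⁱ). Indeed,
-- substituting X^p for X in both arguments raises a norm to the p-th power, and
-- substituting it in g only does not change the norm of g modulo Φₑ, because X ↦ X^p
-- is an automorphism of ℤ[X]/(Φₑ). One obtains 1 for i ≠ j, and the power of the norm
-- of Φ_d modulo Φₑ with exponent φ(pⁱ) for i = j. Together with
-- (X^(pM) - 1)/(X^M - 1) ≡ p modulo X^M - 1, where M = pᵏ⁻¹m, this gives by induction
-- W(pᵏm) = W(m)^(pᵏ) p^(m (1 + p + … + pᵏ⁻¹)). The powers of 2, which carry the sign,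
-- only require the latter congruence.

module Submission where

open import Defs
open import Level using (_⊔_)
open import Algebra.Apartness.Bundles using (module HeytingField)
open import Algebra.Bundles using (CommutativeMonoid; CommutativeRing)
open import Algebra.Morphism.Structures using (module RingMorphisms)
import Algebra.Solver.Ring.NaturalCoefficients.Default
open import Data.Bool.Base using (if_then_else_)
open import Data.Fin.Base as Fin using (Fin; toℕ; cast; punchIn)
import Data.Fin.Properties as Fin
open import Data.Fin.Properties using (toℕ<n)
open import Data.Integer.Base as ℤ using (ℤ; +_; -1ℤ; 0ℤ; 1ℤ)
import Data.Integer.Properties as ℤ
open import Data.List.Base
  using (List; []; _∷_; [_]; _++_; map; replicate; length; take; applyUpTo; upTo; concatMap; foldr;
         tabulate; filter; lookup; cartesianProduct)
open import Data.List.Membership.Propositional using (_∈_)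
open import Data.List.Membership.Propositional.Properties
  using (∈-filter⁺; ∈-filter⁻; ∈-applyUpTo⁺; ∈-map⁺; ∈-map⁻; ∈-++⁺ˡ; ∈-++⁺ʳ; ∈-++⁻; ∈-upTo⁺; ∈-upTo⁻)
open import Data.List.Membership.Propositional.Properties.WithK using (unique∧set⇒bag)
import Data.List.Properties as List
open import Data.List.Properties using (length-++; length-map; length-replicate; length-take; length-applyUpTo)
open import Data.List.Relation.Binary.BagAndSetEquality using (∼bag⇒↭)
open import Data.List.Relation.Binary.Permutation.Propositional as ↭ using (_↭_)
open import Data.List.Relation.Unary.All as All using ([]; _∷_)
open import Data.List.Relation.Unary.AllPairs using (AllPairs; []; _∷_)
import Data.List.Relation.Unary.AllPairs.Properties as AllPairs
open import Data.List.Relation.Unary.Any using (here; there)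
open import Data.List.Relation.Unary.Unique.Propositional using (Unique)
import Data.List.Relation.Unary.Unique.Propositional.Properties as Unique
open import Data.Nat.Base as ℕ using (ℕ; zero; suc; _<_; _≤_; s≤s; z≤n; z<s; s<s; _∸_; NonZero; pred)
open import Data.Nat.Coprimality using (Coprime; coprime-Bézout)
open import Data.Nat.Divisibility
  using (_∣_; _∣?_; divides; ∣⇒≤; ∣-refl; ∣-trans; 0∣⇒≡0; 1∣_; _∣0; ∣1⇒≡1; m∣m*n; n∣m*n; *-monoʳ-∣; *-cancelˡ-∣;
         ∣m∣n⇒∣m+n)
import Data.Nat.DivMod as ℕ
open import Data.Nat.GCD using (gcd; gcd[m,n]∣m; gcd[m,n]∣n; gcd-comm; gcd-GCD; gcd[m,n]≡0⇒m≡0; module Bézout)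
open import Data.Nat.Induction using (<-rec; <-wellFounded)
open import Data.Nat.ListAction using (product)
open import Data.Nat.Primality using (Prime; euclidsLemma; prime[2]; prime⇒irreducible; prime⇒nonZero; prime⇒nonTrivial)
import Data.Nat.Properties as ℕ
import Data.Nat.Solver
open import Data.Product.Base using (∃-syntax; _×_; _,_; proj₁; proj₂)
import Data.Rational.Base as ℚ
import Data.Rational.Properties as ℚ
open import Data.Rational.Unnormalised.Base using (mkℚᵘ; *≡*)
import Data.Rational.Unnormalised.Properties as ℚᵘ
open import Data.Sum.Base using (_⊎_; inj₁; inj₂)
open import Function.Base using (_∘_; id)
open import Function.Bundles using (mk⇔)
open import Function.Definitions using (Injective)
import Induction.WellFounded as WF
open import Relation.Binary.Definitions using (Tri; tri<; tri≈; tri>)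
open import Relation.Binary.PropositionalEquality as ≡ using (_≡_; _≢_)
import Relation.Binary.Reasoning.Setoid
open import Relation.Binary.Structures using (IsEquivalence)
open import Relation.Nullary using (Dec; yes; no; ¬_; contradiction; does; ¬?)
open import Relation.Unary using (Pred; Decidable)

open Data.Nat.Solver.+-*-Solver using ()
  renaming (solve to solveℕ; _:+_ to _:+:_; _:*_ to _:*:_; _:=_ to _:=:_; con to conℕ)

-- Roots enter only where resultants over the algebraic closure are compared with norms; everything
-- else is an identity between determinants over ℤ. The price is that every quotient has to be a
-- cancellation, and two places depend on one: the division in the definition of `Φ`, which must be
-- shown exact, and the extraction of single norms from those of the towers. Both rest on the same
-- fact: for k ≠ l some nonzero integer lies in the ideal of Φₖ and Φₗ, so these polynomials are
-- coprime over ℚ and the norm of one modulo the other is nonzero.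
--
-- The other obstacle is the order of the divisors. The theorem orders each pair by size, whereas
-- the induction on the power of p adds the multiples of the new power after all earlier divisors,
-- and norms are symmetric only up to sign. For odd p the two orders can disagree only on pairs pⁱd,
-- pʲe with i ≠ j and d ≠ e, whose norms are 1 in both directions. The prime 2 is handled alone,
-- with m = 1, where size and exponent give the same order; the odd primes are then attached to the
-- power of 2.

-- Matrices are indexed by ℕ, only an initial block being relevant: this avoids
-- casts between types such as Fin (m + n). Accordingly skip is Fin.punchIn.
skip : ℕ → ℕ → ℕ
skip zero    k       = suc k
skip (suc j) zero    = zero
skip (suc j) (suc k) = suc (skip j k)

skip-< : ∀ j {k n} → k < n → skip j k < suc n
skip-< zero            k<n       = s<s k<n
skip-< (suc j) {zero}  k<n       = z<s
skip-< (suc j) {suc k} (s<s k<n) = s<s (skip-< j k<n)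

skip-<⁻¹ : ∀ {j k n} → j < suc n → skip j k < suc n → k < n
skip-<⁻¹ {zero}                  _          (s<s k<n) = k<n
skip-<⁻¹ {suc j} {zero}  {suc n} _          _         = z<s
skip-<⁻¹ {suc j} {zero}  {zero}  (s<s ())
skip-<⁻¹ {suc j} {suc k} {suc n} (s<s j<)   (s<s lt)  = s<s (skip-<⁻¹ j< lt)
skip-<⁻¹ {suc j} {suc k} {zero}  (s<s ())

skip-≢ : ∀ j k → skip j k ≢ j
skip-≢ (suc j) (suc k) eq = skip-≢ j k (ℕ.suc-injective eq)

skip-injective : ∀ j {k l} → skip j k ≡ skip j l → k ≡ l
skip-injective zero                    eq = ℕ.suc-injective eq
skip-injective (suc j) {zero}  {zero}  eq = ≡.refl
skip-injective (suc j) {suc k} {suc l} eq = ≡.cong suc (skip-injective j (ℕ.suc-injective eq))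

data Skip (j : ℕ) : ℕ → Set where
  here  : Skip j j
  there : ∀ k → Skip j (skip j k)

skip? : ∀ j c → Skip j c
skip? zero    zero    = here
skip? zero    (suc c) = there c
skip? (suc j) zero    = there zero
skip? (suc j) (suc c) with skip? j c
... | here    = here
... | there k = there (suc k)

-- Made for a matrix whose adjacent columns c and c + 1 agree: deleting column j either removes one
-- of the two or leaves both, still adjacent, in the minor.
data Skip₂ (c : ℕ) : ℕ → Set where
  at     : Skip₂ c c
  after  : Skip₂ c (suc c)
  beside : ∀ {j} k → skip j k ≡ c → skip j (suc k) ≡ suc c → Skip₂ c j

skip₂? : ∀ c j → Skip₂ c j
skip₂? zero    zero          = at
skip₂? zero    (suc zero)    = after
skip₂? zero    (suc (suc j)) = beside zero ≡.refl ≡.refl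
skip₂? (suc c) zero          = beside c ≡.refl ≡.refl
skip₂? (suc c) (suc j) with skip₂? c j
... | at                = at
... | after             = after
... | beside k eq₁ eq₂  = beside (suc k) (≡.cong suc eq₁) (≡.cong suc eq₂)

skip-adjacent : ∀ c k → skip c k ≡ skip (suc c) k ⊎ (skip c k ≡ suc c × skip (suc c) k ≡ c)
skip-adjacent zero    zero    = inj₂ (≡.refl , ≡.refl)
skip-adjacent zero    (suc k) = inj₁ ≡.refl
skip-adjacent (suc c) zero    = inj₁ ≡.refl
skip-adjacent (suc c) (suc k) with skip-adjacent c k
... | inj₁ eq          = inj₁ (≡.cong suc eq)
... | inj₂ (eq₁ , eq₂) = inj₂ (≡.cong suc eq₁ , ≡.cong suc eq₂)

module Sums {c ℓ} (R : CommutativeRing c ℓ) where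
  open CommutativeRing R
  open import Relation.Binary.Reasoning.Setoid setoid
  open import Algebra.Properties.CommutativeSemigroup +-commutativeSemigroup using (interchange)

  ∑ : ℕ → (ℕ → Carrier) → Carrier
  ∑ zero    f = 0#
  ∑ (suc n) f = f 0 + ∑ n (f ∘ suc)

  ∑-cong : ∀ n {f g} → (∀ i → i < n → f i ≈ g i) → ∑ n f ≈ ∑ n g
  ∑-cong zero    eq = refl
  ∑-cong (suc n) eq = +-cong (eq 0 z<s) (∑-cong n λ i i<n → eq (suc i) (s<s i<n))

  ∑-zero : ∀ n {f} → (∀ i → i < n → f i ≈ 0#) → ∑ n f ≈ 0#
  ∑-zero zero    eq = refl
  ∑-zero (suc n) eq =
    trans (+-cong (eq 0 z<s) (∑-zero n λ i i<n → eq (suc i) (s<s i<n))) (+-identityˡ 0#)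

  ∑-+ : ∀ n f g → ∑ n (λ i → f i + g i) ≈ ∑ n f + ∑ n g
  ∑-+ zero    f g = sym (+-identityˡ 0#)
  ∑-+ (suc n) f g = trans (+-congˡ (∑-+ n (f ∘ suc) (g ∘ suc))) (interchange _ _ _ _)

  *-∑ : ∀ n a f → a * ∑ n f ≈ ∑ n (λ i → a * f i)
  *-∑ zero    a f = zeroʳ a
  *-∑ (suc n) a f = trans (distribˡ a _ _) (+-congˡ (*-∑ n a (f ∘ suc)))

  ∑-* : ∀ n a f → ∑ n f * a ≈ ∑ n (λ i → f i * a)
  ∑-* zero    a f = zeroˡ a
  ∑-* (suc n) a f = trans (distribʳ a _ _) (+-congˡ (∑-* n a (f ∘ suc)))

  ∑-split : ∀ m n f → ∑ (m ℕ.+ n) f ≈ ∑ m f + ∑ n (λ i → f (m ℕ.+ i))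
  ∑-split zero    n f = sym (+-identityˡ _)
  ∑-split (suc m) n f = trans (+-congˡ (∑-split m n (f ∘ suc))) (sym (+-assoc _ _ _))

  ∑-single : ∀ n {f} a → a < n → (∀ i → i < n → i ≢ a → f i ≈ 0#) → ∑ n f ≈ f a
  ∑-single (suc n) zero    _         off =
    trans (+-congˡ (∑-zero n λ i i<n → off (suc i) (s<s i<n) λ ())) (+-identityʳ _)
  ∑-single (suc n) (suc a) (s<s a<n) off = trans
    (+-cong (off 0 z<s λ ()) (∑-single n a a<n λ i i<n i≢a → off (suc i) (s<s i<n) (i≢a ∘ ℕ.suc-injective)))
    (+-identityˡ _)

  ∑-adjacent : ∀ n {f} a → suc a < n → (∀ i → i < n → i ≢ a → i ≢ suc a → f i ≈ 0#) →
               f a + f (suc a) ≈ 0# → ∑ n f ≈ 0#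
  ∑-adjacent (suc (suc n)) {f} zero _ off eq = begin
    f 0 + (f 1 + ∑ n (λ i → f (suc (suc i))))
      ≈⟨ +-congˡ (+-congˡ (∑-zero n λ i i<n → off _ (s<s (s<s i<n)) (λ ()) (λ ()))) ⟩
    f 0 + (f 1 + 0#)  ≈⟨ +-congˡ (+-identityʳ _) ⟩
    f 0 + f 1         ≈⟨ eq ⟩
    0#                ∎
  ∑-adjacent (suc n) (suc a) (s<s a<n) off eq = trans
    (+-cong (off 0 z<s (λ ()) (λ ()))
      (∑-adjacent n a a<n (λ i i<n i≢a i≢1+a →
        off (suc i) (s<s i<n) (i≢a ∘ ℕ.suc-injective) (i≢1+a ∘ ℕ.suc-injective)) eq))
    (+-identityˡ _)

-- Determinants as alternating forms in the columns

module Det {c ℓ} (R : CommutativeRing c ℓ) where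
  open CommutativeRing R
  open Sums R
  open import Relation.Binary.Reasoning.Setoid setoid
  open import Algebra.Properties.Ring ring using (-‿distribˡ-*; -‿distribʳ-*)
  open import Algebra.Properties.AbelianGroup +-abelianGroup using (identityˡ-unique)
  open import Algebra.Solver.Ring.NaturalCoefficients.Default commutativeSemiring
    using (solve; _:+_; _:*_; _:=_; con)

  Mat : Set c
  Mat = ℕ → ℕ → Carrier

  sgn : ℕ → Carrier
  sgn zero    = 1#
  sgn (suc j) = - sgn j

  minor : ℕ → Mat → Mat
  minor j M i k = M (suc i) (skip j k)

  -- The determinant of the upper left n × n block of M.
  D : ℕ → Mat → Carrier
  D zero    M = 1#
  D (suc n) M = ∑ (suc n) λ j → sgn j * M 0 j * D n (minor j M)

  _≈⟦_,_⟧_ : Mat → ℕ → ℕ → Mat → Set ℓ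
  M ≈⟦ m , n ⟧ M′ = ∀ i j → i < m → j < n → M i j ≈ M′ i j

  D-cong : ∀ n {M M′} → M ≈⟦ n , n ⟧ M′ → D n M ≈ D n M′
  D-cong zero    eq = refl
  D-cong (suc n) {M} {M′} eq = ∑-cong (suc n)
    {λ j → sgn j * M 0 j * D n (minor j M)} {λ j → sgn j * M′ 0 j * D n (minor j M′)} λ j j<n → *-cong (*-congˡ (eq 0 j z<s j<n))
    (D-cong n λ i k i<n k<n → eq (suc i) (skip j k) (s<s i<n) (skip-< j k<n))

  -- Rows and columns are counted separately because the uniqueness proof clears rows and fixes
  -- columns one at a time, passing through forms on non-square matrices. Vanishing is asked for
  -- equal adjacent columns only, which is what the expansion along the first row yields directly.
  record Alternating (n k : ℕ) (ω : Mat → Carrier) : Set (c ⊔ ℓ) where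
    field
      ω-cong : ∀ {M M′} → M ≈⟦ n , k ⟧ M′ → ω M ≈ ω M′
      linear : ∀ {M M′ M″} a j → j < k →
               (∀ i → i < n → M i j ≈ a * M′ i j + M″ i j) →
               (∀ i l → i < n → l < k → l ≢ j → M i l ≈ M′ i l) →
               (∀ i l → i < n → l < k → l ≢ j → M i l ≈ M″ i l) →
               ω M ≈ a * ω M′ + ω M″
      alternating : ∀ {M} j → suc j < k → (∀ i → i < n → M i j ≈ M i (suc j)) → ω M ≈ 0#

  D-linear : ∀ n {M M′ M″} a j → j < n →
             (∀ i → i < n → M i j ≈ a * M′ i j + M″ i j) →
             (∀ i l → i < n → l < n → l ≢ j → M i l ≈ M′ i l) →
             (∀ i l → i < n → l < n → l ≢ j → M i l ≈ M″ i l) →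
             D n M ≈ a * D n M′ + D n M″
  D-linear (suc n) {M} {M′} {M″} a c c<n eq eq′ eq″ = begin
    ∑ (suc n) (t M)                                ≈⟨ ∑-cong (suc n) term ⟩
    ∑ (suc n) (λ j → a * t M′ j + t M″ j)          ≈⟨ ∑-+ (suc n) (λ j → a * t M′ j) (t M″) ⟩
    ∑ (suc n) (λ j → a * t M′ j) + ∑ (suc n) (t M″) ≈⟨ +-congʳ (*-∑ (suc n) a (t M′)) ⟨
    a * ∑ (suc n) (t M′) + ∑ (suc n) (t M″)        ∎
    where
    t : Mat → ℕ → Carrier
    t N j = sgn j * N 0 j * D n (minor j N)

    term : ∀ j → j < suc n → t M j ≈ a * t M′ j + t M″ j
    term j j<n with skip? j c
    ... | here = begin
      sgn j * M 0 j * D n (minor j M)                       ≈⟨ *-congʳ (*-congˡ (eq 0 z<s)) ⟩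
      sgn j * (a * M′ 0 j + M″ 0 j) * D n (minor j M)
        ≈⟨ solve 5 (λ s a x y d → s :* (a :* x :+ y) :* d := a :* (s :* x :* d) :+ s :* y :* d) refl
             (sgn j) a (M′ 0 j) (M″ 0 j) (D n (minor j M)) ⟩
      a * (sgn j * M′ 0 j * D n (minor j M)) + sgn j * M″ 0 j * D n (minor j M)
        ≈⟨ +-cong
             (*-congˡ (*-congˡ (D-cong n λ i k i<n k<n →
               eq′ (suc i) (skip j k) (s<s i<n) (skip-< j k<n) (skip-≢ j k))))
             (*-congˡ (D-cong n λ i k i<n k<n →
               eq″ (suc i) (skip j k) (s<s i<n) (skip-< j k<n) (skip-≢ j k))) ⟩
      a * t M′ j + t M″ j ∎
    ... | there k = begin
      sgn j * M 0 j * D n (minor j M)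
        ≈⟨ *-congˡ (D-linear n a k (skip-<⁻¹ j<n c<n) (λ i i<n → eq (suc i) (s<s i<n))
             (λ i l i<n l<n l≢k → eq′ (suc i) (skip j l) (s<s i<n) (skip-< j l<n) (l≢k ∘ skip-injective j))
             (λ i l i<n l<n l≢k → eq″ (suc i) (skip j l) (s<s i<n) (skip-< j l<n) (l≢k ∘ skip-injective j))) ⟩
      sgn j * M 0 j * (a * D n (minor j M′) + D n (minor j M″))
        ≈⟨ solve 5 (λ s a x d e → s :* x :* (a :* d :+ e) := a :* (s :* x :* d) :+ s :* x :* e) refl
             (sgn j) a (M 0 j) (D n (minor j M′)) (D n (minor j M″)) ⟩
      a * (sgn j * M 0 j * D n (minor j M′)) + sgn j * M 0 j * D n (minor j M″)
        ≈⟨ +-cong (*-congˡ (*-congʳ (*-congˡ (eq′ 0 j z<s j<n j≢c))))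
                  (*-congʳ (*-congˡ (eq″ 0 j z<s j<n j≢c))) ⟩
      a * t M′ j + t M″ j ∎
      where
      j≢c : j ≢ skip j k
      j≢c = skip-≢ j k ∘ ≡.sym

  -- Most minors inherit two equal adjacent columns and vanish by induction. The two that lose one
  -- of these columns coincide and carry opposite signs.
  D-alternating : ∀ n {M} j → suc j < n → (∀ i → i < n → M i j ≈ M i (suc j)) → D n M ≈ 0#
  D-alternating (suc n) {M} c c<n eq = ∑-adjacent (suc n) c c<n off cancel
    where
    off : ∀ j → j < suc n → j ≢ c → j ≢ suc c → sgn j * M 0 j * D n (minor j M) ≈ 0#
    off j j<n j≢c j≢1+c with skip₂? c j
    ... | at    = contradiction ≡.refl j≢c
    ... | after = contradiction ≡.refl j≢1+c
    ... | beside k eq₁ eq₂ = trans (*-congˡ (D-alternating n k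
      (skip-<⁻¹ j<n (≡.subst (_< suc n) (≡.sym eq₂) c<n))
      λ i i<n → trans (reflexive (≡.cong (M (suc i)) eq₁))
        (trans (eq (suc i) (s<s i<n)) (reflexive (≡.cong (M (suc i)) (≡.sym eq₂)))))) (zeroʳ _)

    minors : D n (minor (suc c) M) ≈ D n (minor c M)
    minors = D-cong n λ i k i<n k<n → entry i k i<n
      where
      entry : ∀ i k → i < n → minor (suc c) M i k ≈ minor c M i k
      entry i k i<n with skip-adjacent c k
      ... | inj₁ e         = reflexive (≡.cong (M (suc i)) (≡.sym e))
      ... | inj₂ (e₁ , e₂) = trans (reflexive (≡.cong (M (suc i)) e₂))
              (trans (eq (suc i) (s<s i<n)) (reflexive (≡.cong (M (suc i)) (≡.sym e₁))))

    cancel : sgn c * M 0 c * D n (minor c M) + - sgn c * M 0 (suc c) * D n (minor (suc c) M) ≈ 0#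
    cancel = begin
      sgn c * M 0 c * D n (minor c M) + - sgn c * M 0 (suc c) * D n (minor (suc c) M)
        ≈⟨ +-congˡ (*-cong (*-congˡ (sym (eq 0 z<s))) minors) ⟩
      sgn c * M 0 c * D n (minor c M) + - sgn c * M 0 c * D n (minor c M)
        ≈⟨ solve 4 (λ s t x d → s :* x :* d :+ t :* x :* d := (s :+ t) :* (x :* d)) refl
             (sgn c) (- sgn c) (M 0 c) (D n (minor c M)) ⟩
      (sgn c + - sgn c) * (M 0 c * D n (minor c M))  ≈⟨ *-congʳ (-‿inverseʳ _) ⟩
      0# * (M 0 c * D n (minor c M))                 ≈⟨ zeroˡ _ ⟩
      0#                                             ∎

  infixr 5 _∷ᶜ_ _∷ʳ_

  _∷ᶜ_ : (ℕ → Carrier) → Mat → Mat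
  (u ∷ᶜ M) i zero    = u i
  (u ∷ᶜ M) i (suc j) = M i j

  _∷ʳ_ : (ℕ → Carrier) → Mat → Mat
  (u ∷ʳ M) zero    j = u j
  (u ∷ʳ M) (suc i) j = M i j

  𝟎 : ℕ → Carrier
  𝟎 _ = 0#

  e₀ : ℕ → Carrier
  e₀ zero    = 1#
  e₀ (suc _) = 0#

  I : Mat
  I zero    zero    = 1#
  I zero    (suc j) = 0#
  I (suc i) zero    = 0#
  I (suc i) (suc j) = I i j

  I-≡ : ∀ i → I i i ≡ 1#
  I-≡ zero    = ≡.refl
  I-≡ (suc i) = I-≡ i

  I-≢ : ∀ {i j} → i ≢ j → I i j ≡ 0#
  I-≢ {zero}  {zero}  i≢j = contradiction ≡.refl i≢j
  I-≢ {zero}  {suc j} i≢j = ≡.refl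
  I-≢ {suc i} {zero}  i≢j = ≡.refl
  I-≢ {suc i} {suc j} i≢j = I-≢ (i≢j ∘ ≡.cong suc)

  module _ {n k ω} (alt : Alternating n (suc k) ω) where
    open Alternating alt

    fixColumn : ∀ u → Alternating n k (λ M → ω (u ∷ᶜ M))
    fixColumn u = record
      { ω-cong = λ eq → ω-cong λ where
          i zero    i<n j<k       → refl
          i (suc j) i<n (s<s j<k) → eq i j i<n j<k
      ; linear = λ a j j<k eq eq′ eq″ → linear a (suc j) (s<s j<k) eq
          (λ where
            i zero    i<n l<k l≢j       → refl
            i (suc l) i<n (s<s l<k) l≢j → eq′ i l i<n l<k (l≢j ∘ ≡.cong suc))
          (λ where
            i zero    i<n l<k l≢j       → refl
            i (suc l) i<n (s<s l<k) l≢j → eq″ i l i<n l<k (l≢j ∘ ≡.cong suc))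
      ; alternating = λ j j<k eq → alternating (suc j) (s<s j<k) eq
      }

  fixRow : ∀ {n k ω} → Alternating (suc n) k ω → Alternating n k (λ M → ω (𝟎 ∷ʳ M))
  fixRow alt = record
    { ω-cong = λ eq → ω-cong λ where
        zero    j i<n       j<k → refl
        (suc i) j (s<s i<n) j<k → eq i j i<n j<k
    ; linear = λ a j j<k eq eq′ eq″ → linear a j j<k
        (λ where
          zero    i<n       → sym (trans (+-identityʳ _) (zeroʳ _))
          (suc i) (s<s i<n) → eq i i<n)
        (λ where
          zero    l i<n       l<k l≢j → refl
          (suc i) l (s<s i<n) l<k l≢j → eq′ i l i<n l<k l≢j)
        (λ where
          zero    l i<n       l<k l≢j → refl
          (suc i) l (s<s i<n) l<k l≢j → eq″ i l i<n l<k l≢j)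
    ; alternating = λ j j<k eq → alternating j j<k λ where
        zero    i<n       → refl
        (suc i) (s<s i<n) → eq i i<n
    }
    where open Alternating alt

  module _ {n k ω} (alt : Alternating n (suc (suc k)) ω) where
    open Alternating alt

    private
      _⊞_ : (ℕ → Carrier) → (ℕ → Carrier) → ℕ → Carrier
      (u ⊞ v) i = u i + v i

    swap-columns : ∀ u v M → ω (u ∷ᶜ v ∷ᶜ M) ≈ - ω (v ∷ᶜ u ∷ᶜ M)
    swap-columns u v M = begin
      ω (u ∷ᶜ v ∷ᶜ M)                              ≈⟨ +-identityˡ _ ⟨
      0# + ω (u ∷ᶜ v ∷ᶜ M)                         ≈⟨ +-congʳ (-‿inverseˡ _) ⟨
      - ω (v ∷ᶜ u ∷ᶜ M) + ω (v ∷ᶜ u ∷ᶜ M) + ω (u ∷ᶜ v ∷ᶜ M) ≈⟨ +-assoc _ _ _ ⟩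
      - ω (v ∷ᶜ u ∷ᶜ M) + (ω (v ∷ᶜ u ∷ᶜ M) + ω (u ∷ᶜ v ∷ᶜ M)) ≈⟨ +-congˡ (trans (+-comm _ _) total) ⟩
      - ω (v ∷ᶜ u ∷ᶜ M) + 0#                       ≈⟨ +-identityʳ _ ⟩
      - ω (v ∷ᶜ u ∷ᶜ M)                            ∎
      where
      split₀ : ∀ u v w → ω ((u ⊞ v) ∷ᶜ w ∷ᶜ M) ≈ ω (u ∷ᶜ w ∷ᶜ M) + ω (v ∷ᶜ w ∷ᶜ M)
      split₀ u v w = trans (linear 1# 0 z<s (λ i _ → +-congʳ (sym (*-identityˡ _)))
        (λ where i zero _ _ 0≢0 → contradiction ≡.refl 0≢0
                 i (suc l) _ _ _ → refl)
        (λ where i zero _ _ 0≢0 → contradiction ≡.refl 0≢0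
                 i (suc l) _ _ _ → refl)) (+-congʳ (*-identityˡ _))
      split₁ : ∀ w u v → ω (w ∷ᶜ (u ⊞ v) ∷ᶜ M) ≈ ω (w ∷ᶜ u ∷ᶜ M) + ω (w ∷ᶜ v ∷ᶜ M)
      split₁ w u v = trans (linear 1# 1 (s<s z<s) (λ i _ → +-congʳ (sym (*-identityˡ _)))
        (λ where i zero _ _ _ → refl
                 i (suc zero) _ _ 1≢1 → contradiction ≡.refl 1≢1
                 i (suc (suc l)) _ _ _ → refl)
        (λ where i zero _ _ _ → refl
                 i (suc zero) _ _ 1≢1 → contradiction ≡.refl 1≢1
                 i (suc (suc l)) _ _ _ → refl)) (+-congʳ (*-identityˡ _))
      vanish : ∀ u → ω (u ∷ᶜ u ∷ᶜ M) ≈ 0#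
      vanish u = alternating 0 (s<s z<s) λ _ _ → refl
      total : ω (u ∷ᶜ v ∷ᶜ M) + ω (v ∷ᶜ u ∷ᶜ M) ≈ 0#
      total = begin
        ω (u ∷ᶜ v ∷ᶜ M) + ω (v ∷ᶜ u ∷ᶜ M)
          ≈⟨ +-cong (trans (split₁ u u v) (trans (+-congʳ (vanish u)) (+-identityˡ _)))
                    (trans (split₁ v u v) (trans (+-congˡ (vanish v)) (+-identityʳ _))) ⟨
        ω (u ∷ᶜ (u ⊞ v) ∷ᶜ M) + ω (v ∷ᶜ (u ⊞ v) ∷ᶜ M) ≈⟨ split₀ u v (u ⊞ v) ⟨
        ω ((u ⊞ v) ∷ᶜ (u ⊞ v) ∷ᶜ M)                   ≈⟨ vanish _ ⟩
        0# ∎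

  -- Each column is a multiple of `e₀` plus a column with zero on top. Expanding multilinearly, the
  -- terms with two columns `e₀` vanish; what remains has none, or exactly one, which the sign moves
  -- to the front.
  expand-row : ∀ {n} k {ω} → Alternating (suc n) k ω → ∀ M →
    ω M ≈ ω (𝟎 ∷ʳ M ∘ suc) + ∑ k (λ j → sgn j * M 0 j * ω (e₀ ∷ᶜ 𝟎 ∷ʳ minor j M))
  expand-row zero alt M = sym (trans (+-identityʳ _) (Alternating.ω-cong alt λ _ _ _ ()))
  expand-row {n} (suc k) {ω} alt M = begin
    ω M
      ≈⟨ linear (M 0 0) 0 z<s
           (λ where zero    _ → sym (trans (+-identityʳ _) (*-identityʳ _))
                    (suc i) _ → sym (trans (+-congʳ (zeroʳ _)) (+-identityˡ _)))
           (λ where i zero _ _ 0≢0 → contradiction ≡.refl 0≢0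
                    i (suc l) _ _ _ → refl)
           (λ where i zero _ _ 0≢0 → contradiction ≡.refl 0≢0
                    i (suc l) _ _ _ → refl) ⟩
    M 0 0 * ω (e₀ ∷ᶜ M→) + ω (u ∷ᶜ M→)
      ≈⟨ +-cong (*-congˡ first) rest ⟩
    M 0 0 * W 0 + (ω (𝟎 ∷ʳ M ∘ suc) + S)
      ≈⟨ solve 3 (λ x y z → x :+ (y :+ z) := y :+ (x :+ z)) refl _ _ _ ⟩
    ω (𝟎 ∷ʳ M ∘ suc) + (M 0 0 * W 0 + S)
      ≈⟨ +-congˡ (+-congʳ (*-congʳ (sym (*-identityˡ _)))) ⟩
    ω (𝟎 ∷ʳ M ∘ suc) + (1# * M 0 0 * W 0 + S) ∎
    where
    open Alternating alt
    M→ : Mat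
    M→ i j = M i (suc j)
    u : ℕ → Carrier
    u zero    = 0#
    u (suc i) = M (suc i) 0
    W : ℕ → Carrier
    W j = ω (e₀ ∷ᶜ 𝟎 ∷ʳ minor j M)
    S : Carrier
    S = ∑ k (λ j → - sgn j * M 0 (suc j) * W (suc j))

    first : ω (e₀ ∷ᶜ M→) ≈ W 0
    first = begin
      ω (e₀ ∷ᶜ M→) ≈⟨ expand-row k (fixColumn alt e₀) M→ ⟩
      ω (e₀ ∷ᶜ 𝟎 ∷ʳ M→ ∘ suc) + ∑ k (λ j → sgn j * M 0 (suc j) * ω (e₀ ∷ᶜ e₀ ∷ᶜ 𝟎 ∷ʳ minor j M→))
        ≈⟨ +-congˡ (∑-zero k λ j j<k →
             trans (*-congˡ (alternating 0 (s<s (ℕ.≤-<-trans z≤n j<k)) λ _ _ → refl)) (zeroʳ _)) ⟩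
      W 0 + 0# ≈⟨ +-identityʳ _ ⟩
      W 0 ∎

    swapped : ∀ {j} → j < k → ω (u ∷ᶜ e₀ ∷ᶜ 𝟎 ∷ʳ minor j M→) ≈ - W (suc j)
    swapped {j} (s≤s _) = trans (swap-columns alt u e₀ _) (-‿cong (ω-cong λ where
      zero    zero          _ _ → refl
      (suc i) zero          _ _ → refl
      zero    (suc zero)    _ _ → refl
      zero    (suc (suc l)) _ _ → refl
      (suc i) (suc zero)    _ _ → refl
      (suc i) (suc (suc l)) _ _ → refl))

    rest : ω (u ∷ᶜ M→) ≈ ω (𝟎 ∷ʳ M ∘ suc) + S
    rest = begin
      ω (u ∷ᶜ M→) ≈⟨ expand-row k (fixColumn alt u) M→ ⟩
      ω (u ∷ᶜ 𝟎 ∷ʳ M→ ∘ suc) + ∑ k (λ j → sgn j * M 0 (suc j) * ω (u ∷ᶜ e₀ ∷ᶜ 𝟎 ∷ʳ minor j M→))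
        ≈⟨ +-cong
             (ω-cong λ where
               zero    zero    _ _ → refl
               zero    (suc j) _ _ → refl
               (suc i) zero    _ _ → refl
               (suc i) (suc j) _ _ → refl)
             (∑-cong k λ j j<k → begin
               sgn j * M 0 (suc j) * ω (u ∷ᶜ e₀ ∷ᶜ 𝟎 ∷ʳ minor j M→) ≈⟨ *-congˡ (swapped j<k) ⟩
               sgn j * M 0 (suc j) * - W (suc j)                    ≈⟨ -‿distribʳ-* _ _ ⟨
               - (sgn j * M 0 (suc j) * W (suc j))                  ≈⟨ -‿distribˡ-* _ _ ⟩
               - (sgn j * M 0 (suc j)) * W (suc j)                  ≈⟨ *-congʳ (-‿distribˡ-* _ _) ⟩
               - sgn j * M 0 (suc j) * W (suc j)                    ∎) ⟩
      ω (𝟎 ∷ʳ M ∘ suc) + S ∎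

  -- Each expansion uses up one row and at most one column, so columns outlast the rows. With no row
  -- left, the conditions of `linear` hold vacuously and give ω M = ω M + ω M.
  alternating-vanishes : ∀ n {k ω} → n < k → Alternating n k ω → ∀ M → ω M ≈ 0#
  alternating-vanishes zero {k} {ω} 0<k alt M = identityˡ-unique (ω M) (ω M) (sym (trans
    (Alternating.linear alt {M} {M} {M} 1# 0 0<k (λ _ ()) (λ _ _ ()) (λ _ _ ()))
    (+-congʳ (*-identityˡ _))))
  alternating-vanishes (suc n) {suc k} {ω} (s<s n<k) alt M = begin
    ω M ≈⟨ expand-row (suc k) alt M ⟩
    ω (𝟎 ∷ʳ M ∘ suc) + ∑ (suc k) (λ j → sgn j * M 0 j * ω (e₀ ∷ᶜ 𝟎 ∷ʳ minor j M))
      ≈⟨ +-cong (alternating-vanishes n (ℕ.m<n⇒m<1+n n<k) (fixRow alt) _)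
           (∑-zero (suc k) {λ j → sgn j * M 0 j * ω (e₀ ∷ᶜ 𝟎 ∷ʳ minor j M)} λ j _ → trans
             (*-congˡ (alternating-vanishes n n<k (fixRow (fixColumn alt e₀)) _)) (zeroʳ _)) ⟩
    0# + 0# ≈⟨ +-identityˡ 0# ⟩
    0# ∎

  -- Expansion along the first row reproduces the recursion that defines `D`; the extra term has one
  -- column more than rows and vanishes. Applied to the form B ↦ D(AB), this makes `D`
  -- multiplicative.
  alternating-unique : ∀ n {ω} → Alternating n n ω → ∀ M → ω M ≈ ω I * D n M
  alternating-unique zero    alt M = trans (Alternating.ω-cong alt λ _ _ ()) (sym (*-identityʳ _))
  alternating-unique (suc n) {ω} alt M = begin
    ω M ≈⟨ expand-row (suc n) alt M ⟩
    ω (𝟎 ∷ʳ M ∘ suc) + ∑ (suc n) (λ j → sgn j * M 0 j * ω (e₀ ∷ᶜ 𝟎 ∷ʳ minor j M))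
      ≈⟨ +-cong (alternating-vanishes n ℕ.≤-refl (fixRow alt) _)
           (∑-cong (suc n) {λ j → sgn j * M 0 j * ω (e₀ ∷ᶜ 𝟎 ∷ʳ minor j M)} λ j _ → begin
             sgn j * M 0 j * ω (e₀ ∷ᶜ 𝟎 ∷ʳ minor j M)
               ≈⟨ *-congˡ (alternating-unique n (fixRow (fixColumn alt e₀)) (minor j M)) ⟩
             sgn j * M 0 j * (ω (e₀ ∷ᶜ 𝟎 ∷ʳ I) * D n (minor j M))
               ≈⟨ *-congˡ (*-congʳ (Alternating.ω-cong alt λ where
                    zero    zero    _ _ → refl
                    zero    (suc _) _ _ → refl
                    (suc _) zero    _ _ → refl
                    (suc _) (suc _) _ _ → refl)) ⟩
             sgn j * M 0 j * (ω I * D n (minor j M))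
               ≈⟨ solve 3 (λ x y z → x :* (y :* z) := y :* (x :* z)) refl _ _ _ ⟩
             ω I * (sgn j * M 0 j * D n (minor j M)) ∎) ⟩
    0# + ∑ (suc n) (λ j → ω I * (sgn j * M 0 j * D n (minor j M)))  ≈⟨ +-identityˡ _ ⟩
    ∑ (suc n) (λ j → ω I * (sgn j * M 0 j * D n (minor j M)))       ≈⟨ *-∑ (suc n) (ω I) (λ j → sgn j * M 0 j * D n (minor j M)) ⟨
    ω I * D (suc n) M ∎

  mul : ℕ → Mat → Mat → Mat
  mul n A B i j = ∑ n (λ k → A i k * B k j)

  mul-alt : ∀ n A → Alternating n n (λ B → D n (mul n A B))
  mul-alt n A = record
    { ω-cong = λ eq → D-cong n λ i j _ j<n → ∑-cong n λ k k<n → *-congˡ (eq k j k<n j<n)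
    ; linear = λ {M} {M′} {M″} a j j<n eq eq′ eq″ → D-linear n a j j<n
        (λ i i<n → begin
          ∑ n (λ k → A i k * M k j)
            ≈⟨ ∑-cong n (λ k k<n → trans (*-congˡ (eq k k<n))
                 (solve 4 (λ x a y z → x :* (a :* y :+ z) := a :* (x :* y) :+ x :* z) refl _ _ _ _)) ⟩
          ∑ n (λ k → a * (A i k * M′ k j) + A i k * M″ k j)  ≈⟨ ∑-+ n _ _ ⟩
          ∑ n (λ k → a * (A i k * M′ k j)) + mul n A M″ i j  ≈⟨ +-congʳ (*-∑ n a _) ⟨
          a * mul n A M′ i j + mul n A M″ i j                ∎)
        (λ i l _ l<n l≢j → ∑-cong n λ k k<n → *-congˡ (eq′ k l k<n l<n l≢j))
        (λ i l _ l<n l≢j → ∑-cong n λ k k<n → *-congˡ (eq″ k l k<n l<n l≢j))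
    ; alternating = λ j j<n eq → D-alternating n j j<n λ i _ →
        ∑-cong n λ k k<n → *-congˡ (eq k k<n)
    }

  mul-I : ∀ n A → mul n A I ≈⟦ n , n ⟧ A
  mul-I n A i j _ j<n = begin
    ∑ n (λ k → A i k * I k j)
      ≈⟨ ∑-single n j j<n (λ k _ k≢j → trans (*-congˡ (reflexive (I-≢ k≢j))) (zeroʳ _)) ⟩
    A i j * I j j ≈⟨ *-congˡ (reflexive (I-≡ j)) ⟩
    A i j * 1#    ≈⟨ *-identityʳ _ ⟩
    A i j         ∎

  D-mul : ∀ n A B → D n (mul n A B) ≈ D n A * D n B
  D-mul n A B = trans (alternating-unique n (mul-alt n A) B) (*-congʳ (D-cong n (mul-I n A)))

  D-zero-column : ∀ n {M} j → j < n → (∀ i → i < n → M i j ≈ 0#) → D n M ≈ 0#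
  D-zero-column n {M} j j<n eq = identityˡ-unique (D n M) (D n M) (sym (trans
    (D-linear n {M} {M} {M} 1# j j<n
      (λ i i<n → trans (eq i i<n) (sym (trans (+-cong (trans (*-identityˡ _) (eq i i<n)) (eq i i<n)) (+-identityˡ 0#))))
      (λ _ _ _ _ _ → refl) (λ _ _ _ _ _ → refl))
    (+-congʳ (*-identityˡ _))))

  D-unitriangular : ∀ n {M} → (∀ i → i < n → M i i ≈ 1#) →
                    (∀ i j → j < i → i < n → M i j ≈ 0#) → D n M ≈ 1#
  D-unitriangular zero    diag low = refl
  D-unitriangular (suc n) {M} diag low = begin
    D (suc n) M
      ≈⟨ ∑-single (suc n) {λ j → sgn j * M 0 j * D n (minor j M)} 0 z<s off ⟩
    1# * M 0 0 * D n (minor 0 M)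
      ≈⟨ *-cong (trans (*-identityˡ _) (diag 0 z<s))
           (D-unitriangular n (λ i i<n → diag (suc i) (s<s i<n))
             (λ i j j<i i<n → low (suc i) (suc j) (s<s j<i) (s<s i<n))) ⟩
    1# * 1# ≈⟨ *-identityˡ 1# ⟩
    1# ∎
    where
    off : ∀ j → j < suc n → j ≢ 0 → sgn j * M 0 j * D n (minor j M) ≈ 0#
    off zero    _         0≢0 = contradiction ≡.refl 0≢0
    off (suc j) (s<s j<n) _   = trans (*-congˡ (D-zero-column n 0 (ℕ.≤-<-trans z≤n j<n)
      λ i i<n → low (suc i) 0 z<s (s<s i<n))) (zeroʳ _)

  D-I : ∀ n → D n I ≈ 1#
  D-I n = D-unitriangular n (λ i _ → reflexive (I-≡ i))
    (λ i j j<i _ → reflexive (I-≢ (ℕ.>⇒≢ j<i)))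

  open import Algebra.Properties.Semiring.Exp semiring using (_^_)

  D-scalar : ∀ n a → D n (λ i j → a * I i j) ≈ a ^ n
  D-scalar zero    a = refl
  D-scalar (suc n) a = begin
    D (suc n) (λ i j → a * I i j)
      ≈⟨ ∑-single (suc n) {λ j → sgn j * (a * I 0 j) * D n (minor j (λ i j → a * I i j))} 0 z<s off ⟩
    1# * (a * 1#) * D n (λ i j → a * I i j)
      ≈⟨ *-cong (trans (*-identityˡ _) (*-identityʳ a)) (D-scalar n a) ⟩
    a * a ^ n ∎
    where
    off : ∀ j → j < suc n → j ≢ 0 → sgn j * (a * I 0 j) * D n (minor j (λ i j → a * I i j)) ≈ 0#
    off zero    _ 0≢0 = contradiction ≡.refl 0≢0
    off (suc j) _ _   = trans (*-congʳ (trans (*-congˡ (zeroʳ a)) (zeroʳ _))) (zeroˡ _)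

  skip-≥ : ∀ {j k} → j ≤ k → skip j k ≡ suc k
  skip-≥ z≤n       = ≡.refl
  skip-≥ (s≤s j≤k) = ≡.cong suc (skip-≥ j≤k)

  skip-below : ∀ {j k} → k < j → skip j k ≡ k
  skip-below {suc j} {zero}  _         = ≡.refl
  skip-below {suc j} {suc k} (s<s k<j) = ≡.cong suc (skip-below k<j)

  D-block : ∀ m n {M} → (∀ i j → i < m → j < n → M i (m ℕ.+ j) ≈ 0#) →
            D (m ℕ.+ n) M ≈ D m M * D n (λ i j → M (m ℕ.+ i) (m ℕ.+ j))
  D-block zero    n     eq = sym (*-identityˡ _)
  D-block (suc m) n {M} eq = begin
    ∑ (suc m ℕ.+ n) t
      ≈⟨ ∑-split (suc m) n t ⟩
    ∑ (suc m) t + ∑ n (λ j → t (suc m ℕ.+ j))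
      ≈⟨ +-cong (∑-cong (suc m) {t} {λ j → sgn j * M 0 j * D m (minor j M) * L} term)
                (∑-zero n λ j j<n → trans (*-congʳ (trans (*-congˡ (eq 0 j z<s j<n)) (zeroʳ _))) (zeroˡ _)) ⟩
    ∑ (suc m) (λ j → sgn j * M 0 j * D m (minor j M) * L) + 0#
      ≈⟨ +-identityʳ _ ⟩
    ∑ (suc m) (λ j → sgn j * M 0 j * D m (minor j M) * L)
      ≈⟨ ∑-* (suc m) L (λ j → sgn j * M 0 j * D m (minor j M)) ⟨
    D (suc m) M * L ∎
    where
    t : ℕ → Carrier
    t j = sgn j * M 0 j * D (m ℕ.+ n) (minor j M)
    L : Carrier
    L = D n (λ i j → M (suc m ℕ.+ i) (suc m ℕ.+ j))
    shift : ∀ {j} → j < suc m → ∀ i k → minor j M i (m ℕ.+ k) ≈ M (suc i) (suc m ℕ.+ k)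
    shift (s≤s j≤m) i k = reflexive (≡.cong (M (suc i)) (skip-≥ (ℕ.≤-trans j≤m (ℕ.m≤m+n m k))))
    term : ∀ j → j < suc m → t j ≈ sgn j * M 0 j * D m (minor j M) * L
    term j j<m = trans (*-congˡ (trans
      (D-block m n λ i k i<m k<n → trans (shift j<m i k) (eq (suc i) k (s<s i<m) k<n))
      (*-congˡ (D-cong n λ i k _ _ → shift j<m (m ℕ.+ i) k)))) (sym (*-assoc _ _ _))

  D-blocks : ∀ q m {M N} →
    (∀ b i j → b < q → i < m → suc b ℕ.* m ℕ.+ j < q ℕ.* m → M (b ℕ.* m ℕ.+ i) (suc b ℕ.* m ℕ.+ j) ≈ 0#) →
    (∀ b i j → b < q → i < m → j < m → M (b ℕ.* m ℕ.+ i) (b ℕ.* m ℕ.+ j) ≈ N i j) →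
    D (q ℕ.* m) M ≈ D m N ^ q
  D-blocks zero    m         zeros diag = refl
  D-blocks (suc q) m {M} {N} zeros diag = trans
    (D-block m (q ℕ.* m) λ i j i<m j<qm → trans
      (reflexive (≡.cong (λ k → M i (k ℕ.+ j)) (≡.sym (ℕ.+-identityʳ m))))
      (zeros 0 i j z<s i<m (≡.subst (λ k → k ℕ.+ j < suc q ℕ.* m) (≡.sym (ℕ.+-identityʳ m))
        (ℕ.+-monoʳ-< m j<qm))))
    (*-cong (D-cong m λ i j i<m j<m → diag 0 i j z<s i<m j<m)
      (D-blocks q m
        (λ b i j b<q i<m lt → trans
          (reflexive (≡.cong₂ M (≡.sym (ℕ.+-assoc m _ i)) (≡.sym (ℕ.+-assoc m _ j))))
          (zeros (suc b) i j (s<s b<q) i<m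
            (≡.subst (_< suc q ℕ.* m) (≡.sym (ℕ.+-assoc m _ j)) (ℕ.+-monoʳ-< m lt))))
        (λ b i j b<q i<m j<m → trans
          (reflexive (≡.cong₂ M (≡.sym (ℕ.+-assoc m _ i)) (≡.sym (ℕ.+-assoc m _ j))))
          (diag (suc b) i j (s<s b<q) i<m j<m))))

  D-rows : ∀ n (π : ℕ → ℕ) M → (∀ i → i < n → π i < n) →
           D n (λ i j → M (π i) j) ≈ D n (λ i j → I (π i) j) * D n M
  D-rows n π M π< = trans (D-cong n λ i j i<n j<n → sym (begin
    ∑ n (λ k → I (π i) k * M k j)
      ≈⟨ ∑-single n (π i) (π< i i<n) (λ k _ k≢ → trans (*-congʳ (reflexive (I-≢ (k≢ ∘ ≡.sym)))) (zeroˡ _)) ⟩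
    I (π i) (π i) * M (π i) j ≈⟨ *-congʳ (reflexive (I-≡ (π i))) ⟩
    1# * M (π i) j            ≈⟨ *-identityˡ _ ⟩
    M (π i) j                 ∎)) (D-mul n (λ i j → I (π i) j) M)

  D-columns : ∀ n (π : ℕ → ℕ) M → (∀ i → i < n → π i < n) →
              D n (λ i j → M i (π j)) ≈ D n M * D n (λ i j → I i (π j))
  D-columns n π M π< = trans (D-cong n λ i j i<n j<n → sym (begin
    ∑ n (λ k → M i k * I k (π j))
      ≈⟨ ∑-single n (π j) (π< j j<n) (λ k _ k≢ → trans (*-congˡ (reflexive (I-≢ k≢))) (zeroʳ _)) ⟩
    M i (π j) * I (π j) (π j) ≈⟨ *-congˡ (reflexive (I-≡ (π j))) ⟩
    M i (π j) * 1#            ≈⟨ *-identityʳ _ ⟩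
    M i (π j)                 ∎)) (D-mul n M (λ i j → I i (π j)))

  I-injective : ∀ (π : ℕ → ℕ) i j → (π i ≡ π j → i ≡ j) → I (π i) (π j) ≡ I i j
  I-injective π i j inj with i ℕ.≟ j
  ... | yes ≡.refl = ≡.trans (I-≡ (π i)) (≡.sym (I-≡ i))
  ... | no  i≢j    = ≡.trans (I-≢ (i≢j ∘ inj)) (≡.sym (I-≢ i≢j))

  -- The signs of π on rows and on columns cancel: their product is the determinant of the matrix
  -- with entries I (π i) (π j), and by injectivity this is the identity matrix.
  D-permute : ∀ n (π : ℕ → ℕ) M → (∀ i → i < n → π i < n) → (∀ i j → i < n → j < n → π i ≡ π j → i ≡ j) →
              D n (λ i j → M (π i) (π j)) ≈ D n M
  D-permute n π M π< inj = begin
    D n (λ i j → M (π i) (π j))                       ≈⟨ D-rows n π (λ i j → M i (π j)) π< ⟩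
    P * D n (λ i j → M i (π j))                       ≈⟨ *-congˡ (D-columns n π M π<) ⟩
    P * (D n M * Q)
      ≈⟨ solve 3 (λ p m q → p :* (m :* q) := m :* (p :* q)) refl _ _ _ ⟩
    D n M * (P * Q)                                   ≈⟨ *-congˡ (sym (D-rows n π (λ i j → I i (π j)) π<)) ⟩
    D n M * D n (λ i j → I (π i) (π j))
      ≈⟨ *-congˡ (trans (D-cong n λ i j i<n j<n → reflexive (I-injective π i j (inj i j i<n j<n))) (D-I n)) ⟩
    D n M * 1#                                        ≈⟨ *-identityʳ _ ⟩
    D n M                                             ∎
    where
    P Q : Carrier
    P = D n (λ i j → I (π i) j)
    Q = D n (λ i j → I i (π j))

  sgn-+ : ∀ a b → sgn (a ℕ.+ b) ≈ sgn a * sgn b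
  sgn-+ zero    b = sym (*-identityˡ _)
  sgn-+ (suc a) b = trans (-‿cong (sgn-+ a b)) (-‿distribˡ-* _ _)

  I-skip : ∀ j a b → I (skip j a) (skip j b) ≡ I a b
  I-skip j a b = I-injective (skip j) a b (skip-injective j)

  -- The first row has its only nonzero entry in column k, which contributes the sign of k and
  -- leaves a matrix of the same shape with m lowered by one.
  D-swap-blocks : ∀ m k {M} → (∀ i j → i < m → M i j ≈ I (k ℕ.+ i) j) →
                  (∀ i j → i < k → M (m ℕ.+ i) j ≈ I i j) → D (m ℕ.+ k) M ≈ sgn (m ℕ.* k)
  D-swap-blocks zero    k     upper lower = trans (D-cong k λ i j i<k _ → lower i j i<k) (D-I k)
  D-swap-blocks (suc m) k {M} upper lower = begin
    D (suc m ℕ.+ k) M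
      ≈⟨ ∑-single (suc (m ℕ.+ k)) {λ j → sgn j * M 0 j * D (m ℕ.+ k) (minor j M)} k
           (s≤s (ℕ.m≤n+m k m)) (λ j _ j≢k → trans (*-congʳ (trans
             (*-congˡ (trans (first j) (reflexive (I-≢ (j≢k ∘ ≡.sym))))) (zeroʳ _))) (zeroˡ _)) ⟩
    sgn k * M 0 k * D (m ℕ.+ k) (minor k M)
      ≈⟨ *-cong (trans (*-congˡ (trans (first k) (reflexive (I-≡ k)))) (*-identityʳ _))
           (D-swap-blocks m k upper′ lower′) ⟩
    sgn k * sgn (m ℕ.* k) ≈⟨ sgn-+ k (m ℕ.* k) ⟨
    sgn (k ℕ.+ m ℕ.* k)   ∎
    where
    first : ∀ j → M 0 j ≈ I k j
    first j = trans (upper 0 j z<s) (reflexive (≡.cong (λ a → I a j) (ℕ.+-identityʳ k)))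
    upper′ : ∀ i j → i < m → minor k M i j ≈ I (k ℕ.+ i) j
    upper′ i j i<m = trans (upper (suc i) (skip k j) (s<s i<m)) (reflexive (≡.trans
      (≡.cong (λ a → I a (skip k j)) (≡.trans (ℕ.+-suc k i) (≡.sym (skip-≥ (ℕ.m≤m+n k i)))))
      (I-skip k (k ℕ.+ i) j)))
    lower′ : ∀ i j → i < k → minor k M (m ℕ.+ i) j ≈ I i j
    lower′ i j i<k = trans (lower i (skip k j) i<k) (reflexive (≡.trans
      (≡.cong (λ a → I a (skip k j)) (≡.sym (skip-below i<k))) (I-skip k i j)))

  open Determinant R renaming (det to detᶠ; Matrix to Matrixᶠ)
  open import Algebra.Properties.Monoid.Sum +-monoid using (sum)

  sum≈∑ : ∀ {n} {f : Fin n → Carrier} {g} → (∀ i → f i ≈ g (toℕ i)) → sum f ≈ ∑ n g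
  sum≈∑ {zero}  eq = refl
  sum≈∑ {suc n} eq = +-cong (eq Fin.zero) (sum≈∑ (eq ∘ Fin.suc))

  sgn≈^ : ∀ j → (- 1#) ^ j ≈ sgn j
  sgn≈^ zero    = refl
  sgn≈^ (suc j) = trans (*-congˡ (sgn≈^ j)) (trans (sym (-‿distribˡ-* _ _)) (-‿cong (*-identityˡ _)))

  toℕ-punchIn : ∀ {n} (j : Fin (suc n)) k → toℕ (Fin.punchIn j k) ≡ skip (toℕ j) (toℕ k)
  toℕ-punchIn Fin.zero    k           = ≡.refl
  toℕ-punchIn (Fin.suc j) Fin.zero    = ≡.refl
  toℕ-punchIn (Fin.suc j) (Fin.suc k) = ≡.cong suc (toℕ-punchIn j k)

  det≈D : ∀ n {A : Matrixᶠ n n} {M} → (∀ i j → A i j ≈ M (toℕ i) (toℕ j)) → detᶠ A ≈ D n M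
  det≈D zero    eq = refl
  det≈D (suc n) {A} {M} eq = sum≈∑ {g = λ j → sgn j * M 0 j * D n (minor j M)} λ j →
    *-cong (*-cong (sgn≈^ (toℕ j)) (eq Fin.zero j)) (det≈D n λ i k →
      trans (eq (Fin.suc i) (Fin.punchIn j k)) (reflexive (≡.cong (M _) (toℕ-punchIn j k))))

-- Polynomials

module Polys {c ℓ} (R : CommutativeRing c ℓ) where
  open CommutativeRing R
  open Polynomial R
  open Sums R
  open import Algebra.Properties.Ring ring using (-‿distribˡ-*; -0#≈0#)
  open import Algebra.Properties.CommutativeSemigroup +-commutativeSemigroup
    using () renaming (interchange to +-interchange)
  open import Algebra.Properties.CommutativeSemigroup *-commutativeSemigroup using (x∙yz≈y∙xz)

  -- The polynomial equality of Defs is a function type, from which the two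
  -- polynomials cannot be inferred.
  infix 4 _≃_
  record _≃_ (p q : Poly) : Set ℓ where
    constructor mk
    field coeffs : p ≋ q
  open _≃_ public

  ≃-refl : ∀ {p} → p ≃ p
  ≃-refl = mk λ i → refl

  ≃-sym : ∀ {p q} → p ≃ q → q ≃ p
  ≃-sym (mk eq) = mk λ i → sym (eq i)

  ≃-trans : ∀ {p q r} → p ≃ q → q ≃ r → p ≃ r
  ≃-trans (mk eq) (mk eq′) = mk λ i → trans (eq i) (eq′ i)

  coeff-⊕ : ∀ p q i → coeff (p ⊕ q) i ≈ coeff p i + coeff q i
  coeff-⊕ []      q       i       = sym (+-identityˡ _)
  coeff-⊕ (a ∷ p) []      i       = sym (+-identityʳ _)
  coeff-⊕ (a ∷ p) (b ∷ q) zero    = refl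
  coeff-⊕ (a ∷ p) (b ∷ q) (suc i) = coeff-⊕ p q i

  coeff-· : ∀ a p i → coeff (a · p) i ≈ a * coeff p i
  coeff-· a []      i       = sym (zeroʳ a)
  coeff-· a (b ∷ p) zero    = refl
  coeff-· a (b ∷ p) (suc i) = coeff-· a p i

  ⊝_ : Poly → Poly
  ⊝_ = map (-_)

  coeff-⊝ : ∀ p i → coeff (⊝ p) i ≈ - coeff p i
  coeff-⊝ []      i       = sym -0#≈0#
  coeff-⊝ (b ∷ p) zero    = refl
  coeff-⊝ (b ∷ p) (suc i) = coeff-⊝ p i

  ∷-cong : ∀ {a b p q} → a ≈ b → p ≃ q → a ∷ p ≃ b ∷ q
  ∷-cong a≈b (mk eq) = mk λ { zero → a≈b ; (suc i) → eq i }

  0∷[]≃[] : 0# ∷ [] ≃ []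
  0∷[]≃[] = mk λ { zero → refl ; (suc i) → refl }

  ⊕-cong : ∀ {p q r s} → p ≃ q → r ≃ s → p ⊕ r ≃ q ⊕ s
  ⊕-cong {p} {q} {r} {s} (mk eq) (mk eq′) = mk λ i →
    trans (coeff-⊕ p r i) (trans (+-cong (eq i) (eq′ i)) (sym (coeff-⊕ q s i)))

  ⊕-comm : ∀ p q → p ⊕ q ≃ q ⊕ p
  ⊕-comm p q = mk λ i → trans (coeff-⊕ p q i) (trans (+-comm _ _) (sym (coeff-⊕ q p i)))

  ⊕-assoc : ∀ p q r → (p ⊕ q) ⊕ r ≃ p ⊕ (q ⊕ r)
  ⊕-assoc p q r = mk λ i → trans (coeff-⊕ (p ⊕ q) r i) (trans (+-congʳ (coeff-⊕ p q i))
    (trans (+-assoc _ _ _) (sym (trans (coeff-⊕ p (q ⊕ r) i) (+-congˡ (coeff-⊕ q r i))))))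

  ⊕-identityʳ : ∀ p → p ⊕ [] ≃ p
  ⊕-identityʳ p = ⊕-comm p []

  ⊝-inverseʳ : ∀ p → p ⊕ ⊝ p ≃ []
  ⊝-inverseʳ p = mk λ i → trans (coeff-⊕ p (⊝ p) i) (trans (+-congˡ (coeff-⊝ p i)) (-‿inverseʳ _))

  ⊝-cong : ∀ {p q} → p ≃ q → ⊝ p ≃ ⊝ q
  ⊝-cong {p} {q} (mk eq) = mk λ i → trans (coeff-⊝ p i) (trans (-‿cong (eq i)) (sym (coeff-⊝ q i)))

  ⊕-interchange : ∀ p q r s → (p ⊕ q) ⊕ (r ⊕ s) ≃ (p ⊕ r) ⊕ (q ⊕ s)
  ⊕-interchange p q r s = mk λ i → trans (coeff-⊕ (p ⊕ q) (r ⊕ s) i)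
    (trans (+-cong (coeff-⊕ p q i) (coeff-⊕ r s i)) (trans (+-interchange _ _ _ _)
    (sym (trans (coeff-⊕ (p ⊕ r) (q ⊕ s) i) (+-cong (coeff-⊕ p r i) (coeff-⊕ q s i))))))

  ·-cong : ∀ {a b p q} → a ≈ b → p ≃ q → a · p ≃ b · q
  ·-cong {a} {b} {p} {q} a≈b (mk eq) = mk λ i →
    trans (coeff-· a p i) (trans (*-cong a≈b (eq i)) (sym (coeff-· b q i)))

  ·-⊕ : ∀ a p q → a · (p ⊕ q) ≃ a · p ⊕ a · q
  ·-⊕ a p q = mk λ i → trans (coeff-· a (p ⊕ q) i) (trans (*-congˡ (coeff-⊕ p q i))
    (trans (distribˡ a _ _) (sym (trans (coeff-⊕ (a · p) (a · q) i) (+-cong (coeff-· a p i) (coeff-· a q i))))))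

  *-· : ∀ a b p → (a * b) · p ≃ a · (b · p)
  *-· a b p = mk λ i → trans (coeff-· (a * b) p i) (trans (*-assoc _ _ _)
    (sym (trans (coeff-· a (b · p) i) (*-congˡ (coeff-· b p i)))))

  +-· : ∀ a b p → (a + b) · p ≃ a · p ⊕ b · p
  +-· a b p = mk λ i → trans (coeff-· (a + b) p i) (trans (distribʳ _ a b)
    (sym (trans (coeff-⊕ (a · p) (b · p) i) (+-cong (coeff-· a p i) (coeff-· b p i)))))

  0-· : ∀ p → 0# · p ≃ []
  0-· p = mk λ i → trans (coeff-· 0# p i) (zeroˡ _)

  1-· : ∀ p → 1# · p ≃ p
  1-· p = mk λ i → trans (coeff-· 1# p i) (*-identityˡ _)

  ⊗-congˡ : ∀ p {q r} → q ≃ r → p ⊗ q ≃ p ⊗ r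
  ⊗-congˡ []      eq = ≃-refl
  ⊗-congˡ (a ∷ p) eq = ⊕-cong (·-cong refl eq) (∷-cong refl (⊗-congˡ p eq))

  ⊗-zeroʳ : ∀ p → p ⊗ [] ≃ []
  ⊗-zeroʳ []      = ≃-refl
  ⊗-zeroʳ (a ∷ p) = ≃-trans (∷-cong refl (⊗-zeroʳ p)) 0∷[]≃[]

  ⊗-∷ : ∀ p b q → p ⊗ (b ∷ q) ≃ b · p ⊕ (0# ∷ p ⊗ q)
  ⊗-∷ []      b q = ≃-sym 0∷[]≃[]
  ⊗-∷ (a ∷ p) b q = ∷-cong (+-congʳ (*-comm a b))
    (≃-trans (⊕-cong ≃-refl (⊗-∷ p b q))
    (≃-trans (≃-sym (⊕-assoc (a · q) (b · p) (0# ∷ p ⊗ q)))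
    (≃-trans (⊕-cong (⊕-comm (a · q) (b · p)) ≃-refl)
             (⊕-assoc (b · p) (a · q) (0# ∷ p ⊗ q)))))

  ⊗-comm : ∀ p q → p ⊗ q ≃ q ⊗ p
  ⊗-comm []      q = ≃-sym (⊗-zeroʳ q)
  ⊗-comm (a ∷ p) q = ≃-trans (⊕-cong ≃-refl (∷-cong refl (⊗-comm p q))) (≃-sym (⊗-∷ q a p))

  ⊗-cong : ∀ {p q r s} → p ≃ q → r ≃ s → p ⊗ r ≃ q ⊗ s
  ⊗-cong {p} {q} {r} {s} p≃q r≃s = ≃-trans (⊗-congˡ p r≃s)
    (≃-trans (⊗-comm p s) (≃-trans (⊗-congˡ s p≃q) (⊗-comm s q)))

  0∷-⊕ : ∀ p q → 0# ∷ (p ⊕ q) ≃ (0# ∷ p) ⊕ (0# ∷ q)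
  0∷-⊕ p q = ∷-cong (sym (+-identityˡ 0#)) ≃-refl

  ⊗-distribˡ : ∀ p q r → p ⊗ (q ⊕ r) ≃ p ⊗ q ⊕ p ⊗ r
  ⊗-distribˡ []      q r = ≃-refl
  ⊗-distribˡ (a ∷ p) q r = ≃-trans
    (⊕-cong (·-⊕ a q r) (≃-trans (∷-cong refl (⊗-distribˡ p q r)) (0∷-⊕ (p ⊗ q) (p ⊗ r))))
    (⊕-interchange (a · q) (a · r) (0# ∷ p ⊗ q) (0# ∷ p ⊗ r))

  ⊗-distribʳ : ∀ r p q → (p ⊕ q) ⊗ r ≃ p ⊗ r ⊕ q ⊗ r
  ⊗-distribʳ r p q = ≃-trans (⊗-comm (p ⊕ q) r)
    (≃-trans (⊗-distribˡ r p q) (⊕-cong (⊗-comm r p) (⊗-comm r q)))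

  ·-⊗ : ∀ a p q → (a · p) ⊗ q ≃ a · (p ⊗ q)
  ·-⊗ a []      q = ≃-refl
  ·-⊗ a (b ∷ p) q = ≃-trans
    (⊕-cong (*-· a b q) (∷-cong (sym (zeroʳ a)) (·-⊗ a p q)))
    (≃-sym (·-⊕ a (b · q) (0# ∷ p ⊗ q)))

  0∷-⊗ : ∀ p q → (0# ∷ p) ⊗ q ≃ 0# ∷ p ⊗ q
  0∷-⊗ p q = ⊕-cong (0-· q) (≃-refl {0# ∷ p ⊗ q})

  ⊗-assoc : ∀ p q r → (p ⊗ q) ⊗ r ≃ p ⊗ (q ⊗ r)
  ⊗-assoc []      q r = ≃-refl
  ⊗-assoc (a ∷ p) q r = ≃-trans (⊗-distribʳ r (a · q) (0# ∷ p ⊗ q))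
    (⊕-cong (·-⊗ a q r) (≃-trans (0∷-⊗ (p ⊗ q) r) (∷-cong refl (⊗-assoc p q r))))

  ⊗-identityˡ : ∀ p → [ 1# ] ⊗ p ≃ p
  ⊗-identityˡ p = ≃-trans (⊕-cong (1-· p) 0∷[]≃[]) (⊕-identityʳ p)

  ≃-isEquivalence : IsEquivalence _≃_
  ≃-isEquivalence = record { refl = ≃-refl ; sym = ≃-sym ; trans = ≃-trans }

  polyRing : CommutativeRing c ℓ
  polyRing = record
    { Carrier = Poly ; _≈_ = _≃_ ; _+_ = _⊕_ ; _*_ = _⊗_ ; -_ = ⊝_ ; 0# = [] ; 1# = [ 1# ]
    ; isCommutativeRing = record
      { isRing = record
        { +-isAbelianGroup = record
          { isGroup = record
            { isMonoid = record
              { isSemigroup = record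
                { isMagma = record { isEquivalence = ≃-isEquivalence ; ∙-cong = ⊕-cong }
                ; assoc = ⊕-assoc }
              ; identity = (λ _ → ≃-refl) , ⊕-identityʳ }
            ; inverse = (λ p → ≃-trans (⊕-comm (⊝ p) p) (⊝-inverseʳ p)) , ⊝-inverseʳ
            ; ⁻¹-cong = ⊝-cong }
          ; comm = ⊕-comm }
        ; *-cong = ⊗-cong
        ; *-assoc = ⊗-assoc
        ; *-identity = ⊗-identityˡ , (λ p → ≃-trans (⊗-comm p [ 1# ]) (⊗-identityˡ p))
        ; distrib = ⊗-distribˡ , ⊗-distribʳ }
      ; *-comm = ⊗-comm } }

  private module P = CommutativeRing polyRing
  open import Relation.Binary.Reasoning.Setoid P.setoid
  open import Algebra.Solver.Ring.NaturalCoefficients.Default P.commutativeSemiring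
    using (solve; _:+_; _:*_; _:=_; con)

  [-]⊗ : ∀ a p → [ a ] ⊗ p ≃ a · p
  [-]⊗ a p = ≃-trans (⊕-cong ≃-refl 0∷[]≃[]) (⊕-identityʳ (a · p))

  X^-⊗ : ∀ n p → X^ n ⊗ p ≃ replicate n 0# ++ p
  X^-⊗ zero    p = ⊗-identityˡ p
  X^-⊗ (suc n) p = ≃-trans (0∷-⊗ (X^ n) p) (∷-cong refl (X^-⊗ n p))

  X^-+ : ∀ m n → X^ (m ℕ.+ n) ≃ X^ m ⊗ X^ n
  X^-+ zero    n = ≃-sym (⊗-identityˡ (X^ n))
  X^-+ (suc m) n = ≃-trans (∷-cong refl (X^-+ m n)) (≃-sym (0∷-⊗ (X^ m) (X^ n)))

  coeff-shift : ∀ n p i → coeff (replicate n 0# ++ p) (n ℕ.+ i) ≡ coeff p i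
  coeff-shift zero    p i = ≡.refl
  coeff-shift (suc n) p i = coeff-shift n p i

  coeff-shift-< : ∀ {n} p {i} → i < n → coeff (replicate n 0# ++ p) i ≡ 0#
  coeff-shift-< {suc n} p {zero}  _         = ≡.refl
  coeff-shift-< {suc n} p {suc i} (s<s i<n) = coeff-shift-< p i<n

  Below : ℕ → Poly → Set ℓ
  Below n p = ∀ i → n ≤ i → coeff p i ≈ 0#

  below-length : ∀ p → Below (length p) p
  below-length []      i       _         = refl
  below-length (a ∷ p) (suc i) (s≤s n≤i) = below-length p i n≤i

  below-⊕ : ∀ {n} p q → Below n p → Below n q → Below n (p ⊕ q)
  below-⊕ p q bp bq i n≤i =
    trans (coeff-⊕ p q i) (trans (+-cong (bp i n≤i) (bq i n≤i)) (+-identityˡ 0#))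

  below-· : ∀ a {n} p → Below n p → Below n (a · p)
  below-· a p bp i n≤i = trans (coeff-· a p i) (trans (*-congˡ (bp i n≤i)) (zeroʳ a))

  below-≃ : ∀ {n p q} → p ≃ q → Below n p → Below n q
  below-≃ (mk eq) bp i n≤i = trans (sym (eq i)) (bp i n≤i)

  below-≤ : ∀ {m n p} → m ≤ n → Below m p → Below n p
  below-≤ m≤n bp i n≤i = bp i (ℕ.≤-trans m≤n n≤i)

  below-0 : ∀ p → Below 0 p → p ≃ []
  below-0 p b = mk λ i → b i z≤n

  coeff-⊗-lead : ∀ p q m k → Below (suc m) p → Below (suc k) q →
                 Below (suc (m ℕ.+ k)) (p ⊗ q) × coeff (p ⊗ q) (m ℕ.+ k) ≈ coeff p m * coeff q k
  coeff-⊗-lead []      q m k bp bq = (λ _ _ → refl) , sym (zeroˡ _)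
  coeff-⊗-lead (a ∷ p) q zero k bp bq =
    below-≃ (≃-sym eq) (below-· a q bq) , trans (coeffs eq k) (coeff-· a q k)
    where
    eq : (a ∷ p) ⊗ q ≃ a · q
    eq = ≃-trans (⊕-cong ≃-refl (≃-trans
      (∷-cong refl (⊗-cong (below-0 p λ i _ → bp (suc i) (s≤s z≤n)) (≃-refl {q}))) 0∷[]≃[]))
      (⊕-identityʳ (a · q))
  coeff-⊗-lead (a ∷ p) q (suc m) k bp bq = (λ where
      (suc i) (s≤s lt) → trans (coeff-⊕ (a · q) (0# ∷ p ⊗ q) (suc i)) (trans
        (+-cong (below-· a q bq (suc i) (s≤s (ℕ.≤-trans (ℕ.m≤n+m k m) (ℕ.≤-trans (ℕ.n≤1+n _) lt)))) (proj₁ ih i lt))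
        (+-identityˡ 0#))) ,
    trans (coeff-⊕ (a · q) (0# ∷ p ⊗ q) (suc (m ℕ.+ k)))
      (trans (+-cong (below-· a q bq (suc (m ℕ.+ k)) (s≤s (ℕ.m≤n+m k m))) (proj₂ ih)) (+-identityˡ _))
    where ih = coeff-⊗-lead p q m k (λ i m<i → bp (suc i) (s≤s m<i)) bq

  record IsMonic (n : ℕ) (p : Poly) : Set ℓ where
    constructor isMonic
    field
      lead  : coeff p n ≈ 1#
      below : Below (suc n) p
  open IsMonic public

  isMonic-⊗ : ∀ {m k p q} → IsMonic m p → IsMonic k q → IsMonic (m ℕ.+ k) (p ⊗ q)
  isMonic-⊗ {m} {k} {p} {q} (isMonic lp bp) (isMonic lq bq) =
    let b , l = coeff-⊗-lead p q m k bp bq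
    in  isMonic (trans l (trans (*-cong lp lq) (*-identityˡ 1#))) b

  isMonic-≃ : ∀ {m p q} → p ≃ q → IsMonic m p → IsMonic m q
  isMonic-≃ {p = p} {q} (mk eq) (isMonic l b) = isMonic (trans (sym (eq _)) l) (below-≃ {p = p} {q} (mk eq) b)

  ++[1]≃ : ∀ p → p ++ [ 1# ] ≃ p ⊕ X^ (length p)
  ++[1]≃ []      = ≃-refl
  ++[1]≃ (a ∷ p) = ∷-cong (sym (+-identityʳ a)) (++[1]≃ p)

  coeff-++[1]-< : ∀ p {i} → i < length p → coeff (p ++ [ 1# ]) i ≡ coeff p i
  coeff-++[1]-< (a ∷ p) {zero}  _        = ≡.refl
  coeff-++[1]-< (a ∷ p) {suc i} (s<s lt) = coeff-++[1]-< p lt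

  isMonic-++[1] : ∀ p → IsMonic (length p) (p ++ [ 1# ])
  isMonic-++[1] []      = isMonic refl λ { (suc i) _ → refl }
  isMonic-++[1] (a ∷ p) with isMonic-++[1] p
  ... | isMonic l b = isMonic l λ { (suc i) (s≤s lt) → b i lt }

  isMonic-⟦⟧ : ∀ f → IsMonic (degree f) ⟦ f ⟧
  isMonic-⟦⟧ f = isMonic-++[1] (lower f)

  isMonic-X^ : ∀ n → IsMonic n (X^ n)
  isMonic-X^ n = ≡.subst (λ k → IsMonic k (X^ n)) (length-replicate n) (isMonic-++[1] (replicate n 0#))

  isMonic-unique : ¬ (1# ≈ 0#) → ∀ {m n p} → IsMonic m p → IsMonic n p → m ≡ n
  isMonic-unique 1≉0 {m} {n} (isMonic l b) (isMonic l′ b′) with ℕ.<-cmp m n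
  ... | tri< m<n _ _ = contradiction (trans (sym l′) (b n m<n)) 1≉0
  ... | tri≈ _ m≡n _ = m≡n
  ... | tri> _ _ n<m = contradiction (trans (sym l) (b′ m n<m)) 1≉0

  coeff-take : ∀ n p {i} → i < n → coeff (take n p) i ≡ coeff p i
  coeff-take (suc n) []      _                 = ≡.refl
  coeff-take (suc n) (a ∷ p) {zero}  _         = ≡.refl
  coeff-take (suc n) (a ∷ p) {suc i} (s<s i<n) = coeff-take n p i<n

  below-take : ∀ n p → Below n (take n p)
  below-take n p i n≤i = below-length (take n p) i
    (ℕ.≤-trans (ℕ.≤-reflexive (length-take n p)) (ℕ.≤-trans (ℕ.m⊓n≤m n (length p)) n≤i))

  take-below : ∀ {n} p → Below n p → take n p ≃ p
  take-below {n} p b = mk eq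
    where
    eq : take n p ≋ p
    eq i with i ℕ.<? n
    ... | yes i<n = reflexive (coeff-take n p i<n)
    ... | no  i≮n = trans (below-take n p i (ℕ.≮⇒≥ i≮n)) (sym (b i (ℕ.≮⇒≥ i≮n)))

  monic-≃ : ∀ {n p} l → length l ≡ n → IsMonic n p → (∀ {i} → i < n → coeff l i ≈ coeff p i) →
            ⟦ monic l ⟧ ≃ p
  monic-≃ {p = p} l ≡.refl mp eq = mk go
    where
    go : (l ++ [ 1# ]) ≋ p
    go i with ℕ.<-cmp i (length l)
    ... | tri< i<n _ _ = trans (reflexive (coeff-++[1]-< l i<n)) (eq i<n)
    ... | tri≈ _ ≡.refl _ = trans (lead (isMonic-++[1] l)) (sym (lead mp))
    ... | tri> _ _ n<i = trans (below (isMonic-++[1] l) i n<i) (sym (below mp i n<i))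

  length-⊕ : ∀ p q → length (p ⊕ q) ≡ length p ℕ.⊔ length q
  length-⊕ []      q       = ≡.refl
  length-⊕ (a ∷ p) []      = ≡.refl
  length-⊕ (a ∷ p) (b ∷ q) = ≡.cong suc (length-⊕ p q)

  length-⊗ : ∀ p q → length (p ⊗ ⟦ q ⟧) ℕ.⊔ (length p ℕ.+ degree q) ≡ length p ℕ.+ degree q
  length-⊗ []      q = ≡.refl
  length-⊗ (a ∷ p) q = ≡.trans (≡.cong (ℕ._⊔ _) len) (ℕ.m≤n⇒m⊔n≡n (ℕ.⊔-lub (s≤s (ℕ.m≤n+m _ _)) (s≤s
      (≡.subst (length (p ⊗ ⟦ q ⟧) ≤_) (length-⊗ p q) (ℕ.m≤m⊔n _ _)))))
    where
    len : length ((a · ⟦ q ⟧) ⊕ (0# ∷ p ⊗ ⟦ q ⟧)) ≡ suc (degree q) ℕ.⊔ suc (length (p ⊗ ⟦ q ⟧))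
    len = ≡.trans (length-⊕ (a · ⟦ q ⟧) (0# ∷ p ⊗ ⟦ q ⟧)) (≡.cong (ℕ._⊔ _)
      (≡.trans (length-map (a *_) ⟦ q ⟧) (≡.trans (length-++ (lower q)) (ℕ.+-comm _ 1))))

  degree-⊗ᵐ : ∀ f g → degree (f ⊗ᵐ g) ≡ degree f ℕ.+ degree g
  degree-⊗ᵐ f g = ≡.trans (length-⊕ (lower f ⊗ ⟦ g ⟧) _) (≡.trans
    (≡.cong (length (lower f ⊗ ⟦ g ⟧) ℕ.⊔_) (≡.trans (length-++ (replicate (degree f) 0#))
      (≡.cong (ℕ._+ degree g) (length-replicate (degree f)))))
    (length-⊗ (lower f) g))

  ⟦⟧≃ : ∀ f → ⟦ f ⟧ ≃ lower f ⊕ X^ (degree f)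
  ⟦⟧≃ f = ++[1]≃ (lower f)

  ⟦⊗ᵐ⟧ : ∀ f g → ⟦ f ⊗ᵐ g ⟧ ≃ ⟦ f ⟧ ⊗ ⟦ g ⟧
  ⟦⊗ᵐ⟧ f g = begin
    ⟦ f ⊗ᵐ g ⟧  ≈⟨ ⟦⟧≃ (f ⊗ᵐ g) ⟩
    ((lower f ⊗ ⟦ g ⟧) ⊕ (replicate (degree f) 0# ++ lower g)) ⊕ X^ (degree (f ⊗ᵐ g))
      ≈⟨ P.+-cong (P.+-congˡ {lower f ⊗ ⟦ g ⟧} (P.sym (X^-⊗ (degree f) (lower g))))
           (P.trans (P.reflexive (≡.cong X^ (degree-⊗ᵐ f g))) (X^-+ (degree f) (degree g))) ⟩
    ((lower f ⊗ ⟦ g ⟧) ⊕ (X^ (degree f) ⊗ lower g)) ⊕ X^ (degree f) ⊗ X^ (degree g)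
      ≈⟨ P.trans (P.+-assoc (lower f ⊗ ⟦ g ⟧) (X^ (degree f) ⊗ lower g) (X^ (degree f) ⊗ X^ (degree g))) (P.+-congˡ {lower f ⊗ ⟦ g ⟧} (P.sym (P.distribˡ (X^ (degree f)) (lower g) (X^ (degree g))))) ⟩
    (lower f ⊗ ⟦ g ⟧) ⊕ (X^ (degree f) ⊗ (lower g ⊕ X^ (degree g)))
      ≈⟨ P.+-congˡ {lower f ⊗ ⟦ g ⟧} (P.*-congˡ {X^ (degree f)} (P.sym (⟦⟧≃ g))) ⟩
    (lower f ⊗ ⟦ g ⟧) ⊕ (X^ (degree f) ⊗ ⟦ g ⟧)
      ≈⟨ P.distribʳ ⟦ g ⟧ (lower f) (X^ (degree f)) ⟨
    (lower f ⊕ X^ (degree f)) ⊗ ⟦ g ⟧  ≈⟨ P.*-congʳ (P.sym (⟦⟧≃ f)) ⟩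
    ⟦ f ⟧ ⊗ ⟦ g ⟧ ∎

  divMod-spec : ∀ p g → p ≃ (proj₁ (divMod p g) ⊗ ⟦ g ⟧) ⊕ (p mod g) × Below (degree g) (p mod g)
  divMod-spec []      g = zeros , below-≃ zeros (λ _ _ → refl)
    where
    zeros : [] ≃ replicate (degree g) 0#
    zeros = ≃-trans (≃-sym (⊗-zeroʳ (X^ (degree g)))) (≃-trans (X^-⊗ (degree g) [])
      (P.reflexive (List.++-identityʳ _)))
  divMod-spec (a ∷ p) g = (begin
    a ∷ p                               ≈⟨ ∷-cong (sym (+-identityʳ a)) (P.trans eq (⊕-comm (q ⊗ G) r)) ⟩
    s ⊕ (0# ∷ q ⊗ G)                    ≈⟨ P.+-identityʳ _ ⟨
    (s ⊕ (0# ∷ q ⊗ G)) ⊕ []             ≈⟨ P.+-congˡ {s ⊕ (0# ∷ q ⊗ G)} (P.sym cancel) ⟩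
    (s ⊕ (0# ∷ q ⊗ G)) ⊕ (l · G ⊕ (- l) · G)
      ≈⟨ solve 4 (λ s t u v → (s :+ t) :+ (u :+ v) := (u :+ t) :+ (s :+ v)) P.refl s (0# ∷ q ⊗ G) (l · G) ((- l) · G) ⟩
    (l · G ⊕ (0# ∷ q ⊗ G)) ⊕ (s ⊕ (- l) · G)
      ≈⟨ P.+-congˡ {l · G ⊕ (0# ∷ q ⊗ G)} (P.sym (take-below t t-below)) ⟩
    ((l ∷ q) ⊗ G) ⊕ take (degree g) t ∎) , below-take (degree g) t
    where
    q = proj₁ (divMod p g)
    r = p mod g
    G = ⟦ g ⟧
    s = a ∷ r
    l = coeff s (degree g)
    t = s ⊕ (- l) · G
    eq = proj₁ (divMod-spec p g)
    cancel : l · G ⊕ (- l) · G ≃ []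
    cancel = P.trans (P.sym (+-· l (- l) G)) (P.trans (·-cong (-‿inverseʳ l) P.refl) (0-· G))
    s-below : Below (suc (degree g)) s
    s-below (suc i) (s≤s n≤i) = proj₂ (divMod-spec p g) i n≤i
    t-below : Below (degree g) t
    t-below i n≤i with ℕ.m≤n⇒m<n∨m≡n n≤i
    ... | inj₁ n<i    = below-⊕ s ((- l) · G) s-below (below-· (- l) G (below (isMonic-⟦⟧ g))) i n<i
    ... | inj₂ ≡.refl = trans (coeff-⊕ s ((- l) · G) i) (trans
      (+-congˡ (trans (coeff-· (- l) G i) (trans (*-congˡ (lead (isMonic-⟦⟧ g))) (*-identityʳ _))))
      (-‿inverseʳ l))

  -- The leading coefficient 1 of G cannot be cancelled, so the coefficients of q vanish from the
  -- top down. This makes division by monic polynomials unique over any ring.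
  multiple-below : ∀ q {n G} → IsMonic n G → Below n (q ⊗ G) → q ≃ []
  multiple-below []      mG b = ≃-refl
  multiple-below (a ∷ q) {n} {G} mG b = ≃-trans (∷-cong a≈0 q≃[]) 0∷[]≃[]
    where
    q≃[] : q ≃ []
    q≃[] = multiple-below q mG λ i n≤i → trans (sym (+-identityˡ _)) (trans
      (+-congʳ (sym (below-· a G (below mG) (suc i) (s≤s n≤i))))
      (trans (sym (coeff-⊕ (a · G) (0# ∷ q ⊗ G) (suc i))) (b (suc i) (ℕ.m≤n⇒m≤1+n n≤i))))
    aG≃ : (a ∷ q) ⊗ G ≃ a · G
    aG≃ = ≃-trans (⊕-cong ≃-refl (≃-trans (∷-cong refl (⊗-cong q≃[] (≃-refl {G}))) 0∷[]≃[]))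
      (⊕-identityʳ (a · G))
    a≈0 : a ≈ 0#
    a≈0 = trans (sym (*-identityʳ a)) (trans (*-congˡ (sym (lead mG)))
      (trans (sym (coeff-· a G n)) (trans (sym (coeffs aG≃ n)) (b n ℕ.≤-refl))))

  below-⊝ : ∀ {n} p → Below n p → Below n (⊝ p)
  below-⊝ p b i n≤i = trans (coeff-⊝ p i) (trans (-‿cong (b i n≤i)) -0#≈0#)

  ⊕-cancel : ∀ {p q} → p ⊕ ⊝ q ≃ [] → p ≃ q
  ⊕-cancel {p} {q} eq = P.trans (P.sym (P.trans (P.+-assoc p (⊝ q) q)
    (P.trans (P.+-congˡ {p} (P.-‿inverseˡ q)) (P.+-identityʳ p)))) (P.+-congʳ eq)

  open import Algebra.Properties.Ring P.ring using ()
    renaming (-‿distribˡ-* to ⊝-distribˡ-⊗)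

  ÷-unique : ∀ {n G q q′ r r′} → IsMonic n G → Below n r → Below n r′ →
             q ⊗ G ⊕ r ≃ q′ ⊗ G ⊕ r′ → q ≃ q′ × r ≃ r′
  ÷-unique {n} {G} {q} {q′} {r} {r′} mG br br′ eq = q≃q′ , r≃r′
    where
    diff : (q ⊕ ⊝ q′) ⊗ G ≃ r′ ⊕ ⊝ r
    diff = begin
      (q ⊕ ⊝ q′) ⊗ G                            ≈⟨ P.distribʳ G q (⊝ q′) ⟩
      q ⊗ G ⊕ (⊝ q′) ⊗ G                        ≈⟨ P.+-congˡ {q ⊗ G} (P.sym (⊝-distribˡ-⊗ q′ G)) ⟩
      q ⊗ G ⊕ ⊝ (q′ ⊗ G)                        ≈⟨ P.+-congʳ (P.sym (P.+-identityʳ (q ⊗ G))) ⟩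
      (q ⊗ G ⊕ []) ⊕ ⊝ (q′ ⊗ G)                 ≈⟨ P.+-congʳ (P.+-congˡ {q ⊗ G} (P.sym (P.-‿inverseʳ r))) ⟩
      (q ⊗ G ⊕ (r ⊕ ⊝ r)) ⊕ ⊝ (q′ ⊗ G)
        ≈⟨ P.+-congʳ (P.trans (P.sym (P.+-assoc (q ⊗ G) r (⊝ r))) (P.+-congʳ eq)) ⟩
      (q′ ⊗ G ⊕ r′ ⊕ ⊝ r) ⊕ ⊝ (q′ ⊗ G)
        ≈⟨ solve 4 (λ a b c d → (a :+ b :+ c) :+ d := (a :+ d) :+ (b :+ c)) P.refl
             (q′ ⊗ G) r′ (⊝ r) (⊝ (q′ ⊗ G)) ⟩
      (q′ ⊗ G ⊕ ⊝ (q′ ⊗ G)) ⊕ (r′ ⊕ ⊝ r)        ≈⟨ P.+-congʳ (P.-‿inverseʳ (q′ ⊗ G)) ⟩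
      r′ ⊕ ⊝ r ∎
    q-q′ : q ⊕ ⊝ q′ ≃ []
    q-q′ = multiple-below (q ⊕ ⊝ q′) mG (below-≃ (P.sym diff) (below-⊕ r′ (⊝ r) br′ (below-⊝ r br)))
    q≃q′ : q ≃ q′
    q≃q′ = ⊕-cancel q-q′
    r≃r′ : r ≃ r′
    r≃r′ = P.sym (⊕-cancel (P.trans (P.sym diff) (P.*-congʳ q-q′)))

  mod-unique : ∀ {p g q r} → Below (degree g) r → p ≃ q ⊗ ⟦ g ⟧ ⊕ r → p mod g ≃ r
  mod-unique {p} {g} {q} {r} br eq = let e , b = divMod-spec p g in
    proj₂ (÷-unique {q = proj₁ (divMod p g)} {q} {p mod g} {r} (isMonic-⟦⟧ g) b br (P.trans (P.sym e) eq))

  monic-cancel : ∀ {n G p q} → IsMonic n G → p ⊗ G ≃ q ⊗ G → p ≃ q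
  monic-cancel {n} {G} {p} {q} mG eq =
    proj₁ (÷-unique {q = p} {q} {[]} {[]} mG (λ _ _ → refl) (λ _ _ → refl) (P.+-congʳ eq))

  -- `÷ᵐ` truncates the computed quotient and puts the leading coefficient 1 on top, so its value
  -- can be trusted only once an exact quotient `h`, monic of the expected degree, is known.
  -- Uniqueness of division then identifies the two.
  ⟦÷ᵐ⟧ : ∀ f g {h} → degree g ≤ degree f → IsMonic (degree f ∸ degree g) h → ⟦ f ⟧ ≃ h ⊗ ⟦ g ⟧ →
         ⟦ f ÷ᵐ g ⟧ ≃ h × degree (f ÷ᵐ g) ≡ degree f ∸ degree g
  ⟦÷ᵐ⟧ f g {h} g≤f mh eq = monic-≃ (take d q) len mh
    (λ i<d → trans (reflexive (coeff-take d q i<d)) (coeffs q≃h _)) , len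
    where
    d = degree f ∸ degree g
    q = proj₁ (divMod ⟦ f ⟧ g)
    q≃h : q ≃ h
    q≃h = let e , b = divMod-spec ⟦ f ⟧ g in proj₁ (÷-unique {q = q} {h} {⟦ f ⟧ mod g} {[]}
      (isMonic-⟦⟧ g) b (λ _ _ → refl) (P.trans (P.sym e) (P.trans eq (P.sym (P.+-identityʳ (h ⊗ ⟦ g ⟧))))))
    length-quotient : ∀ p → length (proj₁ (divMod p g)) ≡ length p
    length-quotient []      = ≡.refl
    length-quotient (a ∷ p) = ≡.cong suc (length-quotient p)
    len : length (take d q) ≡ d
    len = ≡.trans (length-take d q) (ℕ.m≤n⇒m⊓n≡m (ℕ.≤-trans (ℕ.m∸n≤m (degree f) (degree g))
      (ℕ.≤-trans (≡.subst (degree f ≤_) (≡.sym (length-++ (lower f))) (ℕ.m≤m+n _ 1))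
        (ℕ.≤-reflexive (≡.sym (length-quotient ⟦ f ⟧))))))

  -- Maps into quotients of R[X] are described by their coordinates, each a linear functional on
  -- polynomials. One row of a matrix is then one functional evaluated on a basis.
  record Linear (λ′ : Poly → Carrier) : Set (c ⊔ ℓ) where
    field
      λ-cong : ∀ {p q} → p ≃ q → λ′ p ≈ λ′ q
      λ-⊕    : ∀ p q → λ′ (p ⊕ q) ≈ λ′ p + λ′ q
      λ-·    : ∀ a p → λ′ (a · p) ≈ a * λ′ p
  open Linear public

  λ-[] : ∀ {λ′} → Linear λ′ → λ′ [] ≈ 0#
  λ-[] lin = trans (λ-· lin 0# []) (zeroˡ _)

  linear-⊗ : ∀ {λ′} → Linear λ′ → ∀ h → Linear (λ p → λ′ (h ⊗ p))
  linear-⊗ lin h = record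
    { λ-cong = λ eq → λ-cong lin (⊗-congˡ h eq)
    ; λ-⊕ = λ p q → trans (λ-cong lin (⊗-distribˡ h p q)) (λ-⊕ lin _ _)
    ; λ-· = λ a p → trans (λ-cong lin (≃-trans (⊗-comm h (a · p)) (≃-trans (·-⊗ a p h) (·-cong refl (⊗-comm p h)))))
                          (λ-· lin a (h ⊗ p)) }

  linear-0∷ : ∀ {λ′} → Linear λ′ → Linear (λ p → λ′ (0# ∷ p))
  linear-0∷ lin = record
    { λ-cong = λ eq → λ-cong lin (∷-cong refl eq)
    ; λ-⊕ = λ p q → trans (λ-cong lin (0∷-⊕ p q)) (λ-⊕ lin _ _)
    ; λ-· = λ a p → trans (λ-cong lin (∷-cong (sym (zeroʳ a)) ≃-refl)) (λ-· lin a (0# ∷ p)) }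

  linear-expand : ∀ n {λ′} → Linear λ′ → ∀ p → Below n p → λ′ p ≈ ∑ n (λ j → coeff p j * λ′ (X^ j))
  linear-expand zero    lin p       b = trans (λ-cong lin (below-0 p b)) (λ-[] lin)
  linear-expand (suc n) {λ′} lin []      b = trans (λ-[] lin) (sym (∑-zero (suc n) {λ j → 0# * λ′ (X^ j)} λ j _ → zeroˡ _))
  linear-expand (suc n) {λ′} lin (a ∷ p) b = trans
    (λ-cong lin (∷-cong (sym (trans (+-identityʳ _) (*-identityʳ a))) (≃-refl {p})))
    (trans (λ-⊕ lin (a · [ 1# ]) (0# ∷ p))
      (+-cong (λ-· lin a [ 1# ]) (linear-expand n (linear-0∷ lin) p λ i n≤i → b (suc i) (s≤s n≤i))))

  rem : Monic → ℕ → Poly → Carrier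
  rem f k p = coeff (p mod f) k

  mod-cong : ∀ f {p q} → p ≃ q → p mod f ≃ q mod f
  mod-cong f {p} {q} eq = let e , b = divMod-spec q f in
    mod-unique {p} {f} {proj₁ (divMod q f)} b (P.trans eq e)

  rem-linear : ∀ f k → Linear (rem f k)
  rem-linear f k = record
    { λ-cong = λ eq → coeffs (mod-cong f eq) k
    ; λ-⊕ = λ p q → trans (coeffs (mod-⊕ p q) k) (coeff-⊕ (p mod f) (q mod f) k)
    ; λ-· = λ a p → trans (coeffs (mod-· a p) k) (coeff-· a (p mod f) k) }
    where
    mod-⊕ : ∀ p q → (p ⊕ q) mod f ≃ (p mod f) ⊕ (q mod f)
    mod-⊕ p q = let e , b = divMod-spec p f; e′ , b′ = divMod-spec q f; u = proj₁ (divMod p f); v = proj₁ (divMod q f) in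
      mod-unique {p ⊕ q} {f} {u ⊕ v} (below-⊕ (p mod f) (q mod f) b b′)
        (P.trans (P.+-cong e e′) (solve 5 (λ u v g r s → u :* g :+ r :+ (v :* g :+ s) := (u :+ v) :* g :+ (r :+ s))
          P.refl u v ⟦ f ⟧ (p mod f) (q mod f)))
    mod-· : ∀ a p → (a · p) mod f ≃ a · (p mod f)
    mod-· a p = let e , b = divMod-spec p f; u = proj₁ (divMod p f) in
      mod-unique {a · p} {f} {a · u} (below-· a (p mod f) b)
        (P.trans (·-cong refl e) (P.trans (·-⊕ a (u ⊗ ⟦ f ⟧) (p mod f)) (P.+-congʳ (P.sym (·-⊗ a u ⟦ f ⟧)))))

  mod-below : ∀ f {p} → Below (degree f) p → p mod f ≃ p
  mod-below f {p} b = mod-unique {p} {f} {[]} b P.refl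

  mod-multiple : ∀ f {p} q → p ≃ q ⊗ ⟦ f ⟧ → p mod f ≃ []
  mod-multiple f {p} q eq = mod-unique {p} {f} {q} (λ _ _ → refl) (P.trans eq (P.sym (P.+-identityʳ (q ⊗ ⟦ f ⟧))))

  Annihilates : (Poly → Carrier) → Monic → Set (c ⊔ ℓ)
  Annihilates λ′ f = ∀ q → λ′ (q ⊗ ⟦ f ⟧) ≈ 0#

  annihilates-mod : ∀ {λ′ f} → Linear λ′ → Annihilates λ′ f → ∀ p → λ′ p ≈ λ′ (p mod f)
  annihilates-mod {λ′} {f} lin ann p = trans (λ-cong lin (proj₁ (divMod-spec p f)))
    (trans (λ-⊕ lin (proj₁ (divMod p f) ⊗ ⟦ f ⟧) (p mod f)) (trans (+-congʳ (ann (proj₁ (divMod p f)))) (+-identityˡ _)))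

  -- A functional that vanishes on the ideal of f factors through R[X]/(f) and is determined on 1,
  -- X, .... The right-hand side is an entry of a matrix product, so composing maps on R[X]/(f)
  -- becomes an instance of `D-mul`.
  annihilates-expand : ∀ {λ′ f} → Linear λ′ → Annihilates λ′ f → ∀ p →
                       λ′ p ≈ ∑ (degree f) (λ k → λ′ (X^ k) * rem f k p)
  annihilates-expand {λ′} {f} lin ann p = trans (annihilates-mod lin ann p)
    (trans (linear-expand (degree f) lin (p mod f) (proj₂ (divMod-spec p f)))
      (∑-cong (degree f) λ k _ → *-comm _ _))

  rem-annihilates : ∀ f h k → Annihilates (λ p → rem f k (h ⊗ p)) f
  rem-annihilates f h k q = coeffs (mod-multiple f (h ⊗ q) (P.sym (P.*-assoc h q ⟦ f ⟧))) k

-- Norms and resultants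

nth : ∀ {a} {A : Set a} → A → List A → ℕ → A
nth d []       i       = d
nth d (x ∷ xs) zero    = x
nth d (x ∷ xs) (suc i) = nth d xs i

module _ {a} {A : Set a} (d : A) where
  nth-++ˡ : ∀ xs ys {i} → i < length xs → nth d (xs ++ ys) i ≡ nth d xs i
  nth-++ˡ (x ∷ xs) ys {zero}  _        = ≡.refl
  nth-++ˡ (x ∷ xs) ys {suc i} (s<s lt) = nth-++ˡ xs ys lt

  nth-++ʳ : ∀ xs ys i {m} → length xs ≡ m → nth d (xs ++ ys) (m ℕ.+ i) ≡ nth d ys i
  nth-++ʳ []       ys i ≡.refl = ≡.refl
  nth-++ʳ (x ∷ xs) ys i ≡.refl = nth-++ʳ xs ys i ≡.refl

  nth-applyUpTo : ∀ f n {i} → i < n → nth d (applyUpTo f n) i ≡ f i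
  nth-applyUpTo f (suc n) {zero}  _        = ≡.refl
  nth-applyUpTo f (suc n) {suc i} (s<s lt) = nth-applyUpTo (f ∘ suc) n lt

module Norms {c ℓ} (R : CommutativeRing c ℓ) where
  open CommutativeRing R
  open Polynomial R
  open Polys R
  open Sums R
  open Det R
  open import Relation.Binary.Reasoning.Setoid setoid
  open import Algebra.Properties.Semiring.Exp semiring using (_^_; ^-congˡ)
  open import Algebra.Properties.Ring ring using (-‿distribˡ-*; -‿distribʳ-*; -‿involutive)
  open import Algebra.Solver.Ring.NaturalCoefficients.Default commutativeSemiring
    using (solve; _:+_; _:*_; _:=_; con)
  private module P = CommutativeRing polyRing

  norm : Monic → Poly → Carrier
  norm f g = D (degree f) λ i j → rem f i (g ⊗ X^ j)

  rem-cong : ∀ f k {p q} → p ≃ q → rem f k p ≈ rem f k q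
  rem-cong f k eq = coeffs (mod-cong f eq) k

  norm-cong : ∀ f {g h} → g ≃ h → norm f g ≈ norm f h
  norm-cong f eq = D-cong (degree f) λ i j _ _ → rem-cong f i (⊗-cong eq (≃-refl {X^ j}))

  coeff-X^ : ∀ j i → coeff (X^ j) i ≡ I i j
  coeff-X^ zero    zero    = ≡.refl
  coeff-X^ zero    (suc i) = ≡.refl
  coeff-X^ (suc j) zero    = ≡.refl
  coeff-X^ (suc j) (suc i) = coeff-X^ j i

  linear-rem : ∀ f h i → Linear (λ p → rem f i (h ⊗ p))
  linear-rem f h i = linear-⊗ (rem-linear f i) h

  norm-⊗ : ∀ f g h → norm f (g ⊗ h) ≈ norm f g * norm f h
  norm-⊗ f g h = trans
    (D-cong (degree f) λ i j _ _ → trans (rem-cong f i (⊗-assoc g h (X^ j)))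
      (annihilates-expand {f = f} (linear-rem f g i) (rem-annihilates f g i) (h ⊗ X^ j)))
    (D-mul (degree f) (λ i k → rem f i (g ⊗ X^ k)) (λ k j → rem f k (h ⊗ X^ j)))

  rem-X^ : ∀ f i {j} → j < degree f → rem f i (X^ j) ≈ I i j
  rem-X^ f i {j} j<m = trans
    (coeffs (mod-below f {X^ j} (below-≤ {p = X^ j} j<m (below (isMonic-X^ j)))) i)
    (reflexive (coeff-X^ j i))

  norm-[_] : ∀ a f → norm f [ a ] ≈ a ^ degree f
  norm-[ a ] f = trans
    (D-cong (degree f) λ i j _ j<m → trans (rem-cong f i ([-]⊗ a (X^ j)))
      (trans (λ-· (rem-linear f i) a (X^ j)) (*-congˡ (rem-X^ f i j<m))))
    (D-scalar (degree f) a)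

  norm-1 : ∀ f → norm f [ 1# ] ≈ 1#
  norm-1 f = trans
    (D-cong (degree f) λ i j _ j<m → trans (rem-cong f i (⊗-identityˡ (X^ j))) (rem-X^ f i j<m))
    (D-I (degree f))

  infix 4 _≃_modulo_
  _≃_modulo_ : Poly → Poly → Monic → Set _
  p ≃ q modulo f = ∃[ u ] p ≃ u ⊗ ⟦ f ⟧ ⊕ q

  rem-modulo : ∀ f i {p q} → p ≃ q modulo f → rem f i p ≈ rem f i q
  rem-modulo f i {p} {q} (u , eq) = trans (rem-cong f i eq) (trans (λ-⊕ (rem-linear f i) (u ⊗ ⟦ f ⟧) q)
    (trans (+-congʳ (coeffs (mod-multiple f u P.refl) i)) (+-identityˡ _)))

  modulo-⊗ : ∀ {f p q} r → p ≃ q modulo f → p ⊗ r ≃ q ⊗ r modulo f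
  modulo-⊗ {f} {p} {q} r (u , eq) = u ⊗ r , P.trans (P.*-congʳ eq) (P.trans (P.distribʳ r (u ⊗ ⟦ f ⟧) q)
    (P.+-congʳ {q ⊗ r} (P.trans (P.*-assoc u ⟦ f ⟧ r) (P.trans (P.*-congˡ {u} (P.*-comm ⟦ f ⟧ r)) (P.sym (P.*-assoc u r ⟦ f ⟧))))))

  norm-modulo : ∀ f {g h} → g ≃ h modulo f → norm f g ≈ norm f h
  norm-modulo f {g} {h} eq = D-cong (degree f) λ i j _ _ → rem-modulo f i (modulo-⊗ {f} {g} {h} (X^ j) eq)

  norm-modulus : ∀ {f f′} g → degree f ≡ degree f′ → ⟦ f ⟧ ≃ ⟦ f′ ⟧ → norm f g ≈ norm f′ g
  norm-modulus {f} {f′} g deg eq = trans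
    (D-cong (degree f) λ i j _ _ → coeffs (mods (g ⊗ X^ j)) i)
    (reflexive (≡.cong (λ n → D n (λ i j → rem f′ i (g ⊗ X^ j))) deg))
    where
    mods : ∀ p → p mod f ≃ p mod f′
    mods p = let e , b = divMod-spec p f′; u = proj₁ (divMod p f′) in
      mod-unique {p} {f} {u} (≡.subst (λ n → Below n (p mod f′)) (≡.sym deg) b)
        (P.trans e (P.+-congʳ (P.*-congˡ {u} (P.sym eq))))

  -- Expressing polynomials monic of degrees 0, 1, ... through the powers of X is a unitriangular
  -- change of basis, of determinant 1.
  basis-change : ∀ n (λs : ℕ → Poly → Carrier) (b : ℕ → Poly) →
                 (∀ i → i < n → Linear (λs i)) → (∀ j → j < n → IsMonic j (b j)) →
                 D n (λ i j → λs i (b j)) ≈ D n (λ i j → λs i (X^ j))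
  basis-change n λs b lin mon = begin
    D n (λ i j → λs i (b j))
      ≈⟨ D-cong n (λ i j i<n j<n → trans
           (linear-expand n (lin i i<n) (b j) (below-≤ {p = b j} j<n (below (mon j j<n))))
           (∑-cong n λ k _ → *-comm _ _)) ⟩
    D n (mul n (λ i k → λs i (X^ k)) (λ k j → coeff (b j) k))
      ≈⟨ D-mul n (λ i k → λs i (X^ k)) (λ k j → coeff (b j) k) ⟩
    D n (λ i j → λs i (X^ j)) * D n (λ k j → coeff (b j) k)
      ≈⟨ *-congˡ (D-unitriangular n (λ i i<n → lead (mon i i<n))
           (λ i j j<i i<n → below (mon j (ℕ.<-trans j<i i<n)) i j<i)) ⟩
    D n (λ i j → λs i (X^ j)) * 1# ≈⟨ *-identityʳ _ ⟩
    D n (λ i j → λs i (X^ j)) ∎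

  -- The coordinates of R[X]/(f₁) × … × R[X]/(fₛ).
  rows : List Monic → List (Poly → Carrier)
  rows = concatMap λ f → map (rem f) (upTo (degree f))

  row : List Monic → ℕ → Poly → Carrier
  row fs = nth (λ _ → 0#) (rows fs)

  degrees : List Monic → ℕ
  degrees []       = 0
  degrees (f ∷ fs) = degree f ℕ.+ degrees fs

  map-upTo : ∀ {a} {A : Set a} (g : ℕ → A) h n → map g (applyUpTo h n) ≡ applyUpTo (g ∘ h) n
  map-upTo g h zero    = ≡.refl
  map-upTo g h (suc n) = ≡.cong (g (h 0) ∷_) (map-upTo g (h ∘ suc) n)

  length-coordinates : ∀ f → length (map (rem f) (upTo (degree f))) ≡ degree f
  length-coordinates f = ≡.trans (≡.cong length (map-upTo (rem f) id (degree f))) (length-applyUpTo (rem f) (degree f))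

  row-< : ∀ f fs {i} → i < degree f → row (f ∷ fs) i ≡ rem f i
  row-< f fs {i} lt = ≡.trans
    (nth-++ˡ _ (map (rem f) (upTo (degree f))) (rows fs) (≡.subst (i <_) (≡.sym (length-coordinates f)) lt))
    (≡.trans (≡.cong (λ l → nth _ l i) (map-upTo (rem f) id (degree f))) (nth-applyUpTo _ (rem f) (degree f) lt))

  row-+ : ∀ f fs i → row (f ∷ fs) (degree f ℕ.+ i) ≡ row fs i
  row-+ f fs i = nth-++ʳ _ (map (rem f) (upTo (degree f))) (rows fs) i (length-coordinates f)

  row-linear : ∀ fs i → i < degrees fs → Linear (row fs i)
  row-linear (f ∷ fs) i lt with i ℕ.<? degree f
  ... | yes i<m = ≡.subst Linear (≡.sym (row-< f fs i<m)) (rem-linear f i)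
  ... | no  i≮m = ≡.subst Linear
    (≡.trans (≡.sym (row-+ f fs (i ∸ degree f))) (≡.cong (row (f ∷ fs)) i≡))
    (row-linear fs (i ∸ degree f) (ℕ.+-cancelˡ-< (degree f) _ _ (≡.subst (_< degree f ℕ.+ degrees fs) (≡.sym i≡) lt)))
    where
    i≡ : degree f ℕ.+ (i ∸ degree f) ≡ i
    i≡ = ℕ.m+[n∸m]≡n (ℕ.≮⇒≥ i≮m)

  -- The determinant of p ↦ (h p mod f₁ , … , h p mod fₛ) on the polynomials of
  -- degree below deg f₁ + … + deg fₛ.
  crtDet : Poly → List Monic → Carrier
  crtDet h fs = D (degrees fs) λ i j → row fs i (h ⊗ X^ j)

  -- In the basis 1, X, ..., f, fX, ... the multiples of f vanish in the coordinates modulo f, which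
  -- gives the triangular shape. In the other coordinates they replace h by h f: this is the purpose
  -- of the parameter h.
  crtDet-∷ : ∀ h f fs → crtDet h (f ∷ fs) ≈ norm f h * crtDet (h ⊗ ⟦ f ⟧) fs
  crtDet-∷ h f fs = begin
    D (m ℕ.+ n) (λ i j → row (f ∷ fs) i (h ⊗ X^ j))
      ≈⟨ basis-change (m ℕ.+ n) (λ i p → row (f ∷ fs) i (h ⊗ p)) b
           (λ i i<n → linear-⊗ (row-linear (f ∷ fs) i i<n) h) (λ j _ → b-monic j) ⟨
    D (m ℕ.+ n) (λ i j → row (f ∷ fs) i (h ⊗ b j))
      ≈⟨ D-block m n (λ i j i<m _ → trans
           (reflexive (≡.cong₂ (λ r p → r (h ⊗ p)) (row-< f fs i<m) (b-+ j)))
           (coeffs (mod-multiple f (h ⊗ X^ j) (P.trans (P.*-congˡ {h} (P.*-comm ⟦ f ⟧ (X^ j)))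
             (P.sym (P.*-assoc h (X^ j) ⟦ f ⟧)))) i)) ⟩
    D m (λ i j → row (f ∷ fs) i (h ⊗ b j)) * D n (λ i j → row (f ∷ fs) (m ℕ.+ i) (h ⊗ b (m ℕ.+ j)))
      ≈⟨ *-cong
           (D-cong m λ i j i<m j<m → reflexive (≡.cong₂ (λ r p → r (h ⊗ p)) (row-< f fs i<m) (b-< j<m)))
           (D-cong n λ i j i<n _ → trans
             (reflexive (≡.cong₂ (λ r p → r (h ⊗ p)) (row-+ f fs i) (b-+ j)))
             (λ-cong (row-linear fs i i<n) (P.sym (P.*-assoc h ⟦ f ⟧ (X^ j))))) ⟩
    norm f h * crtDet (h ⊗ ⟦ f ⟧) fs ∎
    where
    m = degree f
    n = degrees fs
    b : ℕ → Poly
    b j with j ℕ.<? m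
    ... | yes _ = X^ j
    ... | no  _ = ⟦ f ⟧ ⊗ X^ (j ∸ m)
    b-< : ∀ {j} → j < m → b j ≡ X^ j
    b-< {j} j<m with j ℕ.<? m
    ... | yes _   = ≡.refl
    ... | no  j≮m = contradiction j<m j≮m
    b-+ : ∀ j → b (m ℕ.+ j) ≡ ⟦ f ⟧ ⊗ X^ j
    b-+ j with m ℕ.+ j ℕ.<? m
    ... | yes lt = contradiction lt (ℕ.≤⇒≯ (ℕ.m≤m+n m j))
    ... | no  _  = ≡.cong (λ k → ⟦ f ⟧ ⊗ X^ k) (ℕ.m+n∸m≡n m j)
    b-monic : ∀ j → IsMonic j (b j)
    b-monic j with j ℕ.<? m
    ... | yes _   = isMonic-X^ j
    ... | no  j≮m = ≡.subst (λ k → IsMonic k (⟦ f ⟧ ⊗ X^ (j ∸ m))) (ℕ.m+[n∸m]≡n (ℕ.≮⇒≥ j≮m))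
                      (isMonic-⊗ (isMonic-⟦⟧ f) (isMonic-X^ (j ∸ m)))

  sgn² : ∀ n → sgn n * sgn n ≈ 1#
  sgn² zero    = *-identityˡ 1#
  sgn² (suc n) = trans (sym (-‿distribˡ-* _ _)) (trans (-‿cong (sym (-‿distribʳ-* _ _)))
    (trans (-‿involutive _) (sgn² n)))

  -- For two factors and h = 1, `crtDet` is the norm of the first factor modulo the second.
  -- Exchanging the factors only exchanges two blocks of rows, whence the sign.
  norm-symmetric : ∀ f g → norm f ⟦ g ⟧ ≈ sgn (degree f ℕ.* degree g) * norm g ⟦ f ⟧
  norm-symmetric f g = begin
    norm f ⟦ g ⟧                    ≈⟨ crtDet₂ g f ⟨
    crtDet [ 1# ] (g ∷ f ∷ [])      ≡⟨ ≡.cong (λ m → D m Mg) N≡ ⟩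
    D N Mg                           ≈⟨ D-cong N (λ i j i<N _ → swap i j i<N) ⟩
    D N (λ i j → Mf (π i) j)         ≈⟨ D-rows N π Mf π< ⟩
    D N (λ i j → I (π i) j) * D N Mf
      ≈⟨ *-congʳ (D-swap-blocks k m
           (λ i j i<k → reflexive (≡.cong (λ a → I a j) (π-< i<k)))
           (λ i j _ → reflexive (≡.cong (λ a → I a j) (π-+ i)))) ⟩
    sgn (k ℕ.* m) * D N Mf
      ≈⟨ *-cong (reflexive (≡.cong sgn (ℕ.*-comm k m)))
           (trans (reflexive (≡.cong (λ m → D m Mf) N≡′)) (crtDet₂ f g)) ⟩
    sgn (m ℕ.* k) * norm g ⟦ f ⟧ ∎
    where
    m = degree f
    k = degree g
    N = k ℕ.+ m
    N≡ : degrees (g ∷ f ∷ []) ≡ N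
    N≡ = ≡.cong (k ℕ.+_) (ℕ.+-identityʳ m)
    N≡′ : N ≡ degrees (f ∷ g ∷ [])
    N≡′ = ≡.trans (ℕ.+-comm k m) (≡.cong (m ℕ.+_) (≡.sym (ℕ.+-identityʳ k)))
    Mg Mf : Mat
    Mg i j = row (g ∷ f ∷ []) i ([ 1# ] ⊗ X^ j)
    Mf i j = row (f ∷ g ∷ []) i ([ 1# ] ⊗ X^ j)
    crtDet₂ : ∀ f g → crtDet [ 1# ] (f ∷ g ∷ []) ≈ norm g ⟦ f ⟧
    crtDet₂ f g = trans (crtDet-∷ [ 1# ] f (g ∷ [])) (trans
      (*-cong (norm-1 f) (trans (crtDet-∷ ([ 1# ] ⊗ ⟦ f ⟧) g []) (*-identityʳ _)))
      (trans (*-identityˡ _) (norm-cong g (⊗-identityˡ ⟦ f ⟧))))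
    π : ℕ → ℕ
    π i with i ℕ.<? k
    ... | yes _ = m ℕ.+ i
    ... | no  _ = i ∸ k
    π-< : ∀ {i} → i < k → π i ≡ m ℕ.+ i
    π-< {i} i<k with i ℕ.<? k
    ... | yes _   = ≡.refl
    ... | no  i≮k = contradiction i<k i≮k
    π-+ : ∀ i → π (k ℕ.+ i) ≡ i
    π-+ i with k ℕ.+ i ℕ.<? k
    ... | yes lt = contradiction lt (ℕ.≤⇒≯ (ℕ.m≤m+n k i))
    ... | no  _  = ℕ.m+n∸m≡n k i
    π< : ∀ i → i < N → π i < N
    π< i i<N with i ℕ.<? k
    ... | yes i<k = ≡.subst (m ℕ.+ i <_) (ℕ.+-comm m k) (ℕ.+-monoʳ-< m i<k)
    ... | no  _   = ℕ.≤-<-trans (ℕ.m∸n≤m i k) i<N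
    second : ∀ {i} → i < k → row (f ∷ g ∷ []) (m ℕ.+ i) ≡ rem g i
    second i<k = ≡.trans (row-+ f (g ∷ []) _) (row-< g [] i<k)
    swap : ∀ i j → i < N → Mg i j ≈ Mf (π i) j
    swap i j i<N with i ℕ.<? k
    ... | yes i<k = reflexive (≡.cong (λ r → r ([ 1# ] ⊗ X^ j)) (≡.trans (row-< g (f ∷ []) i<k) (≡.sym (second i<k))))
    ... | no  i≮k = reflexive (≡.cong (λ r → r ([ 1# ] ⊗ X^ j)) (≡.trans
      (≡.cong (row (g ∷ f ∷ [])) (≡.sym i≡))
      (≡.trans (row-+ g (f ∷ []) (i ∸ k)) (≡.trans (row-< f [] i∸k<m) (≡.sym (row-< f (g ∷ []) i∸k<m))))))
      where
      i≡ : k ℕ.+ (i ∸ k) ≡ i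
      i≡ = ℕ.m+[n∸m]≡n (ℕ.≮⇒≥ i≮k)
      i∸k<m : i ∸ k < m
      i∸k<m = ℕ.+-cancelˡ-< k _ _ (≡.subst (_< N) (≡.sym i≡) i<N)

  -- Symmetry carries multiplicativity from the argument to the modulus, and the signs match because
  -- degrees add. The degrees are related by a hypothesis since over the zero ring they are not
  -- determined by the polynomials.
  norm-product : ∀ f f₁ f₂ g → degree f ≡ degree f₁ ℕ.+ degree f₂ → ⟦ f ⟧ ≃ ⟦ f₁ ⟧ ⊗ ⟦ f₂ ⟧ →
                 norm f ⟦ g ⟧ ≈ norm f₁ ⟦ g ⟧ * norm f₂ ⟦ g ⟧
  norm-product f f₁ f₂ g deg eq = begin
    norm f ⟦ g ⟧                                       ≈⟨ norm-symmetric f g ⟩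
    sgn (degree f ℕ.* k) * norm g ⟦ f ⟧
      ≈⟨ *-cong (trans (reflexive (≡.cong sgn (≡.trans (≡.cong (ℕ._* k) deg) (ℕ.*-distribʳ-+ k (degree f₁) (degree f₂)))))
                       (sgn-+ (degree f₁ ℕ.* k) (degree f₂ ℕ.* k)))
                (trans (norm-cong g eq) (norm-⊗ g ⟦ f₁ ⟧ ⟦ f₂ ⟧)) ⟩
    (s₁ * s₂) * (norm g ⟦ f₁ ⟧ * norm g ⟦ f₂ ⟧)
      ≈⟨ solve 4 (λ s t x y → (s :* t) :* (x :* y) := (s :* x) :* (t :* y)) refl s₁ s₂ _ _ ⟩
    (s₁ * norm g ⟦ f₁ ⟧) * (s₂ * norm g ⟦ f₂ ⟧)
      ≈⟨ *-cong (norm-symmetric f₁ g) (norm-symmetric f₂ g) ⟨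
    norm f₁ ⟦ g ⟧ * norm f₂ ⟦ g ⟧ ∎
    where
    k = degree g
    s₁ = sgn (degree f₁ ℕ.* k)
    s₂ = sgn (degree f₂ ℕ.* k)

  below-[_] : ∀ a → Below 1 [ a ]
  below-[ a ] (suc i) _ = refl

  -- Substitution of X ^ q for X.
  dilate : ℕ → Poly → Poly
  dilate q []      = []
  dilate q (a ∷ p) = [ a ] ⊕ X^ q ⊗ dilate q p

  module _ (q : ℕ) where
    open import Algebra.Solver.Ring.NaturalCoefficients.Default P.commutativeSemiring as PS
      using () renaming (solve to solveᴾ; _:+_ to _⊞_; _:*_ to _⊠_; _:=_ to _≔_)
    import Relation.Binary.Reasoning.Setoid P.setoid as PR

    dilate-cong : ∀ {p r} → p ≃ r → dilate q p ≃ dilate q r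
    dilate-cong {[]}    {[]}    eq = P.refl
    dilate-cong {[]}    {b ∷ r} (mk eq) = P.sym (P.trans
      (P.+-cong (P.trans (∷-cong (sym (eq 0)) P.refl) 0∷[]≃[])
        (P.trans (P.*-congˡ {X^ q} (P.sym (dilate-cong {[]} {r} (mk λ i → eq (suc i))))) (P.zeroʳ (X^ q))))
      P.refl)
    dilate-cong {a ∷ p} {[]}    (mk eq) = P.trans
      (P.+-cong (P.trans (∷-cong (eq 0) P.refl) 0∷[]≃[])
        (P.trans (P.*-congˡ {X^ q} (dilate-cong {p} {[]} (mk λ i → eq (suc i)))) (P.zeroʳ (X^ q))))
      P.refl
    dilate-cong {a ∷ p} {b ∷ r} (mk eq) = P.+-cong (∷-cong (eq 0) P.refl)
      (P.*-congˡ {X^ q} (dilate-cong {p} {r} (mk λ i → eq (suc i))))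

    dilate-⊕ : ∀ p r → dilate q (p ⊕ r) ≃ dilate q p ⊕ dilate q r
    dilate-⊕ []      r       = P.refl
    dilate-⊕ (a ∷ p) []      = P.sym (P.+-identityʳ _)
    dilate-⊕ (a ∷ p) (b ∷ r) = P.trans (P.+-congˡ {[ a + b ]} (P.*-congˡ {X^ q} (dilate-⊕ p r)))
      (solveᴾ 5 (λ a b x p r → (a ⊞ b) ⊞ x ⊠ (p ⊞ r) ≔ (a ⊞ x ⊠ p) ⊞ (b ⊞ x ⊠ r)) P.refl
        [ a ] [ b ] (X^ q) (dilate q p) (dilate q r))

    dilate-· : ∀ a p → dilate q (a · p) ≃ a · dilate q p
    dilate-· a []      = P.refl
    dilate-· a (b ∷ p) = P.trans (P.+-congˡ {[ a * b ]} (P.trans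
        (P.*-congˡ {X^ q} (P.trans (dilate-· a p) (P.sym ([-]⊗ a (dilate q p)))))
        (P.trans (solveᴾ 3 (λ x a p → x ⊠ (a ⊠ p) ≔ a ⊠ (x ⊠ p)) P.refl (X^ q) [ a ] (dilate q p))
          ([-]⊗ a (X^ q ⊗ dilate q p)))))
      (P.sym (·-⊕ a [ b ] (X^ q ⊗ dilate q p)))

    dilate-⊗ : ∀ p r → dilate q (p ⊗ r) ≃ dilate q p ⊗ dilate q r
    dilate-⊗ []      r = P.refl
    dilate-⊗ (a ∷ p) r = PR.begin
      dilate q ((a · r) ⊕ (0# ∷ p ⊗ r))                  PR.≈⟨ dilate-⊕ (a · r) (0# ∷ p ⊗ r) ⟩
      dilate q (a · r) ⊕ ([ 0# ] ⊕ X^ q ⊗ dilate q (p ⊗ r))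
        PR.≈⟨ P.+-cong (P.trans (dilate-· a r) (P.sym ([-]⊗ a (dilate q r))))
             (P.+-cong 0∷[]≃[] (P.*-congˡ {X^ q} (dilate-⊗ p r))) ⟩
      [ a ] ⊗ dilate q r ⊕ X^ q ⊗ (dilate q p ⊗ dilate q r)
        PR.≈⟨ solveᴾ 4 (λ a x p r → a ⊠ r ⊞ x ⊠ (p ⊠ r) ≔ (a ⊞ x ⊠ p) ⊠ r) P.refl
             [ a ] (X^ q) (dilate q p) (dilate q r) ⟩
      ([ a ] ⊕ X^ q ⊗ dilate q p) ⊗ dilate q r PR.∎

    dilate-X^ : ∀ j → dilate q (X^ j) ≃ X^ (j ℕ.* q)
    dilate-X^ zero    = P.trans (P.+-congˡ {[ 1# ]} (P.zeroʳ (X^ q))) P.refl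
    dilate-X^ (suc j) = P.trans (P.+-cong 0∷[]≃[] (P.*-congˡ {X^ q} (dilate-X^ j))) (P.sym (X^-+ q (j ℕ.* q)))

    below-X^⊗ : ∀ n {m p} → Below m p → Below (n ℕ.+ m) (X^ n ⊗ p)
    below-X^⊗ n {m} {p} b = below-≃ (P.sym (X^-⊗ n p)) λ i n+m≤i →
      trans (reflexive (≡.trans (≡.cong (coeff (replicate n 0# ++ p)) (≡.sym (ℕ.m+[n∸m]≡n (ℕ.m+n≤o⇒m≤o n n+m≤i))))
        (coeff-shift n p (i ∸ n)))) (b (i ∸ n) (ℕ.m+n≤o⇒m≤o∸n m (≡.subst (_≤ i) (ℕ.+-comm n m) n+m≤i)))

    dilate-below : ∀ m p → Below (suc m) p → Below (suc (m ℕ.* q)) (dilate q p)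
    dilate-below m       []      b = λ _ _ → refl
    dilate-below zero    (a ∷ p) b = below-⊕ [ a ] (X^ q ⊗ dilate q p) below-[ a ]
      (below-≃ (P.sym (P.trans (P.*-congˡ {X^ q} (dilate-cong {p} {[]} (below-0 p λ i _ → b (suc i) (s≤s z≤n)))) (P.zeroʳ (X^ q))))
        λ _ _ → refl)
    dilate-below (suc m) (a ∷ p) b = below-⊕ [ a ] (X^ q ⊗ dilate q p) (below-≤ {p = [ a ]} (s≤s z≤n) below-[ a ])
      (≡.subst (λ n → Below n (X^ q ⊗ dilate q p)) (ℕ.+-suc q (m ℕ.* q))
        (below-X^⊗ q (dilate-below m p λ i m<i → b (suc i) (s≤s m<i))))

    isMonic-⊕ : ∀ {n} r p → Below n r → IsMonic n p → IsMonic n (r ⊕ p)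
    isMonic-⊕ {n} r p b (isMonic l b′) = isMonic
      (trans (coeff-⊕ r p n) (trans (+-congʳ (b n ℕ.≤-refl)) (trans (+-identityˡ _) l)))
      (below-⊕ r p (below-≤ {p = r} (ℕ.n≤1+n n) b) b′)

    module _ .{{_ : NonZero q}} where
      dilate-monic : ∀ m p → IsMonic m p → IsMonic (m ℕ.* q) (dilate q p)
      dilate-monic m       []      (isMonic l b) = isMonic l (λ _ _ → refl)
      dilate-monic zero    (a ∷ p) (isMonic l b) = isMonic-≃
        (P.sym (P.trans (P.+-cong (∷-cong l P.refl) (P.trans (P.*-congˡ {X^ q}
          (dilate-cong {p} {[]} (below-0 p λ i _ → b (suc i) (s≤s z≤n)))) (P.zeroʳ (X^ q)))) P.refl))
        (isMonic-X^ 0)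
      dilate-monic (suc m) (a ∷ p) (isMonic l b) = isMonic-⊕ [ a ] (X^ q ⊗ dilate q p)
        (below-≤ {p = [ a ]} (ℕ.≤-trans (ℕ.>-nonZero⁻¹ q) (ℕ.m≤m+n q (m ℕ.* q))) below-[ a ])
        (isMonic-⊗ (isMonic-X^ q) (dilate-monic m p (isMonic l λ i m<i → b (suc i) (s≤s m<i))))

      coeff-dilate : ∀ p a {b} → b < q → coeff (dilate q p) (a ℕ.* q ℕ.+ b) ≈ I b 0 * coeff p a
      coeff-dilate []      a       b<q = sym (zeroʳ _)
      coeff-dilate (x ∷ p) zero    {b} b<q = trans (coeff-⊕ [ x ] (X^ q ⊗ dilate q p) b) (trans
        (+-congˡ (trans (coeffs (X^-⊗ q (dilate q p)) b) (reflexive (coeff-shift-< (dilate q p) b<q))))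
        (trans (+-identityʳ _) (const b)))
        where
        const : ∀ b → coeff [ x ] b ≈ I b 0 * x
        const zero    = sym (*-identityˡ x)
        const (suc b) = sym (zeroˡ x)
      coeff-dilate (x ∷ p) (suc a) {b} b<q = trans (coeff-⊕ [ x ] (X^ q ⊗ dilate q p) (q ℕ.+ a ℕ.* q ℕ.+ b)) (trans
        (+-cong
          (below-[ x ] _ (ℕ.≤-trans (ℕ.>-nonZero⁻¹ q) (ℕ.≤-trans (ℕ.m≤m+n q (a ℕ.* q)) (ℕ.m≤m+n _ b))))
          (trans (coeffs (X^-⊗ q (dilate q p)) _) (trans (reflexive (≡.trans
            (≡.cong (coeff (replicate q 0# ++ dilate q p)) (ℕ.+-assoc q (a ℕ.* q) b))
            (coeff-shift q (dilate q p) (a ℕ.* q ℕ.+ b)))) (coeff-dilate p a b<q))))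
        (+-identityˡ _))

      coeff-X^⊗dilate : ∀ p a {b b′} → b < q → b′ < q →
                        coeff (X^ b′ ⊗ dilate q p) (a ℕ.* q ℕ.+ b) ≈ I b b′ * coeff p a
      coeff-X^⊗dilate p a {b} {b′} b<q b′<q = trans (coeffs (X^-⊗ b′ (dilate q p)) _) (go (b′ ℕ.≤? b) a)
        where
        at-shift : ∀ {x y} → x ≡ b′ ℕ.+ y → coeff (replicate b′ 0# ++ dilate q p) x ≈ coeff (dilate q p) y
        at-shift {y = y} ≡.refl = reflexive (coeff-shift b′ (dilate q p) y)
        vanish : ∀ {b b′} a → b ≢ b′ → I b b′ * coeff p a ≈ 0#
        vanish a b≢b′ = trans (*-congʳ (reflexive (I-≢ b≢b′))) (zeroˡ _)
        go : Dec (b′ ≤ b) → ∀ a → coeff (replicate b′ 0# ++ dilate q p) (a ℕ.* q ℕ.+ b) ≈ I b b′ * coeff p a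
        go (yes b′≤b) a = begin
          coeff (replicate b′ 0# ++ dilate q p) (a ℕ.* q ℕ.+ b)
            ≈⟨ at-shift (≡.trans (≡.cong (a ℕ.* q ℕ.+_) (≡.sym e≡))
                 (x+[y+z]≡y+[x+z] (a ℕ.* q) b′ (b ∸ b′))) ⟩
          coeff (dilate q p) (a ℕ.* q ℕ.+ (b ∸ b′))
            ≈⟨ coeff-dilate p a (ℕ.≤-<-trans (ℕ.m∸n≤m b b′) b<q) ⟩
          I (b ∸ b′) 0 * coeff p a
            ≈⟨ *-congʳ (reflexive (≡.sym (I-injective (b′ ℕ.+_) (b ∸ b′) 0 (ℕ.+-cancelˡ-≡ b′ _ _)))) ⟩
          I (b′ ℕ.+ (b ∸ b′)) (b′ ℕ.+ 0) * coeff p a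
            ≈⟨ *-congʳ (reflexive (≡.cong₂ I e≡ (ℕ.+-identityʳ b′))) ⟩
          I b b′ * coeff p a ∎
          where
          e≡ : b′ ℕ.+ (b ∸ b′) ≡ b
          e≡ = ℕ.m+[n∸m]≡n b′≤b
          x+[y+z]≡y+[x+z] : ∀ x y z → x ℕ.+ (y ℕ.+ z) ≡ y ℕ.+ (x ℕ.+ z)
          x+[y+z]≡y+[x+z] x y z = ≡.trans (≡.sym (ℕ.+-assoc x y z)) (≡.trans (≡.cong (ℕ._+ z) (ℕ.+-comm x y)) (ℕ.+-assoc y x z))
        go (no b′≰b) zero = trans (reflexive (coeff-shift-< (dilate q p) (ℕ.≰⇒> b′≰b)))
          (sym (vanish 0 (ℕ.<⇒≢ (ℕ.≰⇒> b′≰b))))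
        -- Subtracting b′ from the last digit b borrows one from the digit before it. The new last
        -- digit (q - b′) + b lies strictly between 0 and q, where a polynomial in X^q has
        -- coefficient 0.
        go (no b′≰b) (suc a) = begin
          coeff (replicate b′ 0# ++ dilate q p) (q ℕ.+ a ℕ.* q ℕ.+ b)
            ≈⟨ at-shift x≡ ⟩
          coeff (dilate q p) (a ℕ.* q ℕ.+ ((q ∸ b′) ℕ.+ b))
            ≈⟨ coeff-dilate p a e<q ⟩
          I ((q ∸ b′) ℕ.+ b) 0 * coeff p a
            ≈⟨ vanish a (ℕ.m<n⇒n≢0 (ℕ.<-≤-trans (ℕ.m<n⇒0<n∸m b′<q) (ℕ.m≤m+n (q ∸ b′) b))) ⟩
          0# ≈⟨ sym (vanish (suc a) (ℕ.<⇒≢ (ℕ.≰⇒> b′≰b))) ⟩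
          I b b′ * coeff p (suc a) ∎
          where
          q≡ : b′ ℕ.+ (q ∸ b′) ≡ q
          q≡ = ℕ.m+[n∸m]≡n (ℕ.<⇒≤ b′<q)
          e<q : (q ∸ b′) ℕ.+ b < q
          e<q = ≡.subst ((q ∸ b′) ℕ.+ b <_) (ℕ.m∸n+n≡m (ℕ.<⇒≤ b′<q)) (ℕ.+-monoʳ-< (q ∸ b′) (ℕ.≰⇒> b′≰b))
          x≡ : q ℕ.+ a ℕ.* q ℕ.+ b ≡ b′ ℕ.+ (a ℕ.* q ℕ.+ ((q ∸ b′) ℕ.+ b))
          x≡ = ≡.trans (≡.cong (λ z → z ℕ.+ a ℕ.* q ℕ.+ b) (≡.sym q≡)) (rearrange b′ (q ∸ b′) (a ℕ.* q) b)
            where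
            rearrange : ∀ u v w x → u ℕ.+ v ℕ.+ w ℕ.+ x ≡ u ℕ.+ (w ℕ.+ (v ℕ.+ x))
            rearrange = solveℕ 4 (λ u v w x → u :+: v :+: w :+: x :=: u :+: (w :+: (v :+: x))) ≡.refl

  fromPoly : ℕ → Poly → Monic
  fromPoly n p = monic (applyUpTo (coeff p) n)

  degree-fromPoly : ∀ n p → degree (fromPoly n p) ≡ n
  degree-fromPoly n p = length-applyUpTo (coeff p) n

  ⟦fromPoly⟧ : ∀ {n p} → IsMonic n p → ⟦ fromPoly n p ⟧ ≃ p
  ⟦fromPoly⟧ {n} {p} mp = monic-≃ (applyUpTo (coeff p) n) (degree-fromPoly n p) mp
    λ i<n → reflexive (coeff-applyUpTo (coeff p) n i<n)
    where
    coeff-applyUpTo : ∀ g n {i} → i < n → coeff (applyUpTo g n) i ≡ g i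
    coeff-applyUpTo g (suc n) {zero}  _         = ≡.refl
    coeff-applyUpTo g (suc n) {suc i} (s<s i<n) = coeff-applyUpTo (g ∘ suc) n i<n

  dilateᵐ : ℕ → Monic → Monic
  dilateᵐ q f = fromPoly (degree f ℕ.* q) (dilate q ⟦ f ⟧)

a*q+b<m*q : ∀ {a b m q} → a < m → b < q → a ℕ.* q ℕ.+ b < m ℕ.* q
a*q+b<m*q {a} {b} {m} {q} a<m b<q = ℕ.<-≤-trans (ℕ.+-monoʳ-< (a ℕ.* q) b<q)
  (≡.subst (_≤ m ℕ.* q) (ℕ.+-comm q (a ℕ.* q)) (ℕ.*-monoˡ-≤ q a<m))

[a*q+b]%q≡b : ∀ a {b q} .{{_ : NonZero q}} → b < q → (a ℕ.* q ℕ.+ b) ℕ.% q ≡ b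
[a*q+b]%q≡b a {b} {q} b<q = ≡.trans (≡.cong (ℕ._% q) (ℕ.+-comm (a ℕ.* q) b))
  (≡.trans (ℕ.[m+kn]%n≡m%n b a q) (ℕ.m<n⇒m%n≡m b<q))

[a*q+b]/q≡a : ∀ a {b q} .{{_ : NonZero q}} → b < q → (a ℕ.* q ℕ.+ b) ℕ./ q ≡ a
[a*q+b]/q≡a a {b} {q} b<q = ≡.trans (ℕ.+-distrib-/-∣ˡ b (n∣m*n a))
  (≡.trans (≡.cong₂ ℕ._+_ (ℕ.m*n/n≡m a q) (ℕ.m<n⇒m/n≡0 b<q)) (ℕ.+-identityʳ a))

-- Norms under substitution of powers of X, and norms of products of linear factors

module NormProperties {c ℓ} (R : CommutativeRing c ℓ) where
  open CommutativeRing R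
  open Polynomial R
  open Polys R
  open Sums R
  open Det R
  open Norms R
  open import Relation.Binary.Reasoning.Setoid setoid
  open import Algebra.Properties.Semiring.Exp semiring using (_^_; ^-congˡ; ^-homo-*)
  open import Algebra.Solver.Ring.NaturalCoefficients.Default commutativeSemiring
    using (solve; _:+_; _:*_; _:=_; con)
  private module P = CommutativeRing polyRing

  module _ (q : ℕ) .{{_ : NonZero q}} (f : Monic) where
    private
      m = degree f
      F = dilateᵐ q f

    degree-dilateᵐ : degree F ≡ m ℕ.* q
    degree-dilateᵐ = degree-fromPoly (m ℕ.* q) (dilate q ⟦ f ⟧)

    ⟦dilateᵐ⟧ : ⟦ F ⟧ ≃ dilate q ⟦ f ⟧
    ⟦dilateᵐ⟧ = ⟦fromPoly⟧ (dilate-monic q m ⟦ f ⟧ (isMonic-⟦⟧ f))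

    below-dilate-rem : ∀ {m r b} → Below m r → b < q → Below (m ℕ.* q) (X^ b ⊗ dilate q r)
    below-dilate-rem {zero} {r} {b} br b<q = below-≃ (P.sym (P.trans
      (P.*-congˡ {X^ b} (dilate-cong q {r} {[]} (below-0 r br))) (P.zeroʳ (X^ b)))) λ _ _ → refl
    below-dilate-rem {suc m} {r} {b} br b<q = below-≤ {p = X^ b ⊗ dilate q r}
      (≡.subst (_≤ q ℕ.+ m ℕ.* q) (≡.sym (ℕ.+-suc b (m ℕ.* q))) (ℕ.+-monoˡ-≤ (m ℕ.* q) b<q))
      (below-X^⊗ q b (dilate-below q m r br))

    dilate-mod : ∀ p b → b < q → (dilate q p ⊗ X^ b) mod F ≃ X^ b ⊗ dilate q (p mod f)
    dilate-mod p b b<q = let e , below-r = divMod-spec p f; u = proj₁ (divMod p f) in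
      mod-unique {dilate q p ⊗ X^ b} {F} {X^ b ⊗ dilate q u}
        (≡.subst (λ n → Below n (X^ b ⊗ dilate q (p mod f))) (≡.sym degree-dilateᵐ)
          (below-dilate-rem {m} {p mod f} below-r b<q))
        (P.trans (P.*-comm (dilate q p) (X^ b)) (P.trans
          (P.*-congˡ {X^ b} (P.trans (dilate-cong q e) (P.trans (dilate-⊕ q (u ⊗ ⟦ f ⟧) (p mod f))
            (P.+-congʳ {dilate q (p mod f)} (P.trans (dilate-⊗ q u ⟦ f ⟧) (P.*-congˡ {dilate q u} (P.sym ⟦dilateᵐ⟧)))))))
          (P.trans (P.distribˡ (X^ b) (dilate q u ⊗ ⟦ F ⟧) (dilate q (p mod f)))
            (P.+-congʳ {X^ b ⊗ dilate q (p mod f)} (P.sym (P.*-assoc (X^ b) (dilate q u) ⟦ F ⟧))))))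

    -- R[X] is the direct sum of the X^b R[X^q] for b < q. Multiplication by g(X^q) and reduction
    -- modulo f(X^q) preserve each summand and act on it as g and f do on R[X].
    rem-dilate : ∀ g a a′ {b b′} → b < q → b′ < q →
      rem F (a ℕ.* q ℕ.+ b) (dilate q g ⊗ X^ (a′ ℕ.* q ℕ.+ b′)) ≈ I b b′ * rem f a (g ⊗ X^ a′)
    rem-dilate g a a′ {b} {b′} b<q b′<q = begin
      rem F (a ℕ.* q ℕ.+ b) (dilate q g ⊗ X^ (a′ ℕ.* q ℕ.+ b′))
        ≈⟨ rem-cong F _ (P.trans (P.*-congˡ {dilate q g} (P.trans (X^-+ (a′ ℕ.* q) b′)
             (P.*-congʳ {X^ b′} (P.sym (dilate-X^ q a′)))))
             (P.trans (P.sym (P.*-assoc (dilate q g) (dilate q (X^ a′)) (X^ b′)))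
               (P.*-congʳ {X^ b′} (P.sym (dilate-⊗ q g (X^ a′)))))) ⟩
      rem F (a ℕ.* q ℕ.+ b) (dilate q (g ⊗ X^ a′) ⊗ X^ b′)
        ≈⟨ coeffs (dilate-mod (g ⊗ X^ a′) b′ b′<q) (a ℕ.* q ℕ.+ b) ⟩
      coeff (X^ b′ ⊗ dilate q ((g ⊗ X^ a′) mod f)) (a ℕ.* q ℕ.+ b)
        ≈⟨ coeff-X^⊗dilate q ((g ⊗ X^ a′) mod f) a b<q b′<q ⟩
      I b b′ * rem f a (g ⊗ X^ a′) ∎

    -- In the basis X ^ (a q + b), with b varying slowest, the matrix of
    -- multiplication by g(X ^ q) consists of q equal diagonal blocks.
    norm-dilate : ∀ g → norm F (dilate q g) ≈ norm f g ^ q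
    norm-dilate g = trans (reflexive (≡.cong (λ n → D n Mg) degree-dilateᵐ)) (go m ≡.refl)
      where
      Mg : Mat
      Mg i j = rem F i (dilate q g ⊗ X^ j)
      go : ∀ m′ → m′ ≡ m → D (m′ ℕ.* q) Mg ≈ D m′ (λ i j → rem f i (g ⊗ X^ j)) ^ q
      go zero         _  = sym (1^ q)
        where
        1^ : ∀ n → 1# ^ n ≈ 1#
        1^ zero    = refl
        1^ (suc n) = trans (*-identityˡ _) (1^ n)
      go m′@(suc _) _ = begin
        D (m′ ℕ.* q) Mg                        ≈⟨ D-permute (m′ ℕ.* q) π Mg π< π-injective ⟨
        D (m′ ℕ.* q) (λ i j → Mg (π i) (π j))  ≡⟨ ≡.cong (λ n → D n (λ i j → Mg (π i) (π j))) (ℕ.*-comm m′ q) ⟩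
        D (q ℕ.* m′) (λ i j → Mg (π i) (π j))
          ≈⟨ D-blocks q m′
               (λ b i j b<q i<m lt → let y = suc b ℕ.* m′ ℕ.+ j in begin
                 Mg (π (b ℕ.* m′ ℕ.+ i)) (π y)
                   ≈⟨ entry (a*q+b<m*q b<q i<m) lt ⟩
                 I ((b ℕ.* m′ ℕ.+ i) ℕ./ m′) (y ℕ./ m′) * N ((b ℕ.* m′ ℕ.+ i) ℕ.% m′) (y ℕ.% m′)
                   ≈⟨ *-congʳ (reflexive (I-≢ λ eq → ℕ.<⇒≢ (b<y/m b j) (≡.trans (≡.sym ([a*q+b]/q≡a b i<m)) eq))) ⟩
                 0# * N ((b ℕ.* m′ ℕ.+ i) ℕ.% m′) (y ℕ.% m′) ≈⟨ zeroˡ _ ⟩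
                 0# ∎)
               (λ b i j b<q i<m j<m → begin
                 Mg (π (b ℕ.* m′ ℕ.+ i)) (π (b ℕ.* m′ ℕ.+ j))
                   ≈⟨ entry (a*q+b<m*q b<q i<m) (a*q+b<m*q b<q j<m) ⟩
                 I ((b ℕ.* m′ ℕ.+ i) ℕ./ m′) ((b ℕ.* m′ ℕ.+ j) ℕ./ m′) * N ((b ℕ.* m′ ℕ.+ i) ℕ.% m′) ((b ℕ.* m′ ℕ.+ j) ℕ.% m′)
                   ≡⟨ ≡.cong₂ _*_ (≡.cong₂ I ([a*q+b]/q≡a b i<m) ([a*q+b]/q≡a b j<m))
                        (≡.cong₂ N ([a*q+b]%q≡b b i<m) ([a*q+b]%q≡b b j<m)) ⟩
                 I b b * N i j ≈⟨ *-congʳ (reflexive (I-≡ b)) ⟩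
                 1# * N i j    ≈⟨ *-identityˡ _ ⟩
                 N i j         ∎) ⟩
        D m′ N ^ q ∎
        where
        N : Mat
        N i j = rem f i (g ⊗ X^ j)
        -- An index with digits b, a to the base m′ is sent to the index with digits a, b to the
        -- base q: the two digits are exchanged.
        π : ℕ → ℕ
        π x = (x ℕ.% m′) ℕ.* q ℕ.+ x ℕ./ m′
        x/m<q : ∀ {x} → x < q ℕ.* m′ → x ℕ./ m′ < q
        x/m<q {x} lt = ℕ.m<n*o⇒m/o<n lt
        π< : ∀ i → i < m′ ℕ.* q → π i < m′ ℕ.* q
        π< i lt = a*q+b<m*q (ℕ.m%n<n i m′) (x/m<q (≡.subst (i <_) (ℕ.*-comm m′ q) lt))
        π-injective : ∀ i j → i < m′ ℕ.* q → j < m′ ℕ.* q → π i ≡ π j → i ≡ j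
        π-injective i j i< j< eq = ≡.trans (ℕ.m≡m%n+[m/n]*n i m′)
          (≡.trans (≡.cong₂ (λ x y → x ℕ.+ y ℕ.* m′)
            (≡.trans (≡.sym ([a*q+b]/q≡a (i ℕ.% m′) bi)) (≡.trans (≡.cong (ℕ._/ q) eq) ([a*q+b]/q≡a (j ℕ.% m′) bj)))
            (≡.trans (≡.sym ([a*q+b]%q≡b (i ℕ.% m′) bi)) (≡.trans (≡.cong (ℕ._% q) eq) ([a*q+b]%q≡b (j ℕ.% m′) bj))))
          (≡.sym (ℕ.m≡m%n+[m/n]*n j m′)))
          where
          bi = x/m<q (≡.subst (i <_) (ℕ.*-comm m′ q) i<)
          bj = x/m<q (≡.subst (j <_) (ℕ.*-comm m′ q) j<)
        entry : ∀ {x y} → x < q ℕ.* m′ → y < q ℕ.* m′ →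
                Mg (π x) (π y) ≈ I (x ℕ./ m′) (y ℕ./ m′) * N (x ℕ.% m′) (y ℕ.% m′)
        entry {x} {y} x< y< = rem-dilate g (x ℕ.% m′) (y ℕ.% m′) (x/m<q x<) (x/m<q y<)
        b<y/m : ∀ b j → b < (suc b ℕ.* m′ ℕ.+ j) ℕ./ m′
        b<y/m b j = ≡.subst (_≤ (suc b ℕ.* m′ ℕ.+ j) ℕ./ m′) (ℕ.m*n/n≡m (suc b) m′)
          (ℕ./-monoˡ-≤ m′ (ℕ.m≤m+n (suc b ℕ.* m′) j))

  modulo-* : ∀ {f p q r s} → p ≃ q modulo f → r ≃ s modulo f → p ⊗ r ≃ q ⊗ s modulo f
  modulo-* {f} {p} {q} {r} {s} (u , e) (v , e′) = u ⊗ r ⊕ q ⊗ v , (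
    P.trans (P.*-congʳ {r} e) (P.trans (P.distribʳ r (u ⊗ ⟦ f ⟧) q)
    (P.trans (P.+-congˡ {u ⊗ ⟦ f ⟧ ⊗ r} (P.*-congˡ {q} e′))
    (PS.solve 6 (λ u f r q v s → u PS.:* f PS.:* r PS.:+ q PS.:* (v PS.:* f PS.:+ s)
                  PS.:= (u PS.:* r PS.:+ q PS.:* v) PS.:* f PS.:+ q PS.:* s) P.refl u ⟦ f ⟧ r q v s))))
    where module PS = Algebra.Solver.Ring.NaturalCoefficients.Default P.commutativeSemiring

  modulo-refl : ∀ {f p} → p ≃ p modulo f
  modulo-refl {f} {p} = [] , P.refl

  modulo-X^ : ∀ {f} j n → X^ n ≃ X^ 1 modulo f → X^ (j ℕ.* n) ≃ X^ j modulo f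
  modulo-X^ {f} zero    n eq = modulo-refl {f} {X^ 0}
  modulo-X^ {f} (suc j) n eq =
    let u , e = modulo-* {f} {X^ n} {X^ 1} {X^ (j ℕ.* n)} {X^ j} eq (modulo-X^ {f} j n eq)
    in  u , P.trans (X^-+ n (j ℕ.* n)) (P.trans e (P.+-congˡ {u ⊗ ⟦ f ⟧} (P.sym (X^-+ 1 j))))

  linear-dilate : ∀ {λ′} q → Linear λ′ → Linear (λ p → λ′ (dilate q p))
  linear-dilate q lin = record
    { λ-cong = λ eq → λ-cong lin (dilate-cong q eq)
    ; λ-⊕ = λ p r → trans (λ-cong lin (dilate-⊕ q p r)) (λ-⊕ lin _ _)
    ; λ-· = λ a p → trans (λ-cong lin (dilate-· q a p)) (λ-· lin a _) }

  -- X ↦ X ^ q induces an automorphism σ of R[X]/(f), with inverse X ↦ X ^ q′, and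
  -- multiplication by σ g is conjugate under σ to multiplication by g.
  norm-automorphism : ∀ q q′ f h → dilate q ⟦ f ⟧ ≃ h ⊗ ⟦ f ⟧ → X^ (q′ ℕ.* q) ≃ X^ 1 modulo f →
                      ∀ g → norm f (dilate q g) ≈ norm f g
  norm-automorphism q q′ f h f∣ inv g = begin
    norm f (dilate q g)                        ≈⟨ *-identityʳ _ ⟨
    norm f (dilate q g) * 1#                   ≈⟨ *-congˡ invertible ⟨
    norm f (dilate q g) * (D m S * D m S′)     ≈⟨ *-assoc _ _ _ ⟨
    norm f (dilate q g) * D m S * D m S′       ≈⟨ *-congʳ conjugate ⟩
    D m S * norm f g * D m S′
      ≈⟨ solve 3 (λ s x t → s :* x :* t := x :* (s :* t)) refl _ _ _ ⟩
    norm f g * (D m S * D m S′)                ≈⟨ *-congˡ invertible ⟩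
    norm f g * 1#                              ≈⟨ *-identityʳ _ ⟩
    norm f g                                   ∎
    where
    m = degree f
    S S′ : Mat
    S  i j = rem f i (dilate q (X^ j))
    S′ i j = rem f i (X^ (j ℕ.* q′))
    σ-linear : ∀ i → Linear (λ p → rem f i (dilate q p))
    σ-linear i = linear-dilate q (rem-linear f i)
    σ-annihilates : ∀ i → Annihilates (λ p → rem f i (dilate q p)) f
    σ-annihilates i u = coeffs (mod-multiple f (dilate q u ⊗ h)
      (P.trans (dilate-⊗ q u ⟦ f ⟧) (P.trans (P.*-congˡ {dilate q u} f∣) (P.sym (P.*-assoc (dilate q u) h ⟦ f ⟧))))) i
    conjugate : norm f (dilate q g) * D m S ≈ D m S * norm f g
    conjugate = begin
      norm f (dilate q g) * D m S
        ≈⟨ D-mul m (λ i j → rem f i (dilate q g ⊗ X^ j)) S ⟨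
      D m (mul m (λ i j → rem f i (dilate q g ⊗ X^ j)) S)
        ≈⟨ D-cong m (λ i j _ _ → trans
             (sym (annihilates-expand {f = f} (linear-rem f (dilate q g) i) (rem-annihilates f (dilate q g) i) (dilate q (X^ j))))
             (trans (rem-cong f i (P.sym (dilate-⊗ q g (X^ j))))
               (annihilates-expand {f = f} (σ-linear i) (σ-annihilates i) (g ⊗ X^ j)))) ⟩
      D m (mul m S (λ i j → rem f i (g ⊗ X^ j)))
        ≈⟨ D-mul m S (λ i j → rem f i (g ⊗ X^ j)) ⟩
      D m S * norm f g ∎
    q′q : ∀ j → X^ (j ℕ.* q′ ℕ.* q) ≃ X^ j modulo f
    q′q j = ≡.subst (λ n → X^ n ≃ X^ j modulo f) (≡.sym (ℕ.*-assoc j q′ q)) (modulo-X^ {f} j (q′ ℕ.* q) inv)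
    invertible : D m S * D m S′ ≈ 1#
    invertible = begin
      D m S * D m S′     ≈⟨ D-mul m S S′ ⟨
      D m (mul m S S′)
        ≈⟨ D-cong m (λ i j _ j<m → begin
             mul m S S′ i j
               ≈⟨ annihilates-expand {f = f} (σ-linear i) (σ-annihilates i) (X^ (j ℕ.* q′)) ⟨
             rem f i (dilate q (X^ (j ℕ.* q′)))  ≈⟨ rem-cong f i (dilate-X^ q (j ℕ.* q′)) ⟩
             rem f i (X^ (j ℕ.* q′ ℕ.* q))       ≈⟨ rem-modulo f i {_} {X^ j} (q′q j) ⟩
             rem f i (X^ j)                      ≈⟨ rem-X^ f i j<m ⟩
             I i j ∎) ⟩
      D m I ≈⟨ D-I m ⟩
      1# ∎

  private
    ∏ : List Carrier → Carrier
    ∏ = foldr _*_ 1#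

  -- X - β is congruent to α - β modulo X - α. This fixes the sign convention: in the resultant the
  -- roots of the modulus come first.
  norm-X-X : ∀ α β → norm (X- α) ⟦ X- β ⟧ ≈ α + - β
  norm-X-X α β = begin
    1# * rem (X- α) 0 (⟦ X- β ⟧ ⊗ X^ 0) * 1# + 0#
      ≈⟨ trans (+-identityʳ _) (trans (*-identityʳ _) (*-identityˡ _)) ⟩
    rem (X- α) 0 (⟦ X- β ⟧ ⊗ X^ 0)
      ≈⟨ coeffs (mod-unique {⟦ X- β ⟧ ⊗ X^ 0} {X- α} {[ 1# ]} {[ α + - β ]} below-[ α + - β ] eq) 0 ⟩
    α + - β ∎
    where
    eq : ⟦ X- β ⟧ ⊗ X^ 0 ≃ [ 1# ] ⊗ ⟦ X- α ⟧ ⊕ [ α + - β ]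
    eq = P.trans (P.*-identityʳ ⟦ X- β ⟧) (P.trans
      (∷-cong (sym (begin
        - α + (α + - β)  ≈⟨ +-assoc _ _ _ ⟨
        - α + α + - β    ≈⟨ +-congʳ (-‿inverseˡ α) ⟩
        0# + - β         ≈⟨ +-identityˡ _ ⟩
        - β              ∎)) P.refl)
      (P.+-congʳ {[ α + - β ]} (P.sym (⊗-identityˡ ⟦ X- α ⟧))))

  norm-X-∏ : ∀ α βs → norm (X- α) ⟦ ∏ᵐ (map X-_ βs) ⟧ ≈ ∏ (map (λ β → α + - β) βs)
  norm-X-∏ α []       = norm-1 (X- α)
  norm-X-∏ α (β ∷ βs) = trans (norm-cong (X- α) (⟦⊗ᵐ⟧ (X- β) (∏ᵐ (map X-_ βs))))
    (trans (norm-⊗ (X- α) ⟦ X- β ⟧ ⟦ ∏ᵐ (map X-_ βs) ⟧) (*-cong (norm-X-X α β) (norm-X-∏ α βs)))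

  norm-∏-∏ : ∀ αs βs → norm (∏ᵐ (map X-_ αs)) ⟦ ∏ᵐ (map X-_ βs) ⟧ ≈ ∏ (map (λ α → ∏ (map (λ β → α + - β) βs)) αs)
  norm-∏-∏ []       βs = refl
  norm-∏-∏ (α ∷ αs) βs = trans
    (norm-product (X- α ⊗ᵐ ∏ᵐ (map X-_ αs)) (X- α) (∏ᵐ (map X-_ αs)) (∏ᵐ (map X-_ βs))
      (degree-⊗ᵐ (X- α) (∏ᵐ (map X-_ αs))) (⟦⊗ᵐ⟧ (X- α) (∏ᵐ (map X-_ αs))))
    (*-cong (norm-X-∏ α βs) (norm-∏-∏ αs βs))

-- Norms under ring homomorphisms

module Homomorphism {c ℓ c′ ℓ′} (R : CommutativeRing c ℓ) (S : CommutativeRing c′ ℓ′)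
  (h : CommutativeRing.Carrier R → CommutativeRing.Carrier S)
  (h-isHomomorphism : RingMorphisms.IsRingHomomorphism (CommutativeRing.rawRing R) (CommutativeRing.rawRing S) h)
  where

  open RingMorphisms.IsRingHomomorphism h-isHomomorphism using ()
    renaming (⟦⟧-cong to h-cong; +-homo to h-+; *-homo to h-*; -‿homo to h-neg; 0#-homo to h-0; 1#-homo to h-1)
  private
    module R = CommutativeRing R
    module S = CommutativeRing S
    module RP = Polynomial R
    module SP = Polynomial S
    module R≃ = Polys R
    module S≃ = Polys S
    module SRing = CommutativeRing S≃.polyRing
    module RS = Sums R
    module SS = Sums S
    module RD = Det R
    module SD = Det S
  open Norms R using () renaming (norm to normᴿ)
  open Norms S using () renaming (norm to normˢ; rem-cong to rem-congˢ)
  open RP using () renaming (coeff to coeffᴿ)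
  open SP using () renaming (coeff to coeffˢ)

  h-∑ : ∀ n f → h (RS.∑ n f) S.≈ SS.∑ n (h ∘ f)
  h-∑ zero    f = h-0
  h-∑ (suc n) f = S.trans (h-+ _ _) (S.+-congˡ (h-∑ n (f ∘ suc)))

  h-sgn : ∀ n → h (RD.sgn n) S.≈ SD.sgn n
  h-sgn zero    = h-1
  h-sgn (suc n) = S.trans (h-neg _) (S.-‿cong (h-sgn n))

  h-D : ∀ n M → h (RD.D n M) S.≈ SD.D n (λ i j → h (M i j))
  h-D zero    M = h-1
  h-D (suc n) M = S.trans (h-∑ (suc n) (λ j → RD.sgn j R.* M 0 j R.* RD.D n (RD.minor j M)))
    (SS.∑-cong (suc n)
      {λ j → h (RD.sgn j R.* M 0 j R.* RD.D n (RD.minor j M))}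
      {λ j → SD.sgn j S.* h (M 0 j) S.* SD.D n (SD.minor j (λ i j → h (M i j)))} λ j _ →
        S.trans (h-* _ _) (S.*-cong (S.trans (h-* _ _) (S.*-congʳ (h-sgn j))) (h-D n (RD.minor j M))))

  mapᵐ : RP.Monic → SP.Monic
  mapᵐ f = SP.monic (map h (RP.lower f))

  degree-mapᵐ : ∀ f → SP.degree (mapᵐ f) ≡ RP.degree f
  degree-mapᵐ f = List.length-map h (RP.lower f)

  coeff-map : ∀ p i → coeffˢ (map h p) i S.≈ h (coeffᴿ p i)
  coeff-map []      i       = S.sym h-0
  coeff-map (a ∷ p) zero    = S.refl
  coeff-map (a ∷ p) (suc i) = coeff-map p i

  map-≃ : ∀ {p q} → p R≃.≃ q → map h p S≃.≃ map h q
  map-≃ {p} {q} eq = S≃.mk λ i →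
    S.trans (coeff-map p i) (S.trans (h-cong (R≃.coeffs eq i)) (S.sym (coeff-map q i)))

  map-⊕ : ∀ p q → map h (p RP.⊕ q) S≃.≃ map h p SP.⊕ map h q
  map-⊕ p q = S≃.mk λ i → S.trans (coeff-map (p RP.⊕ q) i) (S.trans (h-cong (R≃.coeff-⊕ p q i)) (S.trans (h-+ _ _)
    (S.sym (S.trans (S≃.coeff-⊕ (map h p) (map h q) i) (S.+-cong (coeff-map p i) (coeff-map q i))))))

  map-· : ∀ a p → map h (a RP.· p) S≃.≃ h a SP.· map h p
  map-· a p = S≃.mk λ i → S.trans (coeff-map (a RP.· p) i) (S.trans (h-cong (R≃.coeff-· a p i)) (S.trans (h-* _ _)
    (S.sym (S.trans (S≃.coeff-· (h a) (map h p) i) (S.*-congˡ (coeff-map p i))))))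

  map-⊗ : ∀ p q → map h (p RP.⊗ q) S≃.≃ map h p SP.⊗ map h q
  map-⊗ []      q = SRing.refl
  map-⊗ (a ∷ p) q = SRing.trans (map-⊕ (a RP.· q) (R.0# ∷ p RP.⊗ q))
    (S≃.⊕-cong (map-· a q) (S≃.∷-cong h-0 (map-⊗ p q)))

  map-⟦⟧ : ∀ f → map h RP.⟦ f ⟧ S≃.≃ SP.⟦ mapᵐ f ⟧
  map-⟦⟧ f = SRing.trans (SRing.reflexive (List.map-++ h (RP.lower f) _)) (go (map h (RP.lower f)))
    where
    go : ∀ l → l ++ [ h R.1# ] S≃.≃ l ++ [ S.1# ]
    go []      = S≃.∷-cong h-1 SRing.refl
    go (x ∷ l) = S≃.∷-cong S.refl (go l)

  map-X^ : ∀ n → map h (RP.X^ n) S≃.≃ SP.X^ n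
  map-X^ zero    = S≃.∷-cong h-1 SRing.refl
  map-X^ (suc n) = S≃.∷-cong h-0 (map-X^ n)

  -- The image of a division with remainder is again one, the divisor staying monic, and such a
  -- division is unique.
  map-mod : ∀ p f → map h p SP.mod mapᵐ f S≃.≃ map h (p RP.mod f)
  map-mod p f = let e , b = R≃.divMod-spec p f; q = proj₁ (RP.divMod p f) in
    S≃.mod-unique {map h p} {mapᵐ f} {map h q}
      (λ i n≤i → S.trans (coeff-map (p RP.mod f) i) (S.trans (h-cong (b i (≡.subst (_≤ i) (degree-mapᵐ f) n≤i))) h-0))
      (SRing.trans (map-≃ e) (SRing.trans (map-⊕ (q RP.⊗ RP.⟦ f ⟧) (p RP.mod f))
        (SRing.+-congʳ {map h (p RP.mod f)} (SRing.trans (map-⊗ q RP.⟦ f ⟧) (SRing.*-congˡ {map h q} (map-⟦⟧ f))))))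

  h-norm : ∀ f g → h (normᴿ f g) S.≈ normˢ (mapᵐ f) (map h g)
  h-norm f g = S.trans (h-D (RP.degree f) _) (S.trans
    (SD.D-cong (RP.degree f) λ i j _ _ → S.sym (S.trans
      (rem-congˢ (mapᵐ f) i (SRing.trans (SRing.*-congˡ {map h g} (SRing.sym (map-X^ j))) (SRing.sym (map-⊗ g (RP.X^ j)))))
      (S.trans (S≃.coeffs (map-mod (g RP.⊗ RP.X^ j) f) i) (coeff-map ((g RP.⊗ RP.X^ j) RP.mod f) i))))
    (S.reflexive (≡.cong (λ n → SD.D n (λ i j → coeffˢ ((map h g SP.⊗ SP.X^ j) SP.mod mapᵐ f) i)) (≡.sym (degree-mapᵐ f)))))

-- Cyclotomic polynomials

unique-↭ : ∀ {a} {A : Set a} {xs ys : List A} → Unique xs → Unique ys →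
           (∀ {x} → x ∈ xs → x ∈ ys) → (∀ {x} → x ∈ ys → x ∈ xs) → xs ↭ ys
unique-↭ uxs uys to from = ∼bag⇒↭ (unique∧set⇒bag uxs uys (mk⇔ to from))

module BigProduct {c ℓ} (M : CommutativeMonoid c ℓ) where
  open CommutativeMonoid M
  open import Algebra.Properties.CommutativeSemigroup commutativeSemigroup using (interchange; x∙yz≈y∙xz)
  open import Relation.Binary.Reasoning.Setoid setoid

  module _ {a} {A : Set a} where
    prod : (A → Carrier) → List A → Carrier
    prod f = foldr (λ x y → f x ∙ y) ε

    prod-cong : ∀ {f g} xs → (∀ {x} → x ∈ xs → f x ≈ g x) → prod f xs ≈ prod g xs
    prod-cong []       eq = refl
    prod-cong (x ∷ xs) eq = ∙-cong (eq (here ≡.refl)) (prod-cong xs (eq ∘ there))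

    prod-ε : ∀ xs → prod (λ _ → ε) xs ≈ ε
    prod-ε []       = refl
    prod-ε (x ∷ xs) = trans (identityˡ _) (prod-ε xs)

    prod-∙ : ∀ f g xs → prod (λ x → f x ∙ g x) xs ≈ prod f xs ∙ prod g xs
    prod-∙ f g []       = sym (identityˡ ε)
    prod-∙ f g (x ∷ xs) = trans (∙-congˡ (prod-∙ f g xs)) (interchange _ _ _ _)

    prod-++ : ∀ f xs ys → prod f (xs ++ ys) ≈ prod f xs ∙ prod f ys
    prod-++ f []       ys = sym (identityˡ _)
    prod-++ f (x ∷ xs) ys = trans (∙-congˡ (prod-++ f xs ys)) (sym (assoc _ _ _))

    prod-↭ : ∀ f {xs ys} → xs ↭ ys → prod f xs ≈ prod f ys
    prod-↭ f ↭.refl           = refl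
    prod-↭ f (↭.prep x p)     = ∙-congˡ (prod-↭ f p)
    prod-↭ f (↭.swap x y p)   = trans (∙-congˡ (∙-congˡ (prod-↭ f p))) (x∙yz≈y∙xz _ _ _)
    prod-↭ f (↭.trans p q)    = trans (prod-↭ f p) (prod-↭ f q)

    prod-filter : ∀ {p} {P : Pred A p} (P? : Decidable P) f xs →
                  prod f xs ≈ prod f (filter P? xs) ∙ prod f (filter (¬? ∘ P?) xs)
    prod-filter P? f []       = sym (identityˡ ε)
    prod-filter P? f (x ∷ xs) with P? x
    ... | yes _ = trans (∙-congˡ (prod-filter P? f xs)) (sym (assoc _ _ _))
    ... | no  _ = trans (∙-congˡ (prod-filter P? f xs)) (x∙yz≈y∙xz _ _ _)

  prod-map : ∀ {a b} {A : Set a} {B : Set b} f (g : A → B) xs → prod f (map g xs) ≡ prod (f ∘ g) xs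
  prod-map f g []       = ≡.refl
  prod-map f g (x ∷ xs) = ≡.cong (f (g x) ∙_) (prod-map f g xs)

  prod-swap : ∀ {a b} {A : Set a} {B : Set b} (f : A → B → Carrier) xs ys →
              prod (λ x → prod (f x) ys) xs ≈ prod (λ y → prod (λ x → f x y) xs) ys
  prod-swap f []       ys = sym (prod-ε ys)
  prod-swap f (x ∷ xs) ys = trans (∙-congˡ (prod-swap f xs ys)) (sym (prod-∙ (f x) _ ys))

-- Filters from 0 upwards, in step with the tabulated product in the definition of `Φ`; for nonzero
-- n the entry 0 is filtered out.
properDivisors : ℕ → List ℕ
properDivisors n = filter (_∣? n) (upTo n)

∈-divisors⁺ : ∀ {d} n .{{_ : NonZero n}} → d ∣ n → d ∈ divisors n
∈-divisors⁺ {zero}  n 0∣n = contradiction (0∣⇒≡0 0∣n) (ℕ.≢-nonZero⁻¹ n)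
∈-divisors⁺ {suc d} n d∣n = ∈-filter⁺ (_∣? n) (∈-applyUpTo⁺ suc (∣⇒≤ d∣n)) d∣n

∈-divisors⁻ : ∀ {d} n → d ∈ divisors n → d ∣ n
∈-divisors⁻ n d∈ = proj₂ (∈-filter⁻ (_∣? n) {xs = applyUpTo suc n} d∈)

∈-properDivisors⁺ : ∀ {d} n → d ∣ n → d < n → d ∈ properDivisors n
∈-properDivisors⁺ n d∣n d<n = ∈-filter⁺ (_∣? n) (∈-upTo⁺ d<n) d∣n

∈-properDivisors⁻ : ∀ {d} n → d ∈ properDivisors n → d ∣ n × d < n
∈-properDivisors⁻ n d∈ = let d∈′ , d∣n = ∈-filter⁻ (_∣? n) {xs = upTo n} d∈ in d∣n , ∈-upTo⁻ d∈′

divisors-unique : ∀ n → Unique (divisors n)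
divisors-unique n = Unique.filter⁺ (_∣? n) (Unique.applyUpTo⁺₁ suc n λ i<j _ eq → ℕ.<⇒≢ i<j (ℕ.suc-injective eq))

properDivisors-unique : ∀ n → Unique (properDivisors n)
properDivisors-unique n = Unique.filter⁺ (_∣? n) (Unique.upTo⁺ n)

divisors-↭-properDivisors : ∀ n .{{_ : NonZero n}} → divisors n ↭ n ∷ properDivisors n
divisors-↭-properDivisors n = unique-↭ (divisors-unique n)
  (All.tabulate (λ d∈ → ℕ.>⇒≢ (proj₂ (∈-properDivisors⁻ n d∈))) ∷ properDivisors-unique n)
  (λ {d} d∈ → let d∣n = ∈-divisors⁻ n d∈ in to d∣n (ℕ.m≤n⇒m<n∨m≡n (∣⇒≤ d∣n)))
  (λ { (here ≡.refl) → ∈-divisors⁺ n ∣-refl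
     ; (there d∈)    → ∈-divisors⁺ n (proj₁ (∈-properDivisors⁻ n d∈)) })
  where
  to : ∀ {d} → d ∣ n → d < n ⊎ d ≡ n → d ∈ n ∷ properDivisors n
  to d∣n (inj₁ d<n)    = there (∈-properDivisors⁺ n d∣n d<n)
  to d∣n (inj₂ ≡.refl) = here ≡.refl

properDivisors-filter : ∀ g k .{{_ : NonZero k}} → g ∣ k → g < k → filter (_∣? g) (properDivisors k) ↭ divisors g
properDivisors-filter g k g∣k g<k = unique-↭
  (Unique.filter⁺ (_∣? g) (properDivisors-unique k)) (divisors-unique g)
  (λ d∈ → ∈-divisors⁺ g (proj₂ (∈-filter⁻ (_∣? g) {xs = properDivisors k} d∈)))
  (λ d∈ → let d∣g = ∈-divisors⁻ g d∈ in
    ∈-filter⁺ (_∣? g) (∈-properDivisors⁺ k (∣-trans d∣g g∣k) (ℕ.≤-<-trans (∣⇒≤ d∣g) g<k)) d∣g)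
  where instance
    g≢0 : NonZero g
    g≢0 = ℕ.≢-nonZero λ { ≡.refl → ℕ.≢-nonZero⁻¹ k (0∣⇒≡0 g∣k) }

-- Ideals with two generators

module _ {c ℓ} (S : CommutativeRing c ℓ) where
  open CommutativeRing S
  open import Relation.Binary.Reasoning.Setoid setoid
  open import Algebra.Properties.Ring ring using (-‿distribˡ-*)
  open import Algebra.Solver.Ring.NaturalCoefficients.Default commutativeSemiring
    using (solve; _:+_; _:*_; _:=_; con)

  ⟨_,_⟩∋_ : Carrier → Carrier → Carrier → Set _
  ⟨ a , b ⟩∋ x = ∃[ u ] ∃[ v ] x ≈ u * a + v * b

  ideal-+ : ∀ {a b x y} → ⟨ a , b ⟩∋ x → ⟨ a , b ⟩∋ y → ⟨ a , b ⟩∋ (x + y)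
  ideal-+ {a} {b} (u , v , e) (u′ , v′ , e′) = u + u′ , v + v′ , trans (+-cong e e′)
    (solve 6 (λ u v u′ v′ a b → u :* a :+ v :* b :+ (u′ :* a :+ v′ :* b) := (u :+ u′) :* a :+ (v :+ v′) :* b) refl u v u′ v′ a b)

  ideal-* : ∀ {a b y} x → ⟨ a , b ⟩∋ y → ⟨ a , b ⟩∋ (x * y)
  ideal-* {a} {b} x (u , v , e) = x * u , x * v , trans (*-congˡ e)
    (solve 5 (λ x u v a b → x :* (u :* a :+ v :* b) := x :* u :* a :+ x :* v :* b) refl x u v a b)

  ideal-≈ : ∀ {a b x y} → x ≈ y → ⟨ a , b ⟩∋ x → ⟨ a , b ⟩∋ y
  ideal-≈ eq (u , v , e) = u , v , trans (sym eq) e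

  ideal-ˡ : ∀ {a b} u → ⟨ a , b ⟩∋ (u * a)
  ideal-ˡ {a} {b} u = u , 0# , trans (sym (+-identityʳ _)) (+-congˡ (sym (zeroˡ b)))

  ideal-ʳ : ∀ {a b} v → ⟨ a , b ⟩∋ (v * b)
  ideal-ʳ {a} {b} v = 0# , v , trans (sym (+-identityˡ _)) (+-congʳ (sym (zeroˡ a)))

  ideal-- : ∀ {a b x y z} → x ≈ y + z → ⟨ a , b ⟩∋ x → ⟨ a , b ⟩∋ y → ⟨ a , b ⟩∋ z
  ideal-- {x = x} {y} {z} eq ix iy = ideal-≈ (begin
      x + - 1# * y          ≈⟨ +-cong eq (trans (sym (-‿distribˡ-* 1# y)) (-‿cong (*-identityˡ y))) ⟩
      y + z + - y           ≈⟨ solve 3 (λ y z w → y :+ z :+ w := (y :+ w) :+ z) refl y z (- y) ⟩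
      (y + - y) + z         ≈⟨ +-congʳ (-‿inverseʳ y) ⟩
      0# + z                ≈⟨ +-identityˡ z ⟩
      z                     ∎) (ideal-+ ix (ideal-* (- 1#) iy))

  ideal-sym : ∀ {a b x} → ⟨ a , b ⟩∋ x → ⟨ b , a ⟩∋ x
  ideal-sym (u , v , e) = v , u , trans e (+-comm _ _)

  -- Modulo a, a multiple of b times a multiple of b′ is a multiple of b b′.
  ideal-product : ∀ {a b b′ x x′} → ⟨ a , b ⟩∋ x → ⟨ a , b′ ⟩∋ x′ → ⟨ a , b * b′ ⟩∋ (x * x′)
  ideal-product {a} {b} {b′} {x} {x′} (u , v , e) (u′ , v′ , e′) =
    u * x′ + v * b * u′ , v * v′ , (begin
      x * x′                     ≈⟨ *-congʳ e ⟩
      (u * a + v * b) * x′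
        ≈⟨ solve 5 (λ u a v b x → (u :* a :+ v :* b) :* x := u :* x :* a :+ v :* b :* x) refl u a v b x′ ⟩
      u * x′ * a + v * b * x′    ≈⟨ +-congˡ (*-congˡ e′) ⟩
      u * x′ * a + v * b * (u′ * a + v′ * b′)
        ≈⟨ solve 8 (λ u x a v b u′ v′ b′ → u :* x :* a :+ v :* b :* (u′ :* a :+ v′ :* b′)
             := (u :* x :+ v :* b :* u′) :* a :+ v :* v′ :* (b :* b′)) refl u x′ a v b u′ v′ b′ ⟩
      (u * x′ + v * b * u′) * a + v * v′ * (b * b′) ∎)

  -- For c = 1 this is the familiar fact that coprime divisors a and b of x have their product
  -- dividing x. For general c the cofactor s of a is divisible by b only after multiplication by c.
  ideal-divides : ∀ {a b c x s t} → x ≈ s * a → x ≈ t * b → ⟨ a , b ⟩∋ c → ∃[ w ] c * s ≈ w * b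
  ideal-divides {a} {b} {c} {x} {s} {t} xsa xtb (u , v , e) = u * t + v * s , (begin
    c * s                         ≈⟨ *-congʳ e ⟩
    (u * a + v * b) * s
      ≈⟨ solve 5 (λ u a v b s → (u :* a :+ v :* b) :* s := u :* (s :* a) :+ v :* s :* b) refl u a v b s ⟩
    u * (s * a) + v * s * b       ≈⟨ +-congʳ (*-congˡ (trans (sym xsa) xtb)) ⟩
    u * (t * b) + v * s * b
      ≈⟨ solve 5 (λ u t b v s → u :* (t :* b) :+ v :* s :* b := (u :* t :+ v :* s) :* b) refl u t b v s ⟩
    (u * t + v * s) * b           ∎)

module FromNat {c ℓ} (R : CommutativeRing c ℓ) where
  open CommutativeRing R

  fromℕ : ℕ → Carrier
  fromℕ zero    = 0#
  fromℕ (suc n) = 1# + fromℕ n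

-- Decidable vanishing makes leading terms available in `lead-view`. Characteristic zero ensures
-- that the integer k / gcd(k, l), which witnesses the coprimality of Φₖ and Φₗ, is nonzero.
record IsCharZeroDomain {c ℓ} (R : CommutativeRing c ℓ) : Set (c ⊔ ℓ) where
  open CommutativeRing R
  open FromNat R using (fromℕ)

  field
    domain  : ∀ {x y} → x * y ≈ 0# → ¬ x ≈ 0# → y ≈ 0#
    ≈0?     : ∀ x → Dec (x ≈ 0#)
    fromℕ≉0 : ∀ n .{{_ : NonZero n}} → ¬ fromℕ n ≈ 0#

  1≉0 : ¬ 1# ≈ 0#
  1≉0 1≈0 = fromℕ≉0 1 (trans (+-identityʳ 1#) 1≈0)

-- The type checker would unfold Defs.Φ, so the theory is developed for an
-- abstract family satisfying its defining equation.
record CyclotomicFamily {c ℓ} (R : CommutativeRing c ℓ) : Set (c ⊔ ℓ) where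
  open CommutativeRing R
  open Polynomial R
  field
    isDomain : IsCharZeroDomain R
    Xⁿ-1ᵐ     : ℕ → Monic
    Xⁿ-1-suc : ∀ n → Xⁿ-1ᵐ (suc n) ≡ monic (- 1# ∷ replicate n 0#)
    Φᵐ        : ℕ → Monic
    Φ-unfold : ∀ n → Φᵐ n ≡ Xⁿ-1ᵐ n ÷ᵐ ∏ᵐ (tabulate λ (d : Fin n) → if does (toℕ d ∣? n) then Φᵐ (toℕ d) else 1ᵐ)

module Cyclotomic {c ℓ} {R : CommutativeRing c ℓ} (family : CyclotomicFamily R) where
  open CommutativeRing R
  open Polynomial R
  open CyclotomicFamily family
  open IsCharZeroDomain isDomain
  open FromNat R
  open Polys R
  open Norms R
  private module P = CommutativeRing polyRing
  open BigProduct P.*-commutativeMonoid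
  open import Relation.Binary.Reasoning.Setoid P.setoid
  open import Algebra.Properties.Ring ring using (-‿distribˡ-*)
  open import Algebra.Solver.Ring.NaturalCoefficients.Default P.commutativeSemiring
    using (solve; _:+_; _:*_; _:=_; con)

  Φᴾ : ℕ → Poly
  Φᴾ d = ⟦ Φᵐ d ⟧

  Xⁿ-1ᴾ : ℕ → Poly
  Xⁿ-1ᴾ n = X^ n ⊕ [ - 1# ]

  ⟦Xⁿ-1⟧ : ∀ n .{{_ : NonZero n}} → ⟦ Xⁿ-1ᵐ n ⟧ ≃ Xⁿ-1ᴾ n
  ⟦Xⁿ-1⟧ (suc n) = P.trans (P.reflexive (≡.cong ⟦_⟧ (Xⁿ-1-suc n)))
    (∷-cong (sym (+-identityˡ _)) (P.sym (P.+-identityʳ (X^ n))))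

  degree-Xⁿ-1 : ∀ n .{{_ : NonZero n}} → degree (Xⁿ-1ᵐ n) ≡ n
  degree-Xⁿ-1 (suc n) = ≡.trans (≡.cong degree (Xⁿ-1-suc n)) (≡.cong suc (List.length-replicate n))

  isMonic-Xⁿ-1ᴾ : ∀ n .{{_ : NonZero n}} → IsMonic n (Xⁿ-1ᴾ n)
  isMonic-Xⁿ-1ᴾ n = isMonic-≃ (⟦Xⁿ-1⟧ n) (≡.subst (λ k → IsMonic k ⟦ Xⁿ-1ᵐ n ⟧) (degree-Xⁿ-1 n) (isMonic-⟦⟧ (Xⁿ-1ᵐ n)))

  [-1]⊕[1] : [ 1# ] ⊕ [ - 1# ] ≃ []
  [-1]⊕[1] = P.trans (∷-cong (-‿inverseʳ 1#) P.refl) 0∷[]≃[]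

  X^≃Xⁿ-1ᴾ⊕1 : ∀ n → X^ n ≃ Xⁿ-1ᴾ n ⊕ [ 1# ]
  X^≃Xⁿ-1ᴾ⊕1 n = P.sym (P.trans (P.+-assoc (X^ n) [ - 1# ] [ 1# ])
    (P.trans (P.+-congˡ {X^ n} (P.trans (P.+-comm [ - 1# ] [ 1# ]) [-1]⊕[1])) (P.+-identityʳ (X^ n))))

  Xⁿ-1ᴾ-+ : ∀ m n → Xⁿ-1ᴾ (m ℕ.+ n) ≃ X^ m ⊗ Xⁿ-1ᴾ n ⊕ Xⁿ-1ᴾ m
  Xⁿ-1ᴾ-+ m n = begin
    X^ (m ℕ.+ n) ⊕ [ - 1# ]                          ≈⟨ P.+-congʳ (X^-+ m n) ⟩
    X^ m ⊗ X^ n ⊕ [ - 1# ]                           ≈⟨ P.+-congʳ (P.*-congˡ {X^ m} (X^≃Xⁿ-1ᴾ⊕1 n)) ⟩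
    X^ m ⊗ (Xⁿ-1ᴾ n ⊕ [ 1# ]) ⊕ [ - 1# ]
      ≈⟨ P.+-congʳ (P.trans (P.distribˡ (X^ m) (Xⁿ-1ᴾ n) [ 1# ]) (P.+-congˡ {X^ m ⊗ Xⁿ-1ᴾ n} (P.*-identityʳ (X^ m)))) ⟩
    X^ m ⊗ Xⁿ-1ᴾ n ⊕ X^ m ⊕ [ - 1# ]                 ≈⟨ P.+-assoc (X^ m ⊗ Xⁿ-1ᴾ n) (X^ m) [ - 1# ] ⟩
    X^ m ⊗ Xⁿ-1ᴾ n ⊕ Xⁿ-1ᴾ m                         ∎

  geometric : ℕ → ℕ → Poly
  geometric zero    m = []
  geometric (suc a) m = [ 1# ] ⊕ X^ m ⊗ geometric a m

  geometric-* : ∀ a m → Xⁿ-1ᴾ (a ℕ.* m) ≃ geometric a m ⊗ Xⁿ-1ᴾ m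
  geometric-* zero    m = [-1]⊕[1]
  geometric-* (suc a) m = begin
    Xⁿ-1ᴾ (m ℕ.+ a ℕ.* m)                             ≈⟨ Xⁿ-1ᴾ-+ m (a ℕ.* m) ⟩
    X^ m ⊗ Xⁿ-1ᴾ (a ℕ.* m) ⊕ Xⁿ-1ᴾ m                 ≈⟨ P.+-congʳ (P.*-congˡ {X^ m} (geometric-* a m)) ⟩
    X^ m ⊗ (geometric a m ⊗ Xⁿ-1ᴾ m) ⊕ Xⁿ-1ᴾ m
      ≈⟨ solve 3 (λ x g y → x :* (g :* y) :+ y := (con 1 :+ x :* g) :* y) P.refl (X^ m) (geometric a m) (Xⁿ-1ᴾ m) ⟩
    (([ 1# ] ⊕ []) ⊕ X^ m ⊗ geometric a m) ⊗ Xⁿ-1ᴾ m  ≈⟨ P.refl ⟩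
    geometric (suc a) m ⊗ Xⁿ-1ᴾ m ∎

  -- The sum 1 + Y + ... of a powers takes the value a at Y = 1, here with Y = X^m. It serves twice:
  -- for the coprimality of cyclotomic polynomials and for the norms that produce the powers of p.
  geometric-mod : ∀ a m → ∃[ u ] geometric a m ≃ u ⊗ Xⁿ-1ᴾ m ⊕ [ fromℕ a ]
  geometric-mod zero    m = [] , P.sym 0∷[]≃[]
  geometric-mod (suc a) m = let u , e = geometric-mod a m; Y = Xⁿ-1ᴾ m; k = [ fromℕ a ] in
    (Y ⊗ u ⊕ k) ⊕ u , (begin
      [ 1# ] ⊕ X^ m ⊗ geometric a m                  ≈⟨ P.+-congˡ {[ 1# ]} (P.*-cong (X^≃Xⁿ-1ᴾ⊕1 m) e) ⟩
      [ 1# ] ⊕ (Y ⊕ [ 1# ]) ⊗ (u ⊗ Y ⊕ k)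
        ≈⟨ solve 3 (λ y u k → con 1 :+ (y :+ con 1) :* (u :* y :+ k) := (y :* u :+ k :+ u) :* y :+ (con 1 :+ k)) P.refl Y u k ⟩
      ((Y ⊗ u ⊕ k) ⊕ u) ⊗ Y ⊕ [ fromℕ (suc a) ]      ∎)

  lead-view : ∀ p → p ≃ [] ⊎ ∃[ d ] (¬ coeff p d ≈ 0#) × Below (suc d) p
  lead-view []      = inj₁ P.refl
  lead-view (a ∷ p) with lead-view p
  ... | inj₂ (d , l , b) = inj₂ (suc d , l , λ { (suc i) (s≤s lt) → b i lt })
  ... | inj₁ p≃[] with ≈0? a
  ...   | yes a≈0 = inj₁ (P.trans (∷-cong a≈0 p≃[]) 0∷[]≃[])
  ...   | no  a≉0 = inj₂ (0 , a≉0 , λ { (suc i) _ → coeffs p≃[] i })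

  -- The cofactor found by the divisibility argument comes with no control of its degree or leading
  -- coefficient. Both are forced by comparing leading terms with those of F.
  quotient-monic : ∀ {F G h n m} → IsMonic n F → IsMonic m G → F ≃ h ⊗ G → ∃[ d ] d ℕ.+ m ≡ n × IsMonic d h
  quotient-monic {F} {G} {h} {n} {m} mF mG eq with lead-view h
  ... | inj₁ h≃[] = contradiction
    (trans (sym (lead mF)) (coeffs (P.trans eq (P.*-congʳ h≃[])) n)) 1≉0
  ... | inj₂ (d , l , b) = d , d+m≡n , isMonic
    (trans (sym lead-coeff) (trans (reflexive (≡.cong (coeff F) d+m≡n)) (lead mF))) b
    where
    prod-lead = coeff-⊗-lead h G d m b (below mG)
    lead-coeff : coeff F (d ℕ.+ m) ≈ coeff h d
    lead-coeff = trans (coeffs eq (d ℕ.+ m)) (trans (proj₂ prod-lead) (trans (*-congˡ (lead mG)) (*-identityʳ _)))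
    d+m≡n : d ℕ.+ m ≡ n
    d+m≡n with ℕ.<-cmp (d ℕ.+ m) n
    ... | tri≈ _ e _ = e
    ... | tri< lt _ _ = contradiction (trans (sym (lead mF)) (trans (coeffs eq n) (proj₁ prod-lead n lt))) 1≉0
    ... | tri> _ _ gt = contradiction (trans (sym lead-coeff) (below mF (d ℕ.+ m) gt)) l

  -- Coprimality over the field of fractions, stated inside R[X]. Comaximality would be too strong:
  -- over ℤ the polynomials Φ₁ and Φₚ, for p prime, generate a proper ideal that contains p.
  Coprimeᴾ : Poly → Poly → Set (c ⊔ ℓ)
  Coprimeᴾ f g = ∃[ k ] (¬ k ≈ 0#) × ⟨_,_⟩∋_ polyRing f g [ k ]

  coprime-1 : ∀ f → Coprimeᴾ f [ 1# ]
  coprime-1 f = 1# , 1≉0 , [] , [ 1# ] , P.sym (P.*-identityʳ [ 1# ])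

  coprime-⊗ : ∀ {f g h} → Coprimeᴾ f g → Coprimeᴾ f h → Coprimeᴾ f (g ⊗ h)
  coprime-⊗ {f} {g} {h} (k , k≉0 , i) (l , l≉0 , j) = k * l , (λ kl≈0 → l≉0 (domain kl≈0 k≉0)) ,
    ideal-≈ polyRing {f} {g ⊗ h} ([-]⊗ k [ l ]) (ideal-product polyRing {f} {g} {h} {[ k ]} {[ l ]} i j)

  coprime-prod : ∀ f fs → (∀ {d} → d ∈ fs → Coprimeᴾ f (Φᴾ d)) → Coprimeᴾ f (prod Φᴾ fs)
  coprime-prod f []       cop = coprime-1 f
  coprime-prod f (g ∷ fs) cop = coprime-⊗ {f} {Φᴾ g} {prod Φᴾ fs} (cop (here ≡.refl)) (coprime-prod f fs (cop ∘ there))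

  -- Plays the part of Gauss's lemma. The remainder modulo g is linear, so that of s is killed by k,
  -- and hence is zero in a domain.
  divides-· : ∀ g k s w → ¬ k ≈ 0# → [ k ] ⊗ s ≃ w ⊗ ⟦ g ⟧ → ∃[ u ] s ≃ u ⊗ ⟦ g ⟧
  divides-· g k s w k≉0 eq = proj₁ (divMod s g) ,
    P.trans (proj₁ (divMod-spec s g)) (P.trans (P.+-congˡ {proj₁ (divMod s g) ⊗ ⟦ g ⟧} (mk λ i →
      domain (trans (sym (λ-· (rem-linear g i) k s)) (coeffs (mod-multiple g w
        (P.trans (P.sym ([-]⊗ k s)) eq)) i)) k≉0)) (P.+-identityʳ _))

  coprime-divides : ∀ {F f s t} g → F ≃ s ⊗ f → F ≃ t ⊗ ⟦ g ⟧ → Coprimeᴾ f ⟦ g ⟧ → ∃[ u ] F ≃ u ⊗ (⟦ g ⟧ ⊗ f)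
  coprime-divides {F} {f} {s} {t} g Fsf Ftg (k , k≉0 , i) =
    let w , e  = ideal-divides polyRing {f} {⟦ g ⟧} {[ k ]} {F} {s} {t} Fsf Ftg i
        u , e′ = divides-· g k s w k≉0 e
    in  u , P.trans Fsf (P.trans (P.*-congʳ {f} e′) (P.*-assoc u ⟦ g ⟧ f))

  prod-divides : ∀ F fs → Unique fs → (∀ {d e} → d ∈ fs → e ∈ fs → d ≢ e → Coprimeᴾ (Φᴾ d) (Φᴾ e)) →
                 (∀ {d} → d ∈ fs → ∃[ u ] F ≃ u ⊗ Φᴾ d) → ∃[ u ] F ≃ u ⊗ prod Φᴾ fs
  prod-divides F []       _          cop div = F , P.sym (P.*-identityʳ F)
  prod-divides F (d ∷ fs) (d∉ ∷ uniq) cop div =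
    let s , e = prod-divides F fs uniq (λ d∈ e∈ → cop (there d∈) (there e∈)) (div ∘ there)
        t , e′ = div (here ≡.refl)
        k , k≉0 , i = coprime-prod (Φᴾ d) fs (λ e∈ → cop (here ≡.refl) (there e∈) (All.lookup d∉ e∈))
    in  coprime-divides {F} {prod Φᴾ fs} {s} {t} (Φᵐ d) e e′ (k , k≉0 , ideal-sym polyRing {Φᴾ d} {prod Φᴾ fs} i)

  Formula : ℕ → Set ℓ
  Formula n = Xⁿ-1ᴾ n ≃ Φᴾ n ⊗ prod Φᴾ (properDivisors n)

  formula-divisors : ∀ n .{{_ : NonZero n}} → Formula n → Xⁿ-1ᴾ n ≃ prod Φᴾ (divisors n)
  formula-divisors n formula = P.trans formula (P.sym (prod-↭ Φᴾ (divisors-↭-properDivisors n)))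

  module _ (k l : ℕ) .{{_ : NonZero k}} .{{_ : NonZero l}} (fk : Formula k) (fl : Formula l) where
    private
      g = gcd k l
      proper : ℕ → Poly
      proper = prod Φᴾ ∘ properDivisors
      ⟨k,l⟩∋_ = ⟨_,_⟩∋_ polyRing (Φᴾ k) (Φᴾ l)

    -- Bézout gives a = g + b with one of a, b a multiple of k and the other a multiple of l. In X^a
    -- - 1 = X^g (X^b - 1) + (X^g - 1) all terms but the last are visibly in the ideal.
    X^gcd-1∈ : ⟨k,l⟩∋ Xⁿ-1ᴾ g
    X^gcd-1∈ = go (Bézout.identity (gcd-GCD k l))
      where
      k-multiples : ∀ x → ⟨k,l⟩∋ Xⁿ-1ᴾ (x ℕ.* k)
      k-multiples x = ideal-≈ polyRing {Φᴾ k} {Φᴾ l} (P.sym (P.trans (geometric-* x k) (P.trans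
        (P.*-congˡ {geometric x k} (P.trans fk (P.*-comm (Φᴾ k) (proper k)))) (P.sym (P.*-assoc (geometric x k) (proper k) (Φᴾ k))))))
        (ideal-ˡ polyRing {Φᴾ k} {Φᴾ l} (geometric x k ⊗ proper k))
      l-multiples : ∀ x → ⟨k,l⟩∋ Xⁿ-1ᴾ (x ℕ.* l)
      l-multiples x = ideal-≈ polyRing {Φᴾ k} {Φᴾ l} (P.sym (P.trans (geometric-* x l) (P.trans
        (P.*-congˡ {geometric x l} (P.trans fl (P.*-comm (Φᴾ l) (proper l)))) (P.sym (P.*-assoc (geometric x l) (proper l) (Φᴾ l))))))
        (ideal-ʳ polyRing {Φᴾ k} {Φᴾ l} (geometric x l ⊗ proper l))
      combine : ∀ {a b} → g ℕ.+ b ≡ a → ⟨k,l⟩∋ Xⁿ-1ᴾ a → ⟨k,l⟩∋ Xⁿ-1ᴾ b → ⟨k,l⟩∋ Xⁿ-1ᴾ g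
      combine {a} {b} eq ia ib = ideal-- polyRing {Φᴾ k} {Φᴾ l} {Xⁿ-1ᴾ a} {X^ g ⊗ Xⁿ-1ᴾ b} {Xⁿ-1ᴾ g}
        (P.trans (P.reflexive (≡.cong Xⁿ-1ᴾ (≡.sym eq))) (Xⁿ-1ᴾ-+ g b)) ia
        (ideal-* polyRing {Φᴾ k} {Φᴾ l} (X^ g) ib)
      go : Bézout.Identity g k l → ⟨k,l⟩∋ Xⁿ-1ᴾ g
      go (Bézout.+- x y eq) = combine eq (k-multiples x) (l-multiples y)
      go (Bézout.-+ x y eq) = combine eq (l-multiples y) (k-multiples x)

    -- With g = gcd(k, l) < k, the quotient of Xᵏ - 1 by Xᵍ - 1 is a multiple of
    -- Φₖ and congruent to k / g modulo Xᵍ - 1.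
    coprime-< : g < k → Formula g → Coprimeᴾ (Φᴾ k) (Φᴾ l)
    coprime-< g<k fg with gcd[m,n]∣m k l
    ... | divides e k≡e*g = fromℕ e , fromℕ≉0 e {{e≢0}} ,
      ideal-- polyRing {Φᴾ k} {Φᴾ l} {geometric e g} {u ⊗ Xⁿ-1ᴾ g} {[ fromℕ e ]} geo
        (ideal-≈ polyRing {Φᴾ k} {Φᴾ l} (P.sym (P.trans quotient≃ (P.*-comm (Φᴾ k) H))) (ideal-ˡ polyRing {Φᴾ k} {Φᴾ l} H))
        (ideal-* polyRing {Φᴾ k} {Φᴾ l} u X^gcd-1∈)
      where
      instance
        e≢0 : NonZero e
        e≢0 = ℕ.≢-nonZero λ { ≡.refl → ℕ.≢-nonZero⁻¹ k k≡e*g }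
        g≢0 : NonZero g
        g≢0 = ℕ.≢-nonZero λ g≡0 → ℕ.≢-nonZero⁻¹ k (≡.trans k≡e*g (≡.trans (≡.cong (e ℕ.*_) g≡0) (ℕ.*-zeroʳ e)))
      u = proj₁ (geometric-mod e g)
      geo = proj₂ (geometric-mod e g)
      H = prod Φᴾ (filter (¬? ∘ (_∣? g)) (properDivisors k))
      quotient≃ : geometric e g ≃ Φᴾ k ⊗ H
      quotient≃ = monic-cancel {g} {Xⁿ-1ᴾ g} {geometric e g} {Φᴾ k ⊗ H} (isMonic-Xⁿ-1ᴾ g) (begin
        geometric e g ⊗ Xⁿ-1ᴾ g                       ≈⟨ geometric-* e g ⟨
        Xⁿ-1ᴾ (e ℕ.* g)                               ≡⟨ ≡.cong Xⁿ-1ᴾ (≡.sym k≡e*g) ⟩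
        Xⁿ-1ᴾ k                                       ≈⟨ fk ⟩
        Φᴾ k ⊗ prod Φᴾ (properDivisors k)
          ≈⟨ P.*-congˡ {Φᴾ k} (prod-filter (_∣? g) Φᴾ (properDivisors k)) ⟩
        Φᴾ k ⊗ (prod Φᴾ (filter (_∣? g) (properDivisors k)) ⊗ H)
          ≈⟨ P.*-congˡ {Φᴾ k} (P.*-congʳ {H} (P.trans
               (prod-↭ Φᴾ (properDivisors-filter g k (gcd[m,n]∣m k l) g<k)) (P.sym (formula-divisors g fg)))) ⟩
        Φᴾ k ⊗ (Xⁿ-1ᴾ g ⊗ H)
          ≈⟨ P.trans (P.*-congˡ {Φᴾ k} (P.*-comm (Xⁿ-1ᴾ g) H)) (P.sym (P.*-assoc (Φᴾ k) H (Xⁿ-1ᴾ g))) ⟩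
        (Φᴾ k ⊗ H) ⊗ Xⁿ-1ᴾ g ∎)

  coprime-Φ : ∀ n → (∀ m → m < n → NonZero m → Formula m) →
              ∀ k l → k < n → l < n → NonZero k → NonZero l → k ≢ l → Coprimeᴾ (Φᴾ k) (Φᴾ l)
  coprime-Φ n formula k l k<n l<n k≢0 l≢0 k≢l with gcd k l ℕ.<? k
  ... | yes g<k = coprime-< k l {{k≢0}} {{l≢0}} (formula k k<n k≢0) (formula l l<n l≢0) g<k
    (formula _ (ℕ.<-trans g<k k<n) (ℕ.≢-nonZero λ eq → ℕ.≢-nonZero⁻¹ k {{k≢0}} (gcd[m,n]≡0⇒m≡0 eq)))
  -- Otherwise the gcd is k itself, so k divides l and is smaller than it; the argument applies with
  -- k and l exchanged.
  ... | no g≮k = let j , j≉0 , i = coprime-< l k {{l≢0}} {{k≢0}} (formula l l<n l≢0) (formula k k<n k≢0)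
                                     (≡.subst (_< l) (gcd-comm k l) g<l)
                                     (≡.subst Formula (gcd-comm k l) (formula _ (ℕ.<-trans g<l l<n)
                                       (ℕ.≢-nonZero λ eq → ℕ.≢-nonZero⁻¹ k {{k≢0}} (gcd[m,n]≡0⇒m≡0 eq))))
                 in  j , j≉0 , ideal-sym polyRing {Φᴾ l} {Φᴾ k} i
    where
    g≡k : gcd k l ≡ k
    g≡k = ℕ.≤-antisym (∣⇒≤ {{k≢0}} (gcd[m,n]∣m k l)) (ℕ.≮⇒≥ g≮k)
    g<l : gcd k l < l
    g<l = ℕ.≤∧≢⇒< (∣⇒≤ {{l≢0}} (gcd[m,n]∣n k l)) λ g≡l → k≢l (≡.trans (≡.sym g≡k) g≡l)

  properProduct : ℕ → Monic
  properProduct n = ∏ᵐ (tabulate λ (d : Fin n) → if does (toℕ d ∣? n) then Φᵐ (toℕ d) else 1ᵐ)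

  ⟦properProduct⟧ : ∀ n → ⟦ properProduct n ⟧ ≃ prod Φᴾ (properDivisors n)
  ⟦properProduct⟧ n = go n id
    where
    go : ∀ m h → ⟦ ∏ᵐ (tabulate λ (d : Fin m) → if does (h (toℕ d) ∣? n) then Φᵐ (h (toℕ d)) else 1ᵐ) ⟧ ≃
                 prod Φᴾ (filter (_∣? n) (applyUpTo h m))
    go zero    h = P.refl
    go (suc m) h with h 0 ∣? n
    ... | yes _ = P.trans (⟦⊗ᵐ⟧ (Φᵐ (h 0)) _) (P.*-congˡ {Φᴾ (h 0)} (go m (h ∘ suc)))
    ... | no  _ = P.trans (⟦⊗ᵐ⟧ 1ᵐ _) (P.trans (P.*-identityˡ _) (go m (h ∘ suc)))

  -- For a proper divisor d of n, the formula for d shows that Φ_d divides X^d - 1 and hence X^n -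
  -- 1. The formulas below n also make these factors pairwise coprime, so their product divides X^n
  -- - 1 and the division that defines Φₙ is exact.
  formula-step : ∀ n → (∀ m → m < n → NonZero m → Formula m) → NonZero n → Formula n
  formula-step n ih n≢0 = result
    where
    instance
      _ = n≢0
    instance-∣ : ∀ {d} → d ∣ n → NonZero d
    instance-∣ d∣n = ℕ.≢-nonZero λ { ≡.refl → ℕ.≢-nonZero⁻¹ n (0∣⇒≡0 d∣n) }
    divides-X^n-1 : ∀ {d} → d ∈ properDivisors n → ∃[ u ] Xⁿ-1ᴾ n ≃ u ⊗ Φᴾ d
    divides-X^n-1 {d} d∈ with ∈-properDivisors⁻ n d∈
    ... | d∣n@(divides e n≡) , d<n = geometric e d ⊗ prod Φᴾ (properDivisors d) ,
      P.trans (P.reflexive (≡.cong Xⁿ-1ᴾ n≡)) (P.trans (geometric-* e d) (P.trans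
        (P.*-congˡ {geometric e d} (P.trans (ih d d<n (instance-∣ d∣n)) (P.*-comm (Φᴾ d) _)))
        (P.sym (P.*-assoc (geometric e d) (prod Φᴾ (properDivisors d)) (Φᴾ d)))))
    cofactor : ∃[ u ] Xⁿ-1ᴾ n ≃ u ⊗ prod Φᴾ (properDivisors n)
    cofactor = prod-divides (Xⁿ-1ᴾ n) (properDivisors n) (properDivisors-unique n)
      (λ {d} {e} d∈ e∈ d≢e → let d∣n , d<n = ∈-properDivisors⁻ n d∈; e∣n , e<n = ∈-properDivisors⁻ n e∈ in
        coprime-Φ n ih d e d<n e<n (instance-∣ d∣n) (instance-∣ e∣n) d≢e)
      divides-X^n-1
    h = proj₁ cofactor
    G = properProduct n
    eq : ⟦ Xⁿ-1ᵐ n ⟧ ≃ h ⊗ ⟦ G ⟧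
    eq = P.trans (⟦Xⁿ-1⟧ n) (P.trans (proj₂ cofactor) (P.*-congˡ {h} (P.sym (⟦properProduct⟧ n))))
    result : Formula n
    result with quotient-monic {h = h} (isMonic-⟦⟧ (Xⁿ-1ᵐ n)) (isMonic-⟦⟧ G) eq
    ... | d , d+m≡n , mh = P.trans (P.sym (⟦Xⁿ-1⟧ n)) (P.trans eq
      (P.*-cong (P.sym (P.trans (P.reflexive (≡.cong ⟦_⟧ (Φ-unfold n)))
        (proj₁ (⟦÷ᵐ⟧ (Xⁿ-1ᵐ n) G {h} (≡.subst (degree G ≤_) d+m≡n (ℕ.m≤n+m (degree G) d))
          (≡.subst (λ k → IsMonic k h) (≡.sym (≡.trans (≡.cong (_∸ degree G) (≡.sym d+m≡n)) (ℕ.m+n∸n≡m d (degree G)))) mh) eq))))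
        (⟦properProduct⟧ n)))

  formula : ∀ n → NonZero n → Formula n
  formula = <-rec (λ n → NonZero n → Formula n) λ n ih → formula-step n λ m m<n → ih m<n

  X^n-1≃∏Φ : ∀ n .{{_ : NonZero n}} → Xⁿ-1ᴾ n ≃ prod Φᴾ (divisors n)
  X^n-1≃∏Φ n = formula-divisors n (formula n (ℕ.≢-nonZero (ℕ.≢-nonZero⁻¹ n)))

  Φ-coprime : ∀ k l .{{_ : NonZero k}} .{{_ : NonZero l}} → k ≢ l → Coprimeᴾ (Φᴾ k) (Φᴾ l)
  Φ-coprime k l = coprime-Φ (suc (k ℕ.⊔ l)) (λ m _ → formula m) k l (s≤s (ℕ.m≤m⊔n k l)) (s≤s (ℕ.m≤n⊔m k l))
    (ℕ.≢-nonZero (ℕ.≢-nonZero⁻¹ k)) (ℕ.≢-nonZero (ℕ.≢-nonZero⁻¹ l))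

-- Divisors of a prime power times a number prime to it

module PrimePowers (p : ℕ) (p-prime : Prime p) where
  instance
    p≢0 : NonZero p
    p≢0 = prime⇒nonZero p-prime

  p^≢0 : ∀ k → NonZero (p ℕ.^ k)
  p^≢0 k = ℕ.m^n≢0 p k

  1<p : 1 < p
  1<p = ℕ.nonTrivial⇒n>1 p {{prime⇒nonTrivial p-prime}}

  p^-mono : ∀ {i j} → i < j → p ℕ.^ i < p ℕ.^ j
  p^-mono = ℕ.^-monoʳ-< p 1<p

  ∣-nonZero : ∀ {d n} .{{_ : NonZero n}} → d ∣ n → NonZero d
  ∣-nonZero {n = n} d∣n = ℕ.≢-nonZero λ { ≡.refl → ℕ.≢-nonZero⁻¹ n (0∣⇒≡0 d∣n) }

  p^∣xy⇒p^∣x : ∀ k x {y} → ¬ p ∣ y → p ℕ.^ k ∣ x ℕ.* y → p ℕ.^ k ∣ x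
  p^∣xy⇒p^∣x zero    x p∤y _  = 1∣ x
  p^∣xy⇒p^∣x (suc k) x {y} p∤y p^∣ with euclidsLemma x y p-prime (∣-trans (m∣m*n (p ℕ.^ k)) p^∣)
  ... | inj₂ p∣y = contradiction p∣y p∤y
  ... | inj₁ (divides x′ ≡.refl) = ≡.subst (p ℕ.^ suc k ∣_) (ℕ.*-comm p x′) (*-monoʳ-∣ p
    (p^∣xy⇒p^∣x k x′ p∤y (*-cancelˡ-∣ p (≡.subst (p ℕ.* p ℕ.^ k ∣_)
      (≡.trans (≡.cong (ℕ._* y) (ℕ.*-comm x′ p)) (ℕ.*-assoc p x′ y)) p^∣))))

  -- Let y be the cofactor of a divisor x. If p divides y, one factor p can be removed and x divides
  -- p^k m; if not, the whole power p^(k+1) is contained in x.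
  divisors-p^ : ∀ k m .{{_ : NonZero m}} → ¬ p ∣ m →
    divisors (p ℕ.^ suc k ℕ.* m) ↭ divisors (p ℕ.^ k ℕ.* m) ++ map (p ℕ.^ suc k ℕ.*_) (divisors m)
  divisors-p^ k m p∤m = unique-↭ (divisors-unique M′)
    (Unique.++⁺ (divisors-unique M)
      (Unique.map⁺ (λ {x} {y} → ℕ.*-cancelˡ-≡ x y (p ℕ.^ suc k) {{p^≢0 (suc k)}}) (divisors-unique m)) disjoint)
    to from
    where
    M M′ : ℕ
    M  = p ℕ.^ k ℕ.* m
    M′ = p ℕ.^ suc k ℕ.* m
    instance
      M≢0 : NonZero M
      M≢0 = ℕ.m*n≢0 (p ℕ.^ k) m {{p^≢0 k}}
      M′≢0 : NonZero M′
      M′≢0 = ℕ.m*n≢0 (p ℕ.^ suc k) m {{p^≢0 (suc k)}}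
    M′≡p*M : M′ ≡ p ℕ.* M
    M′≡p*M = ℕ.*-assoc p (p ℕ.^ k) m
    disjoint : ∀ {x} → ¬ (x ∈ divisors M × x ∈ map (p ℕ.^ suc k ℕ.*_) (divisors m))
    disjoint (x∈ , x∈′) with ∈-map⁻ (p ℕ.^ suc k ℕ.*_) x∈′
    ... | e , e∈ , ≡.refl = p∤m (*-cancelˡ-∣ (p ℕ.^ k) {{p^≢0 k}} (≡.subst (_∣ M) (ℕ.*-comm p (p ℕ.^ k))
      (∣-trans (m∣m*n e) (∈-divisors⁻ M x∈))))
    to : ∀ {x} → x ∈ divisors M′ → x ∈ divisors M ++ map (p ℕ.^ suc k ℕ.*_) (divisors m)
    to {x} x∈ with ∈-divisors⁻ M′ x∈
    ... | divides y M′≡yx with p ∣? y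
    ...   | yes (divides y′ ≡.refl) = ∈-++⁺ˡ (∈-divisors⁺ M (divides y′ (ℕ.*-cancelˡ-≡ M (y′ ℕ.* x) p
      (≡.trans (≡.sym M′≡p*M) (≡.trans M′≡yx (≡.trans (≡.cong (ℕ._* x) (ℕ.*-comm y′ p)) (ℕ.*-assoc p y′ x)))))))
    ...   | no p∤y with p^∣xy⇒p^∣x (suc k) x p∤y (divides m (≡.trans (ℕ.*-comm x y) (≡.trans (≡.sym M′≡yx) (ℕ.*-comm (p ℕ.^ suc k) m))))
    ...     | divides e ≡.refl = ∈-++⁺ʳ (divisors M) (≡.subst (_∈ map (p ℕ.^ suc k ℕ.*_) (divisors m))
      (ℕ.*-comm (p ℕ.^ suc k) e) (∈-map⁺ (p ℕ.^ suc k ℕ.*_) (∈-divisors⁺ m (divides y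
        (ℕ.*-cancelˡ-≡ m (y ℕ.* e) (p ℕ.^ suc k) {{p^≢0 (suc k)}} (≡.trans M′≡yx
          (solveℕ 3 (λ y e q → y :*: (e :*: q) :=: q :*: (y :*: e)) ≡.refl y e (p ℕ.^ suc k))))))))
    from : ∀ {x} → x ∈ divisors M ++ map (p ℕ.^ suc k ℕ.*_) (divisors m) → x ∈ divisors M′
    from x∈ with ∈-++⁻ (divisors M) x∈
    ... | inj₁ x∈M = ∈-divisors⁺ M′ (∣-trans (∈-divisors⁻ M x∈M) (divides p M′≡p*M))
    ... | inj₂ x∈m with ∈-map⁻ (p ℕ.^ suc k ℕ.*_) x∈m
    ...   | e , e∈ , ≡.refl = ∈-divisors⁺ M′ (*-monoʳ-∣ (p ℕ.^ suc k) (∈-divisors⁻ m e∈))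

  divisor-p^ : ∀ k m .{{_ : NonZero m}} → ¬ p ∣ m → ∀ {x} → x ∈ divisors (p ℕ.^ k ℕ.* m) →
               ∃[ i ] ∃[ d ] i ≤ k × d ∣ m × x ≡ p ℕ.^ i ℕ.* d
  divisor-p^ zero    m p∤m {x} x∈ = 0 , x , z≤n ,
    ≡.subst (x ∣_) (ℕ.*-identityˡ m) (∈-divisors⁻ (1 ℕ.* m) x∈) , ≡.sym (ℕ.*-identityˡ x)
  divisor-p^ (suc k) m p∤m x∈ with ∈-++⁻ (divisors (p ℕ.^ k ℕ.* m)) (∈-resp-↭ (divisors-p^ k m p∤m) x∈)
    where open import Data.List.Relation.Binary.Permutation.Propositional.Properties using (∈-resp-↭)
  ... | inj₁ x∈M = let i , d , i≤k , d∣m , eq = divisor-p^ k m p∤m x∈M in i , d , ℕ.m≤n⇒m≤1+n i≤k , d∣m , eq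
  ... | inj₂ x∈m = let d , d∈ , eq = ∈-map⁻ (p ℕ.^ suc k ℕ.*_) x∈m in suc k , d , ℕ.≤-refl , ∈-divisors⁻ m d∈ , eq

  inverse-p : ∀ e .{{_ : NonZero e}} → ¬ p ∣ e → ∃[ x ] ∃[ t ] x ℕ.* p ≡ 1 ℕ.+ t ℕ.* e
  inverse-p e p∤e = go (coprime-Bézout coprime)
    where
    coprime : Coprime p e
    coprime (d∣p , d∣e) with prime⇒irreducible p-prime d∣p
    ... | inj₁ d≡1    = d≡1
    ... | inj₂ ≡.refl = contradiction d∣e p∤e
    go : Bézout.Identity 1 p e → ∃[ x ] ∃[ t ] x ℕ.* p ≡ 1 ℕ.+ t ℕ.* e
    go (Bézout.+- x y eq) = x , y , ≡.sym eq
    -- If 1 + xp = ye then x²p inverts p, because (xp)² = 1 + (xp - 1)(xp + 1).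
    go (Bézout.-+ x y eq) with x ℕ.* p in xp
    -- Here y e = 1, so e = 1 and every number is an inverse.
    ... | zero  = 1 , p ∸ 1 , ≡.trans (ℕ.*-identityˡ p) (≡.trans (≡.sym (ℕ.m+[n∸m]≡n (ℕ.<⇒≤ 1<p)))
      (≡.cong suc (≡.sym (≡.trans (≡.cong ((p ∸ 1) ℕ.*_) (ℕ.m*n≡1⇒n≡1 y e (≡.sym eq))) (ℕ.*-identityʳ (p ∸ 1))))))
    ... | suc w = x ℕ.* x ℕ.* p , w ℕ.* y , (begin
      x ℕ.* x ℕ.* p ℕ.* p          ≡⟨ solveℕ 2 (λ x p → x :*: x :*: p :*: p :=: (x :*: p) :*: (x :*: p)) ≡.refl x p ⟩
      (x ℕ.* p) ℕ.* (x ℕ.* p)      ≡⟨ ≡.cong (λ z → z ℕ.* z) xp ⟩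
      suc w ℕ.* suc w              ≡⟨ solveℕ 1 (λ w → (conℕ 1 :+: w) :*: (conℕ 1 :+: w)
                                        :=: conℕ 1 :+: w :*: (conℕ 1 :+: (conℕ 1 :+: w))) ≡.refl w ⟩
      1 ℕ.+ w ℕ.* (1 ℕ.+ suc w)    ≡⟨ ≡.cong (λ z → 1 ℕ.+ w ℕ.* z) eq ⟩
      1 ℕ.+ w ℕ.* (y ℕ.* e)        ≡⟨ ≡.cong (1 ℕ.+_) (ℕ.*-assoc w y e) ⟨
      1 ℕ.+ w ℕ.* y ℕ.* e          ∎)
      where open ≡.≡-Reasoning

  -- Modulo Φₑ, where X^e = 1, the substitution X ↦ X^x undoes X ↦ X^(p^k): this is the inverse that
  -- `norm-automorphism` asks for.
  inverse-p^ : ∀ k e .{{_ : NonZero e}} → ¬ p ∣ e → ∃[ x ] ∃[ t ] x ℕ.* p ℕ.^ k ≡ 1 ℕ.+ t ℕ.* e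
  inverse-p^ zero    e p∤e = 1 , 0 , ≡.refl
  inverse-p^ (suc k) e p∤e =
    let x , t , eq = inverse-p e p∤e; y , u , eq′ = inverse-p^ k e p∤e
    in  x ℕ.* y , t ℕ.+ u ℕ.+ t ℕ.* u ℕ.* e , (begin
      x ℕ.* y ℕ.* (p ℕ.* p ℕ.^ k)
        ≡⟨ solveℕ 4 (λ x y p q → x :*: y :*: (p :*: q) :=: (x :*: p) :*: (y :*: q)) ≡.refl x y p (p ℕ.^ k) ⟩
      (x ℕ.* p) ℕ.* (y ℕ.* p ℕ.^ k)        ≡⟨ ≡.cong₂ ℕ._*_ eq eq′ ⟩
      (1 ℕ.+ t ℕ.* e) ℕ.* (1 ℕ.+ u ℕ.* e)
        ≡⟨ solveℕ 3 (λ t u e → (conℕ 1 :+: t :*: e) :*: (conℕ 1 :+: u :*: e)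
             :=: conℕ 1 :+: (t :+: u :+: t :*: u :*: e) :*: e) ≡.refl t u e ⟩
      1 ℕ.+ (t ℕ.+ u ℕ.+ t ℕ.* u ℕ.* e) ℕ.* e ∎)
    where open ≡.≡-Reasoning

-- Norms of cyclotomic polynomials modulo each other

module CyclotomicNorms {c ℓ} {R : CommutativeRing c ℓ} (family : CyclotomicFamily R) where
  open CommutativeRing R
  open Polynomial R
  open CyclotomicFamily family
  open IsCharZeroDomain isDomain
  open FromNat R
  open Polys R
  open Det R using (sgn; sgn-+)
  open Norms R
  open NormProperties R
  open Cyclotomic family
  private
    module P = CommutativeRing polyRing
    module PR = Relation.Binary.Reasoning.Setoid P.setoid
    module PP = BigProduct P.*-commutativeMonoid
  open BigProduct *-commutativeMonoid
  open import Relation.Binary.Reasoning.Setoid setoid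
  open import Algebra.Properties.Semiring.Exp semiring using (_^_; ^-congˡ; ^-homo-*)
  open import Algebra.Properties.CommutativeSemiring.Exp commutativeSemiring using (^-distrib-*)
  open import Algebra.Properties.Ring ring using (-‿distribˡ-*; -‿distribʳ-*; x∙y⁻¹≈ε⇒x≈y)
  open import Algebra.Solver.Ring.NaturalCoefficients.Default commutativeSemiring
    using (solve; _:+_; _:*_; _:=_; con)

  ^≉0 : ∀ {x} → ¬ x ≈ 0# → ∀ n → ¬ x ^ n ≈ 0#
  ^≉0 x≉0 zero    = 1≉0
  ^≉0 x≉0 (suc n) x^n≈0 = ^≉0 x≉0 n (domain x^n≈0 x≉0)

  *-cancel : ∀ {x y z} → ¬ x ≈ 0# → x * y ≈ x * z → y ≈ z
  *-cancel {x} {y} {z} x≉0 eq = x∙y⁻¹≈ε⇒x≈y y z (domain (begin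
    x * (y + - z)       ≈⟨ distribˡ x y (- z) ⟩
    x * y + x * - z     ≈⟨ +-cong eq (sym (-‿distribʳ-* x z)) ⟩
    x * z + - (x * z)   ≈⟨ -‿inverseʳ _ ⟩
    0#                  ∎) x≉0)

  *-cancel-1 : ∀ {x y} → ¬ x ≈ 0# → x * y ≈ x → y ≈ 1#
  *-cancel-1 x≉0 eq = *-cancel x≉0 (trans eq (sym (*-identityʳ _)))

  N : ℕ → ℕ → Carrier
  N a b = norm (Φᵐ a) (Φᴾ b)

  -- A nonzero constant x in the ideal of Φₖ and Φₗ is congruent to a multiple of Φₗ modulo Φₖ. Its
  -- norm, a power of x, is therefore a multiple of N k l. All later cancellations of norms rest on
  -- this.
  N≉0 : ∀ k l .{{_ : NonZero k}} .{{_ : NonZero l}} → k ≢ l → ¬ N k l ≈ 0#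
  N≉0 k l k≢l N≈0 = let x , x≉0 , u , v , eq = Φ-coprime k l k≢l in
    ^≉0 x≉0 (degree (Φᵐ k)) (begin
      x ^ degree (Φᵐ k)              ≈⟨ norm-[ x ] (Φᵐ k) ⟨
      norm (Φᵐ k) [ x ]              ≈⟨ norm-modulo (Φᵐ k) {[ x ]} {v ⊗ Φᴾ l} (u , eq) ⟩
      norm (Φᵐ k) (v ⊗ Φᴾ l)         ≈⟨ norm-⊗ (Φᵐ k) v (Φᴾ l) ⟩
      norm (Φᵐ k) v * N k l          ≈⟨ *-congˡ N≈0 ⟩
      norm (Φᵐ k) v * 0#             ≈⟨ zeroʳ _ ⟩
      0#                            ∎)

  dilate-const : ∀ q a → dilate q [ a ] ≃ [ a ]
  dilate-const q a = P.trans (P.+-congˡ {[ a ]} (P.zeroʳ (X^ q))) (P.+-identityʳ [ a ])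

  dilate-dilate : ∀ a b r → dilate a (dilate b r) ≃ dilate (b ℕ.* a) r
  dilate-dilate a b []      = P.refl
  dilate-dilate a b (x ∷ r) = P.trans (dilate-⊕ a [ x ] (X^ b ⊗ dilate b r)) (P.+-cong (dilate-const a x)
    (P.trans (dilate-⊗ a (X^ b) (dilate b r)) (P.*-cong (dilate-X^ a b) (dilate-dilate a b r))))

  dilate-prod : ∀ q l → dilate q (PP.prod Φᴾ l) ≃ PP.prod (dilate q ∘ Φᴾ) l
  dilate-prod q []      = dilate-const q 1#
  dilate-prod q (d ∷ l) = P.trans (dilate-⊗ q (Φᴾ d) (PP.prod Φᴾ l)) (P.*-congˡ {dilate q (Φᴾ d)} (dilate-prod q l))

  dilate-Xⁿ-1 : ∀ q n → dilate q (Xⁿ-1ᴾ n) ≃ Xⁿ-1ᴾ (n ℕ.* q)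
  dilate-Xⁿ-1 q n = P.trans (dilate-⊕ q (X^ n) [ - 1# ]) (P.+-cong (dilate-X^ q n) (dilate-const q (- 1#)))

  sgn-*-odd : ∀ a {p} → sgn p ≈ - 1# → sgn (p ℕ.* a) ≈ sgn a
  sgn-*-odd a {p} sgn-p = trans (reflexive (≡.cong sgn (ℕ.*-comm p a))) (go a)
    where
    go : ∀ a → sgn (a ℕ.* p) ≈ sgn a
    go zero    = refl
    go (suc a) = trans (sgn-+ p (a ℕ.* p)) (trans (*-cong sgn-p (go a))
      (trans (sym (-‿distribˡ-* 1# (sgn a))) (-‿cong (*-identityˡ (sgn a)))))

  module _ (p : ℕ) (p-prime : Prime p) where
    open PrimePowers p p-prime

    tower : ℕ → ℕ → Poly
    tower zero    e = Φᴾ e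
    tower (suc k) e = tower k e ⊗ Φᴾ (p ℕ.^ suc k ℕ.* e)

    tower-monic : ∀ k e → ∃[ n ] IsMonic n (tower k e)
    tower-monic zero    e = degree (Φᵐ e) , isMonic-⟦⟧ (Φᵐ e)
    tower-monic (suc k) e = let n , m = tower-monic k e in
      n ℕ.+ degree (Φᵐ (p ℕ.^ suc k ℕ.* e)) , isMonic-⊗ m (isMonic-⟦⟧ (Φᵐ (p ℕ.^ suc k ℕ.* e)))

    -- For e dividing d and i ≤ k, the numbers pⁱe run exactly once through the divisors of p^k d.
    prod-tower : ∀ k d .{{_ : NonZero d}} → ¬ p ∣ d → PP.prod (tower k) (divisors d) ≃ Xⁿ-1ᴾ (p ℕ.^ k ℕ.* d)
    prod-tower zero    d p∤d = P.trans (P.sym (X^n-1≃∏Φ d)) (P.reflexive (≡.cong Xⁿ-1ᴾ (≡.sym (ℕ.*-identityˡ d))))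
    prod-tower (suc k) d p∤d = PR.begin
      PP.prod (tower (suc k)) (divisors d)
        PR.≈⟨ PP.prod-∙ (tower k) (λ e → Φᴾ (q ℕ.* e)) (divisors d) ⟩
      PP.prod (tower k) (divisors d) ⊗ PP.prod (λ e → Φᴾ (q ℕ.* e)) (divisors d)
        PR.≈⟨ P.*-cong (P.trans (prod-tower k d p∤d) (X^n-1≃∏Φ M {{M≢0}}))
                (P.reflexive (≡.sym (PP.prod-map Φᴾ (q ℕ.*_) (divisors d)))) ⟩
      PP.prod Φᴾ (divisors M) ⊗ PP.prod Φᴾ (map (q ℕ.*_) (divisors d))
        PR.≈⟨ PP.prod-++ Φᴾ (divisors M) (map (q ℕ.*_) (divisors d)) ⟨
      PP.prod Φᴾ (divisors M ++ map (q ℕ.*_) (divisors d))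
        PR.≈⟨ PP.prod-↭ Φᴾ (divisors-p^ k d p∤d) ⟨
      PP.prod Φᴾ (divisors (q ℕ.* d))  PR.≈⟨ X^n-1≃∏Φ (q ℕ.* d) {{ℕ.m*n≢0 q d {{p^≢0 (suc k)}}}} ⟨
      Xⁿ-1ᴾ (q ℕ.* d) PR.∎
      where
      q = p ℕ.^ suc k
      M = p ℕ.^ k ℕ.* d
      M≢0 : NonZero M
      M≢0 = ℕ.m*n≢0 (p ℕ.^ k) d {{p^≢0 k}}

    prod-monic : ∀ (f : ℕ → Poly) → (∀ e → ∃[ n ] IsMonic n (f e)) → ∀ l → ∃[ n ] IsMonic n (PP.prod f l)
    prod-monic f mf []      = 0 , isMonic-X^ 0
    prod-monic f mf (e ∷ l) = let n , m = mf e; n′ , m′ = prod-monic f mf l in n ℕ.+ n′ , isMonic-⊗ m m′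

    -- Taken over all divisors of d, both sides multiply to X^(p^k d) - 1. By induction they agree
    -- at the proper divisors, whose monic factors cancel.
    dilate-Φ : ∀ k d → NonZero d → ¬ p ∣ d → dilate (p ℕ.^ k) (Φᴾ d) ≃ tower k d
    dilate-Φ k = <-rec (λ d → NonZero d → ¬ p ∣ d → dilate q (Φᴾ d) ≃ tower k d) step
      where
      q = p ℕ.^ k
      step : ∀ d → (∀ {e} → e < d → NonZero e → ¬ p ∣ e → dilate q (Φᴾ e) ≃ tower k e) →
             NonZero d → ¬ p ∣ d → dilate q (Φᴾ d) ≃ tower k d
      step d ih d≢0 p∤d = monic-cancel {proj₁ monicP} {rest} {dilate q (Φᴾ d)} {tower k d} (proj₂ monicP) (PR.begin
        dilate q (Φᴾ d) ⊗ rest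
          PR.≈⟨ P.*-congˡ {dilate q (Φᴾ d)} (PP.prod-cong (properDivisors d) λ e∈ →
                  let e∣d , e<d = ∈-properDivisors⁻ d e∈ in
                  ih e<d (∣-nonZero e∣d) (p∤d ∘ λ p∣e → ∣-trans p∣e e∣d)) ⟨
        PP.prod (dilate q ∘ Φᴾ) (d ∷ properDivisors d)
          PR.≈⟨ PP.prod-↭ (dilate q ∘ Φᴾ) (divisors-↭-properDivisors d) ⟨
        PP.prod (dilate q ∘ Φᴾ) (divisors d)            PR.≈⟨ dilate-prod q (divisors d) ⟨
        dilate q (PP.prod Φᴾ (divisors d))              PR.≈⟨ dilate-cong q (X^n-1≃∏Φ d) ⟨
        dilate q (Xⁿ-1ᴾ d)                              PR.≈⟨ dilate-Xⁿ-1 q d ⟩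
        Xⁿ-1ᴾ (d ℕ.* q)                                 PR.≡⟨ ≡.cong Xⁿ-1ᴾ (ℕ.*-comm d q) ⟩
        Xⁿ-1ᴾ (q ℕ.* d)                                 PR.≈⟨ prod-tower k d p∤d ⟨
        PP.prod (tower k) (divisors d)                  PR.≈⟨ PP.prod-↭ (tower k) (divisors-↭-properDivisors d) ⟩
        tower k d ⊗ rest PR.∎)
        where
        instance
          _ = d≢0
        rest = PP.prod (tower k) (properDivisors d)
        monicP = prod-monic (tower k) (tower-monic k) (properDivisors d)

    Φ∣tower : ∀ k e → ∃[ h ] tower k e ≃ h ⊗ Φᴾ e
    Φ∣tower zero    e = [ 1# ] , P.sym (P.*-identityˡ (Φᴾ e))
    Φ∣tower (suc k) e = let h , eq = Φ∣tower k e; g = Φᴾ (p ℕ.^ suc k ℕ.* e) in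
      g ⊗ h , P.trans (P.*-comm (tower k e) g) (P.trans (P.*-congˡ {g} eq) (P.sym (P.*-assoc g h (Φᴾ e))))

    norm-dilate-Φ : ∀ k e .{{_ : NonZero e}} → ¬ p ∣ e → ∀ g → norm (Φᵐ e) (dilate (p ℕ.^ k) g) ≈ norm (Φᵐ e) g
    norm-dilate-Φ k e p∤e g =
      let x , t , eq = inverse-p^ k e p∤e
          h , eq′ = Φ∣tower k e
          -- The quotient of X^(1 + t e) - X by Φₑ: the factor X^(t e) - 1 is a multiple of X^e - 1,
          -- which is Φₑ times the factors of the proper divisors.
          u = X^ 1 ⊗ geometric t e ⊗ PP.prod Φᴾ (properDivisors e)
      in  norm-automorphism (p ℕ.^ k) x (Φᵐ e) h
            (P.trans (dilate-Φ k e (ℕ.≢-nonZero (ℕ.≢-nonZero⁻¹ e)) p∤e) eq′)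
            (u , P.trans (P.reflexive (≡.cong X^ eq)) (P.trans (X^-+ 1 (t ℕ.* e)) (power t u ≡.refl))) g
      where
      power : ∀ t u → u ≡ X^ 1 ⊗ geometric t e ⊗ PP.prod Φᴾ (properDivisors e) → X^ 1 ⊗ X^ (t ℕ.* e) ≃ u ⊗ Φᴾ e ⊕ X^ 1
      power t _ ≡.refl = PR.begin
        X^ 1 ⊗ X^ (t ℕ.* e)                       PR.≈⟨ P.*-congˡ {X^ 1} (X^≃Xⁿ-1ᴾ⊕1 (t ℕ.* e)) ⟩
        X^ 1 ⊗ (Xⁿ-1ᴾ (t ℕ.* e) ⊕ [ 1# ])
          PR.≈⟨ P.*-congˡ {X^ 1} (P.+-congʳ {[ 1# ]} (P.trans (geometric-* t e)
                  (P.*-congˡ {geometric t e} (formula e (ℕ.≢-nonZero (ℕ.≢-nonZero⁻¹ e)))))) ⟩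
        X^ 1 ⊗ (geometric t e ⊗ (Φᴾ e ⊗ rest) ⊕ [ 1# ])
          PR.≈⟨ PS.solve 4 (λ x g f r → x PS.:* (g PS.:* (f PS.:* r) PS.:+ PS.con 1) PS.:= x PS.:* g PS.:* r PS.:* f PS.:+ x)
                  P.refl (X^ 1) (geometric t e) (Φᴾ e) rest ⟩
        X^ 1 ⊗ geometric t e ⊗ rest ⊗ Φᴾ e ⊕ X^ 1 PR.∎
        where
        rest = PP.prod Φᴾ (properDivisors e)
        module PS = Algebra.Solver.Ring.NaturalCoefficients.Default P.commutativeSemiring

    -- The norms of Φ(pʲd) modulo Φ(pⁱe) are extracted from those of the towers,
    -- which norm-dilate and norm-dilate-Φ reduce to N e d.
    module _ (sgn-p : sgn p ≈ - 1#) (e d : ℕ) .{{_ : NonZero e}} .{{_ : NonZero d}}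
             (p∤e : ¬ p ∣ e) (p∤d : ¬ p ∣ d) (e≢d : e ≢ d) where
      private
        q : ℕ → ℕ
        q i = p ℕ.^ i

      private
        t = N e d

      t≉0 : ¬ t ≈ 0#
      t≉0 = N≉0 e d e≢d

      T : ℕ → ℕ → ℕ → ℕ → Carrier
      T e d i j = norm (dilateᵐ (q i) (Φᵐ e)) ⟦ dilateᵐ (q j) (Φᵐ d) ⟧

      -- Writing p^j as p^(j-i) times p^i leaves a common substitution of X^(p^i), which raises the
      -- norm to a power, and a further one in the argument alone. Both e and d are quantified anew
      -- because `T-≥` exchanges them.
      T-≤ : ∀ e d .{{_ : NonZero e}} → ¬ p ∣ e → ∀ {i j} → i ≤ j → T e d i j ≈ N e d ^ q i
      T-≤ e d p∤e {i} {j} i≤j = begin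
        norm (dilateᵐ (q i) (Φᵐ e)) ⟦ dilateᵐ (q j) (Φᵐ d) ⟧
          ≈⟨ norm-cong (dilateᵐ (q i) (Φᵐ e)) (P.trans (⟦dilateᵐ⟧ (q j) {{p^≢0 j}} (Φᵐ d))
               (P.trans (P.reflexive (≡.cong (λ k → dilate k (Φᴾ d)) q≡)) (P.sym (dilate-dilate (q i) (q (j ∸ i)) (Φᴾ d))))) ⟩
        norm (dilateᵐ (q i) (Φᵐ e)) (dilate (q i) (dilate (q (j ∸ i)) (Φᴾ d)))
          ≈⟨ norm-dilate (q i) {{p^≢0 i}} (Φᵐ e) (dilate (q (j ∸ i)) (Φᴾ d)) ⟩
        norm (Φᵐ e) (dilate (q (j ∸ i)) (Φᴾ d)) ^ q i
          ≈⟨ ^-congˡ (q i) (norm-dilate-Φ (j ∸ i) e p∤e (Φᴾ d)) ⟩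
        N e d ^ q i ∎
        where
        q≡ : q j ≡ q (j ∸ i) ℕ.* q i
        q≡ = ≡.trans (≡.cong q (≡.sym (ℕ.m∸n+n≡m i≤j))) (ℕ.^-distribˡ-+-* p (j ∸ i) i)

      sgn-q : ∀ a i → sgn (a ℕ.* q i) ≈ sgn a
      sgn-q a zero    = reflexive (≡.cong sgn (ℕ.*-identityʳ a))
      sgn-q a (suc i) = trans
        (reflexive (≡.cong sgn (solveℕ 3 (λ a p x → a :*: (p :*: x) :=: p :*: (a :*: x)) ≡.refl a p (q i))))
        (trans (sgn-*-odd (a ℕ.* q i) {p} sgn-p) (sgn-q a i))

      sgn-odd-power : ∀ a i → sgn a ^ q i ≈ sgn a
      sgn-odd-power a i = trans (sgn-power a (q i)) (sgn-q a i)
        where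
        sgn-power : ∀ a n → sgn a ^ n ≈ sgn (a ℕ.* n)
        sgn-power a zero    = reflexive (≡.cong sgn (≡.sym (ℕ.*-zeroʳ a)))
        sgn-power a (suc n) = trans (*-congˡ (sgn-power a n)) (trans (sym (sgn-+ a (a ℕ.* n)))
          (reflexive (≡.cong sgn (≡.sym (ℕ.*-suc a n)))))

      -- Symmetry reduces this to `T-≤` with e and d exchanged. One sign comes from the towers,
      -- another from the power of N d e; as p is odd, powers of p change neither, so the two are
      -- equal and cancel.
      T-≥ : ∀ {i j} → j ≤ i → T e d i j ≈ t ^ q j
      T-≥ {i} {j} j≤i = begin
        T e d i j
          ≈⟨ norm-symmetric (dilateᵐ (q i) (Φᵐ e)) (dilateᵐ (q j) (Φᵐ d)) ⟩
        sgn (degree (dilateᵐ (q i) (Φᵐ e)) ℕ.* degree (dilateᵐ (q j) (Φᵐ d))) * T d e j i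
          ≈⟨ *-cong sign (T-≤ d e p∤d j≤i) ⟩
        s * N d e ^ q j
          ≈⟨ *-congˡ (trans (^-congˡ (q j) (norm-symmetric (Φᵐ d) (Φᵐ e))) (^-distrib-* _ _ (q j))) ⟩
        s * (sgn (degree (Φᵐ d) ℕ.* degree (Φᵐ e)) ^ q j * t ^ q j)
          ≈⟨ *-congˡ (*-congʳ (trans (sgn-odd-power (degree (Φᵐ d) ℕ.* degree (Φᵐ e)) j)
               (reflexive (≡.cong sgn (ℕ.*-comm (degree (Φᵐ d)) (degree (Φᵐ e))))))) ⟩
        s * (s * t ^ q j)      ≈⟨ *-assoc s s (t ^ q j) ⟨
        s * s * t ^ q j        ≈⟨ *-congʳ (sgn² (degree (Φᵐ e) ℕ.* degree (Φᵐ d))) ⟩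
        1# * t ^ q j           ≈⟨ *-identityˡ _ ⟩
        t ^ q j                ∎
        where
        s = sgn (degree (Φᵐ e) ℕ.* degree (Φᵐ d))
        sign : sgn (degree (dilateᵐ (q i) (Φᵐ e)) ℕ.* degree (dilateᵐ (q j) (Φᵐ d))) ≈ s
        sign = trans (reflexive (≡.cong sgn (≡.trans
          (≡.cong₂ ℕ._*_ (degree-dilateᵐ (q i) {{p^≢0 i}} (Φᵐ e)) (degree-dilateᵐ (q j) {{p^≢0 j}} (Φᵐ d)))
          (≡.sym (ℕ.*-assoc (degree (Φᵐ e) ℕ.* q i) (degree (Φᵐ d)) (q j))))))
          (trans (sgn-q (degree (Φᵐ e) ℕ.* q i ℕ.* degree (Φᵐ d)) j)
          (trans (reflexive (≡.cong sgn (solveℕ 3 (λ x y z → x :*: y :*: z :=: x :*: z :*: y) ≡.refl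
            (degree (Φᵐ e)) (q i) (degree (Φᵐ d))))) (sgn-q (degree (Φᵐ e) ℕ.* degree (Φᵐ d)) i)))

      ⟦dilateᵐ⟧-tower : ∀ i e .{{_ : NonZero e}} → ¬ p ∣ e → ⟦ dilateᵐ (q i) (Φᵐ e) ⟧ ≃ tower i e
      ⟦dilateᵐ⟧-tower i e p∤e = P.trans (⟦dilateᵐ⟧ (q i) {{p^≢0 i}} (Φᵐ e)) (dilate-Φ i e (ℕ.≢-nonZero (ℕ.≢-nonZero⁻¹ e)) p∤e)

      ⟦dilateᵐ⟧-suc : ∀ i e .{{_ : NonZero e}} → ¬ p ∣ e →
        ⟦ dilateᵐ (q (suc i)) (Φᵐ e) ⟧ ≃ ⟦ dilateᵐ (q i) (Φᵐ e) ⟧ ⊗ Φᴾ (q (suc i) ℕ.* e)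
      ⟦dilateᵐ⟧-suc i e p∤e = P.trans (⟦dilateᵐ⟧-tower (suc i) e p∤e)
        (P.*-congʳ {Φᴾ (q (suc i) ℕ.* e)} (P.sym (⟦dilateᵐ⟧-tower i e p∤e)))

      -- Together, `T-≤` and `T-≥` say that T e d i j is t to the power p^min(i, j). U is the
      -- quotient of consecutive entries in i, and the norms sought are quotients of consecutive U
      -- in j. On exponents this is the mixed difference of p^min(i, j), which vanishes off the
      -- diagonal.
      U : ℕ → ℕ → Carrier
      U i j = norm (Φᵐ (q i ℕ.* e)) ⟦ dilateᵐ (q j) (Φᵐ d) ⟧

      T-suc : ∀ i j → T e d (suc i) j ≈ T e d i j * U (suc i) j
      T-suc i j = norm-product (dilateᵐ (q (suc i)) (Φᵐ e)) (dilateᵐ (q i) (Φᵐ e)) (Φᵐ (q (suc i) ℕ.* e)) (dilateᵐ (q j) (Φᵐ d))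
        (isMonic-unique 1≉0 (isMonic-⟦⟧ (dilateᵐ (q (suc i)) (Φᵐ e)))
          (isMonic-≃ (P.sym eq) (isMonic-⊗ (isMonic-⟦⟧ (dilateᵐ (q i) (Φᵐ e))) (isMonic-⟦⟧ (Φᵐ (q (suc i) ℕ.* e))))))
        eq
        where
        eq = ⟦dilateᵐ⟧-suc i e p∤e

      U-0 : ∀ j → U 0 j ≈ t
      U-0 j = trans (reflexive (≡.cong (λ k → norm (Φᵐ k) ⟦ dilateᵐ (q j) (Φᵐ d) ⟧) (ℕ.*-identityˡ e)))
        (trans (norm-cong (Φᵐ e) (⟦dilateᵐ⟧ (q j) {{p^≢0 j}} (Φᵐ d))) (norm-dilate-Φ j e p∤e (Φᴾ d)))

      U-suc : ∀ i j → U i (suc j) ≈ U i j * N (q i ℕ.* e) (q (suc j) ℕ.* d)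
      U-suc i j = trans (norm-cong (Φᵐ (q i ℕ.* e)) (⟦dilateᵐ⟧-suc j d p∤d))
        (norm-⊗ (Φᵐ (q i ℕ.* e)) ⟦ dilateᵐ (q j) (Φᵐ d) ⟧ (Φᴾ (q (suc j) ℕ.* d)))

      U-> : ∀ {i j} → j ≤ i → U (suc i) j ≈ 1#
      U-> {i} {j} j≤i = *-cancel-1 (^≉0 t≉0 (q j)) (begin
        t ^ q j * U (suc i) j        ≈⟨ *-congʳ (T-≥ j≤i) ⟨
        T e d i j * U (suc i) j      ≈⟨ T-suc i j ⟨
        T e d (suc i) j              ≈⟨ T-≥ (ℕ.m≤n⇒m≤1+n j≤i) ⟩
        t ^ q j                      ∎)

      U-≤ : ∀ {i j} → suc i ≤ j → t ^ q i * U (suc i) j ≈ t ^ q (suc i)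
      U-≤ {i} {j} i<j = begin
        t ^ q i * U (suc i) j        ≈⟨ *-congʳ (T-≤ e d p∤e (ℕ.<⇒≤ i<j)) ⟨
        T e d i j * U (suc i) j      ≈⟨ T-suc i j ⟨
        T e d (suc i) j              ≈⟨ T-≤ e d p∤e i<j ⟩
        t ^ q (suc i)                ∎

      -- The multiplicative form of N = t^φ(p^(i+1)), as φ(p^(i+1)) = p^(i+1) - p^i; in this shape
      -- the layers telescope.
      N-diagonal : ∀ i → t ^ q i * N (q (suc i) ℕ.* e) (q (suc i) ℕ.* d) ≈ t ^ q (suc i)
      N-diagonal i = trans (*-congˡ (sym (trans (U-suc (suc i) i) (trans (*-congʳ (U-> {i} {i} ℕ.≤-refl)) (*-identityˡ _)))))
        (U-≤ {i} {suc i} ℕ.≤-refl)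

      N-off-diagonal : ∀ i j → i ≢ j → N (q i ℕ.* e) (q j ℕ.* d) ≈ 1#
      N-off-diagonal zero    zero    0≢0 = contradiction ≡.refl 0≢0
      N-off-diagonal (suc i) zero    _   = trans
        (norm-cong (Φᵐ (q (suc i) ℕ.* e)) (P.trans (P.reflexive (≡.cong Φᴾ (ℕ.*-identityˡ d))) (P.sym (⟦dilateᵐ⟧-tower 0 d p∤d))))
        (U-> {i} {0} z≤n)
      N-off-diagonal zero    (suc j) _   = *-cancel-1 t≉0 (trans (*-congʳ (sym (U-0 j)))
        (trans (sym (U-suc 0 j)) (U-0 (suc j))))
      N-off-diagonal (suc i) (suc j) i≢j with ℕ.<-cmp i j
      ... | tri≈ _ i≡j _ = contradiction (≡.cong suc i≡j) i≢j
      ... | tri> _ _ j<i = trans (sym (*-identityˡ _)) (trans (*-congʳ (sym (U-> (ℕ.<⇒≤ j<i))))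
        (trans (sym (U-suc (suc i) j)) (U-> j<i)))
      -- From `suc i ≤ j` onwards U (suc i) j no longer depends on j, so the factor gained in
      -- passing to j + 1 is 1.
      ... | tri< i<j _ _ = *-cancel-1 u≉0 (trans (sym (U-suc (suc i) j))
        (*-cancel (^≉0 t≉0 (q i)) (trans (U-≤ (ℕ.m≤n⇒m≤1+n i<j)) (sym (U-≤ i<j)))))
        where
        u≉0 : ¬ U (suc i) j ≈ 0#
        u≉0 u≈0 = ^≉0 t≉0 (q (suc i)) (trans (sym (U-≤ i<j)) (trans (*-congˡ u≈0) (zeroʳ _)))

-- The product of the norms over all pairs of divisors

module PairProduct {c ℓ} (M : CommutativeMonoid c ℓ) where
  open CommutativeMonoid M
  open BigProduct M
  open import Algebra.Properties.CommutativeSemigroup commutativeSemigroup using (interchange; x∙yz≈y∙xz)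
  open import Algebra.Solver.CommutativeMonoid M using (solve; _⊕_; _⊜_)

  module _ {a} {A : Set a} where
    pairs : (A → A → Carrier) → List A → Carrier
    pairs f []       = ε
    pairs f (x ∷ xs) = prod (f x) xs ∙ pairs f xs

    pairs-cong : ∀ {f g} {_<ᴬ_ : A → A → Set} xs → AllPairs _<ᴬ_ xs →
                 (∀ {x y} → x ∈ xs → y ∈ xs → x <ᴬ y → f x y ≈ g x y) → pairs f xs ≈ pairs g xs
    pairs-cong []       _         eq = refl
    pairs-cong (x ∷ xs) (x< ∷ xs<) eq = ∙-cong
      (prod-cong xs λ y∈ → eq (here ≡.refl) (there y∈) (All.lookup x< y∈))
      (pairs-cong xs xs< λ x∈ y∈ → eq (there x∈) (there y∈))

    pairs-∙ : ∀ f g xs → pairs (λ x y → f x y ∙ g x y) xs ≈ pairs f xs ∙ pairs g xs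
    pairs-∙ f g []       = sym (identityˡ ε)
    pairs-∙ f g (x ∷ xs) = trans (∙-cong (prod-∙ (f x) (g x) xs) (pairs-∙ f g xs)) (interchange _ _ _ _)

    pairs-++ : ∀ f xs ys → pairs f (xs ++ ys) ≈ (pairs f xs ∙ pairs f ys) ∙ prod (λ x → prod (f x) ys) xs
    pairs-++ f []       ys = sym (trans (identityʳ _) (identityˡ _))
    pairs-++ f (x ∷ xs) ys = trans (∙-cong (prod-++ (f x) xs ys) (pairs-++ f xs ys))
      (solve 5 (λ a b c d e → (a ⊕ b) ⊕ ((c ⊕ d) ⊕ e) ⊜ ((a ⊕ c) ⊕ d) ⊕ (b ⊕ e)) refl _ _ _ _ _)

    pairs-↭ : ∀ f → (∀ x y → f x y ≈ f y x) → ∀ {xs ys} → xs ↭ ys → pairs f xs ≈ pairs f ys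
    pairs-↭ f f-sym ↭.refl         = refl
    pairs-↭ f f-sym (↭.prep x p)   = ∙-cong (prod-↭ (f x) p) (pairs-↭ f f-sym p)
    pairs-↭ f f-sym (↭.swap x y p) = trans
      (∙-cong (∙-cong (f-sym x y) (prod-↭ (f x) p)) (∙-cong (prod-↭ (f y) p) (pairs-↭ f f-sym p)))
      (solve 4 (λ a b c d → (a ⊕ b) ⊕ (c ⊕ d) ⊜ (a ⊕ c) ⊕ (b ⊕ d)) refl _ _ _ _)
    pairs-↭ f f-sym (↭.trans p q)  = trans (pairs-↭ f f-sym p) (pairs-↭ f f-sym q)

  pairs-map : ∀ {a b} {A : Set a} {B : Set b} f (g : A → B) xs →
              pairs f (map g xs) ≡ pairs (λ x y → f (g x) (g y)) xs
  pairs-map f g []       = ≡.refl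
  pairs-map f g (x ∷ xs) = ≡.cong₂ _∙_ (prod-map (f (g x)) g xs) (pairs-map f g xs)

divisors-sorted : ∀ n → AllPairs _<_ (divisors n)
divisors-sorted n = AllPairs.filter⁺ (_∣? n) (AllPairs.applyUpTo⁺₁ suc n λ i<j _ → s<s i<j)

-- For p > 1 this is (p^k - 1)/(p - 1); the exponents of the theorem are its multiples by n/p^k.
repunit : ℕ → ℕ → ℕ
repunit p zero    = 0
repunit p (suc k) = repunit p k ℕ.+ p ℕ.^ k

-- Evaluation of the product over pairs of divisors, one prime at a time

module Evaluation {c ℓ} {R : CommutativeRing c ℓ} (family : CyclotomicFamily R) where
  open CommutativeRing R
  open Polynomial R
  open CyclotomicFamily family
  open IsCharZeroDomain isDomain
  open FromNat R
  open Polys R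
  open Det R using (sgn; sgn-+)
  open Norms R
  open NormProperties R
  open Cyclotomic family
  open CyclotomicNorms family
  private
    module P = CommutativeRing polyRing
    module PR = Relation.Binary.Reasoning.Setoid P.setoid
    module PP = BigProduct P.*-commutativeMonoid
  open BigProduct *-commutativeMonoid
  open PairProduct *-commutativeMonoid
  open import Relation.Binary.Reasoning.Setoid setoid
  open import Algebra.Properties.Semiring.Exp semiring using (_^_; ^-congˡ; ^-homo-*)
  open import Algebra.Properties.CommutativeSemiring.Exp commutativeSemiring using (^-distrib-*)
  open import Algebra.Properties.Ring ring using (-‿distribˡ-*; -‿distribʳ-*)
  open import Algebra.Solver.Ring.NaturalCoefficients.Default commutativeSemiring
    using (solve; _:+_; _:*_; _:=_; con)

  1^ : ∀ n → 1# ^ n ≈ 1#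
  1^ zero    = refl
  1^ (suc n) = trans (*-identityˡ _) (1^ n)

  prod-^ : ∀ {a} {A : Set a} f n (xs : List A) → prod (λ x → f x ^ n) xs ≈ prod f xs ^ n
  prod-^ f n []       = sym (1^ n)
  prod-^ f n (x ∷ xs) = trans (*-congˡ (prod-^ f n xs)) (sym (^-distrib-* _ _ n))

  pairs-^ : ∀ {a} {A : Set a} f n (xs : List A) → pairs (λ x y → f x y ^ n) xs ≈ pairs f xs ^ n
  pairs-^ f n []       = sym (1^ n)
  pairs-^ f n (x ∷ xs) = trans (*-cong (prod-^ (f x) n xs) (pairs-^ f n xs)) (sym (^-distrib-* _ _ n))

  norm-prod : ∀ f l → norm f (PP.prod Φᴾ l) ≈ prod (λ x → norm f (Φᴾ x)) l
  norm-prod f []      = norm-1 f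
  norm-prod f (x ∷ l) = trans (norm-⊗ f (Φᴾ x) (PP.prod Φᴾ l)) (*-congˡ (norm-prod f l))

  norm-∏ᵐ : ∀ g l → norm (∏ᵐ (map Φᵐ l)) ⟦ g ⟧ ≈ prod (λ x → norm (Φᵐ x) ⟦ g ⟧) l
  norm-∏ᵐ g []      = refl
  norm-∏ᵐ g (x ∷ l) = trans
    (norm-product (Φᵐ x ⊗ᵐ ∏ᵐ (map Φᵐ l)) (Φᵐ x) (∏ᵐ (map Φᵐ l)) g (degree-⊗ᵐ (Φᵐ x) (∏ᵐ (map Φᵐ l))) (⟦⊗ᵐ⟧ (Φᵐ x) (∏ᵐ (map Φᵐ l))))
    (*-congˡ (norm-∏ᵐ g l))

  ⟦∏ᵐ⟧ : ∀ l → ⟦ ∏ᵐ (map Φᵐ l) ⟧ ≃ PP.prod Φᴾ l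
  ⟦∏ᵐ⟧ []      = P.refl
  ⟦∏ᵐ⟧ (x ∷ l) = P.trans (⟦⊗ᵐ⟧ (Φᵐ x) (∏ᵐ (map Φᵐ l))) (P.*-congˡ {Φᴾ x} (⟦∏ᵐ⟧ l))

  -- Each use of `crtDet-∷` multiplies h by one more Φₓ, which distributes over the norms modulo the
  -- later factors; hence the induction for general h.
  crtDet-pairs : ∀ h l → crtDet h (map Φᵐ l) ≈ prod (λ x → norm (Φᵐ x) h) l * pairs (λ x y → N y x) l
  crtDet-pairs h []      = sym (*-identityˡ 1#)
  crtDet-pairs h (x ∷ l) = begin
    crtDet h (Φᵐ x ∷ map Φᵐ l)                            ≈⟨ crtDet-∷ h (Φᵐ x) (map Φᵐ l) ⟩
    norm (Φᵐ x) h * crtDet (h ⊗ Φᴾ x) (map Φᵐ l)          ≈⟨ *-congˡ (crtDet-pairs (h ⊗ Φᴾ x) l) ⟩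
    norm (Φᵐ x) h * (prod (λ y → norm (Φᵐ y) (h ⊗ Φᴾ x)) l * pairs (λ x y → N y x) l)
      ≈⟨ *-congˡ (*-congʳ (trans (prod-cong l λ {y} _ → norm-⊗ (Φᵐ y) h (Φᴾ x))
           (prod-∙ (λ y → norm (Φᵐ y) h) (λ y → N y x) l))) ⟩
    norm (Φᵐ x) h * (prod (λ y → norm (Φᵐ y) h) l * prod (λ y → N y x) l * pairs (λ x y → N y x) l)
      ≈⟨ solve 4 (λ a b c d → a :* (b :* c :* d) := a :* b :* (c :* d)) refl _ _ _ _ ⟩
    norm (Φᵐ x) h * prod (λ y → norm (Φᵐ y) h) l * (prod (λ y → N y x) l * pairs (λ x y → N y x) l) ∎

  -- Sorting the two arguments makes the factor of a pair symmetric, so that `pairs H` is unchanged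
  -- when the divisors are rearranged into layers. N itself is symmetric only up to sign. On the
  -- sorted list of divisors both give the same product.
  H : ℕ → ℕ → Carrier
  H x y = N (x ℕ.⊔ y) (x ℕ.⊓ y)

  H-sym : ∀ x y → H x y ≈ H y x
  H-sym x y = reflexive (≡.cong₂ N (ℕ.⊔-comm x y) (ℕ.⊓-comm x y))

  H-< : ∀ {x y} → x < y → H x y ≈ N y x
  H-< x<y = reflexive (≡.cong₂ N (ℕ.m≤n⇒m⊔n≡n (ℕ.<⇒≤ x<y)) (ℕ.m≤n⇒m⊓n≡m (ℕ.<⇒≤ x<y)))

  H-> : ∀ {x y} → y < x → H x y ≈ N x y
  H-> {x} {y} y<x = trans (H-sym x y) (H-< y<x)

  W : ℕ → Carrier
  W n = pairs H (divisors n)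

  W≈pairs : ∀ n → W n ≈ pairs (λ x y → N y x) (divisors n)
  W≈pairs n = pairs-cong (divisors n) (divisors-sorted n) λ _ _ → H-<

  crtDet≈W : ∀ n → crtDet [ 1# ] (map Φᵐ (divisors n)) ≈ W n
  crtDet≈W n = trans (crtDet-pairs [ 1# ] (divisors n)) (trans
    (*-cong (trans (prod-cong (divisors n) λ {x} _ → norm-1 (Φᵐ x)) (prod-ε (divisors n))) (sym (W≈pairs n)))
    (*-identityˡ _))

  module _ (p : ℕ) (p-prime : Prime p) where
    open PrimePowers p p-prime

    private
      q : ℕ → ℕ
      q k = p ℕ.^ k

    -- The disjunction `odd` covers the two situations in which the factors between layers do not
    -- depend on the order: for odd p the out-of-order norms are 1, and for m = 1 the divisors are
    -- powers of p, never out of order.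
    module _ (m : ℕ) .{{_ : NonZero m}} (p∤m : ¬ p ∣ m) (odd : sgn p ≈ - 1# ⊎ m ≡ 1) where
      private
        layer : ℕ → List ℕ
        layer k = map (q (suc k) ℕ.*_) (divisors m)
        layerᵐ : ℕ → Monic
        layerᵐ k = ∏ᵐ (map Φᵐ (layer k))
        M : ℕ → ℕ
        M k = q k ℕ.* m
        M≢0 : ∀ k → NonZero (M k)
        M≢0 k = ℕ.m*n≢0 (q k) m {{p^≢0 k}}

      ∣m⇒p∤ : ∀ {d} → d ∣ m → ¬ p ∣ d
      ∣m⇒p∤ d∣m p∣d = p∤m (∣-trans p∣d d∣m)

      divisor-1 : ∀ {d} → m ≡ 1 → d ∣ m → d ≡ 1
      divisor-1 ≡.refl d∣1 = ∣1⇒≡1 d∣1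

      layer≃geometric : ∀ k → ⟦ layerᵐ k ⟧ ≃ geometric p (M k)
      layer≃geometric k = monic-cancel {M k} {Xⁿ-1ᴾ (M k)} {⟦ layerᵐ k ⟧} {geometric p (M k)} (isMonic-Xⁿ-1ᴾ (M k) {{M≢0 k}}) (PR.begin
        ⟦ layerᵐ k ⟧ ⊗ Xⁿ-1ᴾ (M k)
          PR.≈⟨ P.*-cong (⟦∏ᵐ⟧ (layer k)) (X^n-1≃∏Φ (M k) {{M≢0 k}}) ⟩
        PP.prod Φᴾ (layer k) ⊗ PP.prod Φᴾ (divisors (M k))
          PR.≈⟨ P.*-comm (PP.prod Φᴾ (layer k)) (PP.prod Φᴾ (divisors (M k))) ⟩
        PP.prod Φᴾ (divisors (M k)) ⊗ PP.prod Φᴾ (layer k)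
          PR.≈⟨ PP.prod-++ Φᴾ (divisors (M k)) (layer k) ⟨
        PP.prod Φᴾ (divisors (M k) ++ layer k)            PR.≈⟨ PP.prod-↭ Φᴾ (divisors-p^ k m p∤m) ⟨
        PP.prod Φᴾ (divisors (M (suc k)))                 PR.≈⟨ X^n-1≃∏Φ (M (suc k)) {{M≢0 (suc k)}} ⟨
        Xⁿ-1ᴾ (M (suc k))                                 PR.≡⟨ ≡.cong Xⁿ-1ᴾ (ℕ.*-assoc p (q k) m) ⟩
        Xⁿ-1ᴾ (p ℕ.* M k)                                 PR.≈⟨ geometric-* p (M k) ⟩
        geometric p (M k) ⊗ Xⁿ-1ᴾ (M k) PR.∎)

      degree-layer : ∀ k → degree (layerᵐ k) ℕ.+ M k ≡ p ℕ.* M k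
      degree-layer k = isMonic-unique 1≉0
        (isMonic-⊗ (isMonic-⟦⟧ (layerᵐ k)) (isMonic-Xⁿ-1ᴾ (M k) {{M≢0 k}}))
        (isMonic-≃ (P.trans (geometric-* p (M k)) (P.*-congʳ {Xⁿ-1ᴾ (M k)} (P.sym (layer≃geometric k))))
          (isMonic-Xⁿ-1ᴾ (p ℕ.* M k) {{ℕ.m*n≢0 p (M k) {{p≢0}} {{M≢0 k}}}}))

      cross : ℕ → Carrier
      cross k = sgn (degree (layerᵐ k) ℕ.* M k) * fromℕ p ^ M k

      -- Either x < y, or x = pⁱd and y = pʲe with i ≠ j and d ≠ e.
      H-cross : ∀ k {x y} → x ∈ divisors (M k) → y ∈ layer k → H x y ≈ N y x
      H-cross k {x} {y} x∈ y∈ with divisor-p^ k m p∤m x∈ | ∈-map⁻ (q (suc k) ℕ.*_) y∈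
      ... | i , d , i≤k , d∣m , ≡.refl | e , e∈ , ≡.refl = compare (ℕ.<-cmp x y)
        where
        e∣m = ∈-divisors⁻ m e∈
        instance
          d≢0 : NonZero d
          d≢0 = ∣-nonZero d∣m
          e≢0 : NonZero e
          e≢0 = ∣-nonZero e∣m
        e≡d⇒x<y : e ≡ d → x < y
        e≡d⇒x<y ≡.refl = ℕ.*-monoˡ-< e (p^-mono (s≤s i≤k))
        compare : Tri (x < y) (x ≡ y) (y < x) → H x y ≈ N y x
        compare (tri< x<y _ _) = H-< x<y
        compare (tri≈ x≮y x≡y _) = contradiction (≡.subst (_∣ M k) x≡y (∈-divisors⁻ (M k) x∈)) λ y∣M →
          p∤m (*-cancelˡ-∣ (q k) {{p^≢0 k}} (≡.subst (_∣ M k) (ℕ.*-comm p (q k)) (∣-trans (m∣m*n e) y∣M)))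
        compare (tri> x≮y _ y<x) = reversed odd x≮y y<x
          where
          reversed : sgn p ≈ - 1# ⊎ m ≡ 1 → ¬ x < y → y < x → H x y ≈ N y x
          reversed (inj₂ m≡1) x≮y y<x = contradiction (e≡d⇒x<y (≡.trans (divisor-1 m≡1 e∣m) (≡.sym (divisor-1 m≡1 d∣m)))) x≮y
          reversed (inj₁ sgn-p) x≮y y<x = trans (H-> y<x) (trans
            (N-off-diagonal p p-prime sgn-p d e (∣m⇒p∤ d∣m) (∣m⇒p∤ e∣m) (x≮y ∘ e≡d⇒x<y ∘ ≡.sym) i (suc k) (ℕ.<⇒≢ (s≤s i≤k)))
            (sym (N-off-diagonal p p-prime sgn-p e d (∣m⇒p∤ e∣m) (∣m⇒p∤ d∣m) (x≮y ∘ e≡d⇒x<y) (suc k) i (ℕ.>⇒≢ (s≤s i≤k)))))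

      -- Multiplicativity in both arguments merges all norms between old divisors and the layer into
      -- one: that of X^M - 1 modulo (X^(pM) - 1)/(X^M - 1). After exchanging the two, the quotient
      -- is congruent to the constant p, of norm p^M.
      prod-cross : ∀ k → prod (λ x → prod (H x) (layer k)) (divisors (M k)) ≈ cross k
      prod-cross k = begin
        prod (λ x → prod (H x) (layer k)) (divisors (M k))
          ≈⟨ prod-cong (divisors (M k)) (λ x∈ → prod-cong (layer k) (H-cross k x∈)) ⟩
        prod (λ x → prod (λ y → N y x) (layer k)) (divisors (M k))
          ≈⟨ prod-swap (λ x y → N y x) (divisors (M k)) (layer k) ⟩
        prod (λ y → prod (N y) (divisors (M k))) (layer k)
          ≈⟨ prod-cong (layer k) (λ {y} _ → trans (sym (norm-prod (Φᵐ y) (divisors (M k))))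
               (norm-cong (Φᵐ y) (P.trans (P.sym (X^n-1≃∏Φ (M k) {{M≢0 k}})) (P.sym (⟦Xⁿ-1⟧ (M k) {{M≢0 k}}))))) ⟩
        prod (λ y → norm (Φᵐ y) ⟦ Xⁿ-1ᵐ (M k) ⟧) (layer k)   ≈⟨ norm-∏ᵐ (Xⁿ-1ᵐ (M k)) (layer k) ⟨
        norm (layerᵐ k) ⟦ Xⁿ-1ᵐ (M k) ⟧                     ≈⟨ norm-symmetric (layerᵐ k) (Xⁿ-1ᵐ (M k)) ⟩
        sgn (degree (layerᵐ k) ℕ.* degree (Xⁿ-1ᵐ (M k))) * norm (Xⁿ-1ᵐ (M k)) ⟦ layerᵐ k ⟧
          ≈⟨ *-cong (reflexive (≡.cong (λ n → sgn (degree (layerᵐ k) ℕ.* n)) degree≡)) (begin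
               norm (Xⁿ-1ᵐ (M k)) ⟦ layerᵐ k ⟧              ≈⟨ norm-cong (Xⁿ-1ᵐ (M k)) (layer≃geometric k) ⟩
               norm (Xⁿ-1ᵐ (M k)) (geometric p (M k))
                 ≈⟨ norm-modulo (Xⁿ-1ᵐ (M k)) {geometric p (M k)} {[ fromℕ p ]} (u ,
                      P.trans geo (P.+-congʳ {[ fromℕ p ]} (P.*-congˡ {u} (P.sym (⟦Xⁿ-1⟧ (M k) {{M≢0 k}}))))) ⟩
               norm (Xⁿ-1ᵐ (M k)) [ fromℕ p ]               ≈⟨ norm-[ fromℕ p ] (Xⁿ-1ᵐ (M k)) ⟩
               fromℕ p ^ degree (Xⁿ-1ᵐ (M k))               ≡⟨ ≡.cong (fromℕ p ^_) degree≡ ⟩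
               fromℕ p ^ M k                               ∎) ⟩
        cross k ∎
        where
        u = proj₁ (geometric-mod p (M k))
        geo = proj₂ (geometric-mod p (M k))
        degree≡ : degree (Xⁿ-1ᵐ (M k)) ≡ M k
        degree≡ = degree-Xⁿ-1 (M k) {{M≢0 k}}

      -- By `N-diagonal` each pair inside the layer supplies exactly what the power p^k of its
      -- factor lacks to become the power p^(k+1). For m = 1 there are no pairs.
      W-layer : ∀ k → W m ^ q k * pairs H (layer k) ≈ W m ^ q (suc k)
      W-layer k = begin
        W m ^ q k * pairs H (layer k)
          ≈⟨ *-cong (sym (pairs-^ H (q k) (divisors m))) (reflexive (pairs-map H (q (suc k) ℕ.*_) (divisors m))) ⟩
        pairs (λ x y → H x y ^ q k) (divisors m) * pairs (λ x y → H (q (suc k) ℕ.* x) (q (suc k) ℕ.* y)) (divisors m)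
          ≈⟨ pairs-∙ (λ x y → H x y ^ q k) (λ x y → H (q (suc k) ℕ.* x) (q (suc k) ℕ.* y)) (divisors m) ⟨
        pairs (λ x y → H x y ^ q k * H (q (suc k) ℕ.* x) (q (suc k) ℕ.* y)) (divisors m)
          ≈⟨ pairs-cong (divisors m) (divisors-sorted m) (λ x∈ y∈ → diagonal (∈-divisors⁻ m x∈) (∈-divisors⁻ m y∈)) ⟩
        pairs (λ x y → H x y ^ q (suc k)) (divisors m)  ≈⟨ pairs-^ H (q (suc k)) (divisors m) ⟩
        W m ^ q (suc k) ∎
        where
        diagonal : ∀ {x y} → x ∣ m → y ∣ m → x < y →
                   H x y ^ q k * H (q (suc k) ℕ.* x) (q (suc k) ℕ.* y) ≈ H x y ^ q (suc k)
        diagonal {x} {y} x∣m y∣m x<y = go odd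
          where
          go : sgn p ≈ - 1# ⊎ m ≡ 1 → H x y ^ q k * H (q (suc k) ℕ.* x) (q (suc k) ℕ.* y) ≈ H x y ^ q (suc k)
          go (inj₂ m≡1)   = contradiction (≡.trans (divisor-1 m≡1 x∣m) (≡.sym (divisor-1 m≡1 y∣m))) (ℕ.<⇒≢ x<y)
          go (inj₁ sgn-p) = trans
            (*-cong (^-congˡ (q k) (H-< x<y)) (H-< (ℕ.*-monoʳ-< (q (suc k)) {{p^≢0 (suc k)}} x<y)))
            (trans (N-diagonal p p-prime sgn-p y x {{∣-nonZero y∣m}} {{∣-nonZero x∣m}} (∣m⇒p∤ y∣m) (∣m⇒p∤ x∣m) (ℕ.>⇒≢ x<y) k)
              (sym (^-congˡ (q (suc k)) (H-< x<y))))

      crosses : ℕ → Carrier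
      crosses zero    = 1#
      crosses (suc k) = crosses k * cross k

      W-p^ : ∀ k → W (M k) ≈ W m ^ q k * crosses k
      W-p^ zero    = trans (reflexive (≡.cong W (ℕ.*-identityˡ m))) (sym (trans (*-identityʳ _) (*-identityʳ _)))
      W-p^ (suc k) = begin
        W (M (suc k))                              ≈⟨ pairs-↭ H H-sym (divisors-p^ k m p∤m) ⟩
        pairs H (divisors (M k) ++ layer k)        ≈⟨ pairs-++ H (divisors (M k)) (layer k) ⟩
        W (M k) * pairs H (layer k) * prod (λ x → prod (H x) (layer k)) (divisors (M k))
          ≈⟨ *-cong (*-congʳ (W-p^ k)) (prod-cross k) ⟩
        W m ^ q k * crosses k * pairs H (layer k) * cross k
          ≈⟨ solve 4 (λ a b c d → a :* b :* c :* d := a :* c :* (b :* d)) refl _ _ _ _ ⟩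
        W m ^ q k * pairs H (layer k) * (crosses k * cross k)  ≈⟨ *-congʳ (W-layer k) ⟩
        W m ^ q (suc k) * crosses (suc k)          ∎

  W-odd : ∀ p (p-prime : Prime p) → sgn p ≈ - 1# → ∀ m .{{_ : NonZero m}} → ¬ p ∣ m → ∀ k →
          W (p ℕ.^ k ℕ.* m) ≈ W m ^ (p ℕ.^ k) * fromℕ p ^ (repunit p k ℕ.* m)
  W-odd p p-prime sgn-p m p∤m k = trans (W-p^ p p-prime m p∤m (inj₁ sgn-p) k) (*-congˡ (go k))
    where
    cross≈ : ∀ k → cross p p-prime m p∤m (inj₁ sgn-p) k ≈ fromℕ p ^ (p ℕ.^ k ℕ.* m)
    cross≈ k = trans (*-congʳ sign) (*-identityˡ _)
      where
      M g : ℕ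
      M = p ℕ.^ k ℕ.* m
      g = degree (∏ᵐ (map Φᵐ (map (p ℕ.^ suc k ℕ.*_) (divisors m))))
      -- The degree g of the layer satisfies g + M = p M, hence g M + M² = p M², which has the
      -- parity of M² as p is odd; so g M is even.
      sign : sgn (g ℕ.* M) ≈ 1#
      sign = begin
        sgn (g ℕ.* M)                                   ≈⟨ *-identityʳ _ ⟨
        sgn (g ℕ.* M) * 1#                              ≈⟨ *-congˡ (sgn² (M ℕ.* M)) ⟨
        sgn (g ℕ.* M) * (sgn (M ℕ.* M) * sgn (M ℕ.* M)) ≈⟨ *-assoc _ _ _ ⟨
        sgn (g ℕ.* M) * sgn (M ℕ.* M) * sgn (M ℕ.* M)
          ≈⟨ *-congʳ (trans (sym (sgn-+ (g ℕ.* M) (M ℕ.* M))) (reflexive (≡.cong sgn (≡.trans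
               (≡.sym (ℕ.*-distribʳ-+ M g M)) (≡.trans (≡.cong (ℕ._* M) (degree-layer p p-prime m p∤m (inj₁ sgn-p) k)) (ℕ.*-assoc p M M)))))) ⟩
        sgn (p ℕ.* (M ℕ.* M)) * sgn (M ℕ.* M)           ≈⟨ *-congʳ (sgn-*-odd (M ℕ.* M) {p} sgn-p) ⟩
        sgn (M ℕ.* M) * sgn (M ℕ.* M)                   ≈⟨ sgn² (M ℕ.* M) ⟩
        1#                                              ∎
    go : ∀ k → crosses p p-prime m p∤m (inj₁ sgn-p) k ≈ fromℕ p ^ (repunit p k ℕ.* m)
    go zero    = refl
    go (suc k) = trans (*-cong (go k) (cross≈ k)) (trans (sym (^-homo-* (fromℕ p) (repunit p k ℕ.* m) (p ℕ.^ k ℕ.* m)))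
      (reflexive (≡.cong (fromℕ p ^_) (≡.sym (ℕ.*-distribʳ-+ m (repunit p k) (p ℕ.^ k))))))

  W-1 : W 1 ≈ 1#
  W-1 = *-identityˡ 1#

  -- Layer k has degree M = 2^k and contributes the sign of M², which is negative for k = 0 alone.
  -- Thus exactly one minus sign survives.
  W-2 : ∀ (2-prime : Prime 2) k → W (2 ℕ.^ suc k) ≈ - (fromℕ 2 ^ repunit 2 (suc k))
  W-2 2-prime k = begin
    W (2 ℕ.^ suc k)                            ≡⟨ ≡.cong W (ℕ.*-identityʳ (2 ℕ.^ suc k)) ⟨
    W (2 ℕ.^ suc k ℕ.* 1)                      ≈⟨ W-p^ 2 2-prime 1 2∤1 (inj₂ ≡.refl) (suc k) ⟩
    W 1 ^ (2 ℕ.^ suc k) * crosses 2 2-prime 1 2∤1 (inj₂ ≡.refl) (suc k)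
      ≈⟨ *-cong (trans (^-congˡ (2 ℕ.^ suc k) W-1) (1^ (2 ℕ.^ suc k))) (go k) ⟩
    1# * - (fromℕ 2 ^ repunit 2 (suc k))         ≈⟨ *-identityˡ _ ⟩
    - (fromℕ 2 ^ repunit 2 (suc k))              ∎
    where
    2∤1 : ¬ 2 ∣ 1
    2∤1 2∣1 with () ← ∣1⇒≡1 2∣1
    cross≈ : ∀ k → cross 2 2-prime 1 2∤1 (inj₂ ≡.refl) k ≈ sgn (2 ℕ.^ k) * fromℕ 2 ^ (2 ℕ.^ k)
    cross≈ k = *-cong sign (reflexive (≡.cong (fromℕ 2 ^_) (ℕ.*-identityʳ (2 ℕ.^ k))))
      where
      M g : ℕ
      M = 2 ℕ.^ k ℕ.* 1
      g = degree (∏ᵐ (map Φᵐ (map (2 ℕ.^ suc k ℕ.*_) (divisors 1))))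
      g≡M : g ≡ M
      g≡M = ℕ.+-cancelʳ-≡ M g M (≡.trans (degree-layer 2 2-prime 1 2∤1 (inj₂ ≡.refl) k) (≡.cong (M ℕ.+_) (ℕ.+-identityʳ M)))
      sgn-square : ∀ n → sgn (n ℕ.* n) ≈ sgn n
      sgn-square zero    = refl
      sgn-square (suc n) = -‿cong (trans (reflexive (≡.cong (λ x → sgn (n ℕ.+ x)) (ℕ.*-suc n n)))
        (trans (sgn-+ n (n ℕ.+ n ℕ.* n)) (trans (*-congˡ (sgn-+ n (n ℕ.* n))) (trans (sym (*-assoc _ _ _))
        (trans (*-congʳ (sgn² n)) (trans (*-identityˡ _) (sgn-square n)))))))
      sign : sgn (g ℕ.* M) ≈ sgn (2 ℕ.^ k)
      sign = trans (reflexive (≡.cong (λ g → sgn (g ℕ.* M)) g≡M)) (trans (sgn-square M) (reflexive (≡.cong sgn (ℕ.*-identityʳ (2 ℕ.^ k)))))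
    go : ∀ k → crosses 2 2-prime 1 2∤1 (inj₂ ≡.refl) (suc k) ≈ - (fromℕ 2 ^ repunit 2 (suc k))
    go zero    = trans (*-identityˡ _) (trans (cross≈ 0) (trans (sym (-‿distribˡ-* _ _)) (-‿cong (*-identityˡ _))))
    go (suc k) = begin
      crosses 2 2-prime 1 2∤1 (inj₂ ≡.refl) (suc k) * cross 2 2-prime 1 2∤1 (inj₂ ≡.refl) (suc k)
        ≈⟨ *-cong (go k) (trans (cross≈ (suc k)) (trans (*-congʳ (trans (sgn-+ (2 ℕ.^ k) (2 ℕ.^ k ℕ.+ 0))
             (trans (*-congˡ (reflexive (≡.cong sgn (ℕ.+-identityʳ (2 ℕ.^ k))))) (sgn² (2 ℕ.^ k))))) (*-identityˡ _))) ⟩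
      - (fromℕ 2 ^ repunit 2 (suc k)) * fromℕ 2 ^ (2 ℕ.^ suc k)   ≈⟨ -‿distribˡ-* _ _ ⟨
      - (fromℕ 2 ^ repunit 2 (suc k) * fromℕ 2 ^ (2 ℕ.^ suc k))
        ≈⟨ -‿cong (sym (^-homo-* (fromℕ 2) (repunit 2 (suc k)) (2 ℕ.^ suc k))) ⟩
      - (fromℕ 2 ^ repunit 2 (suc (suc k))) ∎

-- The matrix Aₙ

ℤ-ring : CommutativeRing _ _
ℤ-ring = ℤ.+-*-commutativeRing

open FromNat ℤ-ring using (fromℕ)

fromℕ≡+ : ∀ n → fromℕ n ≡ + n
fromℕ≡+ zero    = ≡.refl
fromℕ≡+ (suc n) = ≡.cong (λ x → 1ℤ ℤ.+ x) (fromℕ≡+ n)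

ℤ-isDomain : IsCharZeroDomain ℤ-ring
ℤ-isDomain = record
  { domain  = λ {x} xy≡0 x≢0 → resolve x≢0 (ℤ.i*j≡0⇒i≡0∨j≡0 x xy≡0)
  ; ≈0?     = ℤ._≟ 0ℤ
  ; fromℕ≉0 = λ n eq → ℕ.≢-nonZero⁻¹ n (ℤ.+-injective (≡.trans (≡.sym (fromℕ≡+ n)) eq))
  }
  where
  resolve : ∀ {x y} → x ≢ 0ℤ → x ≡ 0ℤ ⊎ y ≡ 0ℤ → y ≡ 0ℤ
  resolve x≢0 (inj₁ x≡0) = contradiction x≡0 x≢0
  resolve x≢0 (inj₂ y≡0) = y≡0

open ℤ[X] using (Monic; ⟦_⟧; monic; degree; 1ᵐ; ∏ᵐ; _÷ᵐ_; X^; coeff; _mod_)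
open Polys ℤ-ring using (isMonic-⟦⟧; isMonic-≃; isMonic-⊗; isMonic-unique; isMonic-X^; IsMonic; λ-cong; ⊗-identityˡ; rem)
open Det ℤ-ring using (D; D-cong; det≈D; sgn; sgn-+)
open Norms ℤ-ring using (norm; rows; row; degrees; crtDet; row-linear; sgn²)

Φ-unfold : ∀ n → Φ n ≡ Xⁿ-1 n ÷ᵐ ∏ᵐ (tabulate λ (d : Fin n) → if does (toℕ d ∣? n) then Φ (toℕ d) else 1ᵐ)
Φ-unfold n = WF.FixPoint.unfold-wfRec <-wellFounded (λ _ → Monic)
  (λ n rec → Xⁿ-1 n ÷ᵐ ∏ᵐ (tabulate λ (d : Fin n) → if does (toℕ d ∣? n) then rec (toℕ<n d) else 1ᵐ))
  (λ n eq → ≡.cong (λ l → Xⁿ-1 n ÷ᵐ ∏ᵐ l) (List.tabulate-cong λ d →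
    ≡.cong (λ f → if does (toℕ d ∣? n) then f else 1ᵐ) (eq (toℕ<n d)))) {n}

ℤ-family : CyclotomicFamily ℤ-ring
ℤ-family = record
  { isDomain = ℤ-isDomain ; Xⁿ-1ᵐ = Xⁿ-1 ; Xⁿ-1-suc = λ _ → ≡.refl ; Φᵐ = Φ ; Φ-unfold = Φ-unfold }

open Cyclotomic ℤ-family
open CyclotomicNorms ℤ-family using (N; sgn-*-odd)
open Evaluation ℤ-family

private
  module ∑ℕ = BigProduct ℕ.+-0-commutativeMonoid
  module Pℤ = CommutativeRing (Polys.polyRing ℤ-ring)
  module PP = BigProduct Pℤ.*-commutativeMonoid

∑-degree : ∀ n .{{_ : NonZero n}} → ∑ℕ.prod (degree ∘ Φ) (divisors n) ≡ n
∑-degree n = isMonic-unique (IsCharZeroDomain.1≉0 ℤ-isDomain) (product-monic (divisors n))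
  (isMonic-≃ (X^n-1≃∏Φ n) (isMonic-Xⁿ-1ᴾ n))
  where
  product-monic : ∀ l → IsMonic (∑ℕ.prod (degree ∘ Φ) l) (PP.prod Φᴾ l)
  product-monic []      = isMonic-X^ 0
  product-monic (d ∷ l) = isMonic-⊗ (isMonic-⟦⟧ (Φ d)) (product-monic l)

length-concatMap : ∀ {a b} {A : Set a} {B : Set b} (h : A → List B) l →
                   length (concatMap h l) ≡ ∑ℕ.prod (length ∘ h) l
length-concatMap h []      = ≡.refl
length-concatMap h (x ∷ l) = ≡.trans (List.length-++ (h x)) (≡.cong (length (h x) ℕ.+_) (length-concatMap h l))

∑-φ : ∀ n → ∑ℕ.prod φ (divisors n) ≡ n
∑-φ n = ≡.trans (∑ℕ.prod-cong (divisors n) λ {d} _ →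
    ≡.sym (≡.trans (List.length-map (d ,_) (upTo (φ d))) (List.length-upTo (φ d))))
  (≡.trans (≡.sym (length-concatMap (λ d → map (d ,_) (upTo (φ d))) (divisors n))) (length-basis n))

-- Both the degree and φ sum to n over the divisors of n, so induction cancels the proper divisors.
-- This aligns the blocks of `basis`, sized by φ, with the coordinates modulo Φ_d.
degree-Φ : ∀ n → NonZero n → degree (Φ n) ≡ φ n
degree-Φ = <-rec (λ n → NonZero n → degree (Φ n) ≡ φ n) λ n ih n≢0 →
  ℕ.+-cancelʳ-≡ (∑ℕ.prod φ (properDivisors n)) (degree (Φ n)) (φ n) (begin
    degree (Φ n) ℕ.+ ∑ℕ.prod φ (properDivisors n)
      ≡⟨ ≡.cong (degree (Φ n) ℕ.+_) (∑ℕ.prod-cong (properDivisors n) λ d∈ →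
           let d∣n , d<n = ∈-properDivisors⁻ n d∈ in ih d<n (∣-nonZero {{n≢0}} d∣n)) ⟨
    degree (Φ n) ℕ.+ ∑ℕ.prod (degree ∘ Φ) (properDivisors n)
      ≡⟨ ∑ℕ.prod-↭ (degree ∘ Φ) (divisors-↭-properDivisors n {{n≢0}}) ⟨
    ∑ℕ.prod (degree ∘ Φ) (divisors n)  ≡⟨ ∑-degree n {{n≢0}} ⟩
    n                                  ≡⟨ ∑-φ n ⟨
    ∑ℕ.prod φ (divisors n)             ≡⟨ ∑ℕ.prod-↭ φ (divisors-↭-properDivisors n {{n≢0}}) ⟩
    φ n ℕ.+ ∑ℕ.prod φ (properDivisors n) ∎)
  where
  open ≡.≡-Reasoning
  ∣-nonZero : ∀ {d n} .{{_ : NonZero n}} → d ∣ n → NonZero d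
  ∣-nonZero {n = n} d∣n = ℕ.≢-nonZero λ { ≡.refl → ℕ.≢-nonZero⁻¹ n (0∣⇒≡0 d∣n) }

nth-map-lookup : ∀ {a b} {A : Set a} {B : Set b} (d : B) (f : A → B) xs i →
                 nth d (map f xs) (toℕ i) ≡ f (lookup xs i)
nth-map-lookup d f (x ∷ xs) Fin.zero    = ≡.refl
nth-map-lookup d f (x ∷ xs) (Fin.suc i) = nth-map-lookup d f xs i

module _ (n : ℕ) .{{_ : NonZero n}} where
  private
    coordinate : ℕ × ℕ → ℤ[X].Poly → ℤ
    coordinate (d , k) = rem (Φ d) k

  rows≡ : rows (map Φ (divisors n)) ≡ map coordinate (basis n)
  rows≡ = go (divisors n) λ {d} d∈ → degree-Φ d (ℕ.≢-nonZero λ { ≡.refl →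
    ℕ.≢-nonZero⁻¹ n (0∣⇒≡0 (∈-divisors⁻ n d∈)) })
    where
    go : ∀ l → (∀ {d} → d ∈ l → degree (Φ d) ≡ φ d) →
         rows (map Φ l) ≡ map coordinate (concatMap (λ d → map (d ,_) (upTo (φ d))) l)
    go []      eq = ≡.refl
    go (d ∷ l) eq = ≡.trans
      (≡.cong₂ _++_ (≡.trans (≡.cong (λ m → map (rem (Φ d)) (upTo m)) (eq (here ≡.refl))) (List.map-∘ (upTo (φ d)))) (go l (eq ∘ there)))
      (≡.sym (List.map-++ coordinate (map (d ,_) (upTo (φ d))) _))

  degrees≡ : degrees (map Φ (divisors n)) ≡ n
  degrees≡ = ≡.trans (go (divisors n)) (∑-degree n)
    where
    go : ∀ l → degrees (map Φ l) ≡ ∑ℕ.prod (degree ∘ Φ) l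
    go []      = ≡.refl
    go (d ∷ l) = ≡.cong (degree (Φ d) ℕ.+_) (go l)

  det≡W : det (A n) ≡ W n
  det≡W = begin
    det (A n)
      ≡⟨ det≈D n {A n} {λ i j → row (map Φ (divisors n)) i (X^ j)} entries ⟩
    D n (λ i j → row (map Φ (divisors n)) i (X^ j))
      ≡⟨ D-cong n (λ i j i<n _ → λ-cong (row-linear (map Φ (divisors n)) i (≡.subst (i <_) (≡.sym degrees≡) i<n))
           (Pℤ.sym (⊗-identityˡ (X^ j)))) ⟩
    D n (λ i j → row (map Φ (divisors n)) i ([ 1ℤ ] ⊗ X^ j))
      ≡⟨ ≡.cong (λ m → D m (λ i j → row (map Φ (divisors n)) i ([ 1ℤ ] ⊗ X^ j))) degrees≡ ⟨
    crtDet [ 1ℤ ] (map Φ (divisors n))   ≡⟨ crtDet≈W n ⟩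
    W n                                  ∎
    where
    open ≡.≡-Reasoning
    open ℤ[X] using (_⊗_)
    entries : ∀ i j → A n i j ≡ row (map Φ (divisors n)) (toℕ i) (X^ (toℕ j))
    entries i j = ≡.sym (≡.trans
      (≡.cong₂ (λ l k → nth (λ _ → 0ℤ) l k (X^ (toℕ j))) rows≡ (≡.sym (Fin.toℕ-cast (≡.sym (length-basis n)) i)))
      (≡.cong (λ r → r (X^ (toℕ j))) (nth-map-lookup (λ _ → 0ℤ) coordinate (basis n) (cast (≡.sym (length-basis n)) i))))

-- Prime factorisations

product-tabulate-punchIn : ∀ {r} (f : Fin (suc r) → ℕ) i →
                           product (tabulate f) ≡ f i ℕ.* product (tabulate (f ∘ punchIn i))
product-tabulate-punchIn         f Fin.zero    = ≡.refl
product-tabulate-punchIn {suc r} f (Fin.suc i) = ≡.trans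
  (≡.cong (f Fin.zero ℕ.*_) (product-tabulate-punchIn (f ∘ Fin.suc) i))
  (solveℕ 3 (λ x y z → x :*: (y :*: z) :=: y :*: (x :*: z)) ≡.refl
    (f Fin.zero) (f (Fin.suc i)) (product (tabulate (f ∘ Fin.suc ∘ punchIn i))))

product-tabulate-cong : ∀ {r} {f g : Fin r → ℕ} → (∀ i → f i ≡ g i) → product (tabulate f) ≡ product (tabulate g)
product-tabulate-cong eq = ≡.cong product (List.tabulate-cong eq)

product-tabulate-^ : ∀ {r} (f : Fin r → ℕ) n → product (tabulate f) ℕ.^ n ≡ product (tabulate (λ i → f i ℕ.^ n))
product-tabulate-^ {zero}  f n = ℕ.^-zeroˡ n
product-tabulate-^ {suc r} f n = ≡.trans (^-distribʳ-* n (f Fin.zero) (product (tabulate (f ∘ Fin.suc))))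
  (≡.cong (f Fin.zero ℕ.^ n ℕ.*_) (product-tabulate-^ (f ∘ Fin.suc) n))
  where
  ^-distribʳ-* : ∀ n a b → (a ℕ.* b) ℕ.^ n ≡ a ℕ.^ n ℕ.* b ℕ.^ n
  ^-distribʳ-* zero    a b = ≡.refl
  ^-distribʳ-* (suc n) a b = ≡.trans (≡.cong (a ℕ.* b ℕ.*_) (^-distribʳ-* n a b))
    (solveℕ 4 (λ a b c d → a :*: b :*: (c :*: d) :=: a :*: c :*: (b :*: d)) ≡.refl a b (a ℕ.^ n) (b ℕ.^ n))

factor∣product : ∀ {r} (f : Fin r → ℕ) i → f i ∣ product (tabulate f)
factor∣product {suc r} f i = ≡.subst (f i ∣_) (≡.sym (product-tabulate-punchIn f i)) (m∣m*n _)

prime∣prime^ : ∀ {p q} → Prime p → Prime q → ∀ k → p ∣ q ℕ.^ k → p ≡ q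
prime∣prime^ {p} {q} pp pq zero    p∣1 = contradiction (∣1⇒≡1 p∣1) (ℕ.nonTrivial⇒≢1 {p} {{prime⇒nonTrivial pp}})
prime∣prime^ {p} {q} pp pq (suc k) p∣ with euclidsLemma q (q ℕ.^ k) pp p∣
... | inj₂ p∣q^k = prime∣prime^ pp pq k p∣q^k
... | inj₁ p∣q with prime⇒irreducible pq p∣q
...   | inj₁ p≡1 = contradiction p≡1 (ℕ.nonTrivial⇒≢1 {p} {{prime⇒nonTrivial pp}})
...   | inj₂ p≡q = p≡q

prime∤product : ∀ {p r} (f : Fin r → ℕ) → Prime p → (∀ i → ¬ p ∣ f i) → ¬ p ∣ product (tabulate f)
prime∤product {p} {zero}  f pp p∤f p∣1 = ℕ.nonTrivial⇒≢1 {p} {{prime⇒nonTrivial pp}} (∣1⇒≡1 p∣1)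
prime∤product {p} {suc r} f pp p∤f p∣ with euclidsLemma (f Fin.zero) _ pp p∣
... | inj₁ p∣f₀ = p∤f Fin.zero p∣f₀
... | inj₂ p∣fs = prime∤product (f ∘ Fin.suc) pp (p∤f ∘ Fin.suc) p∣fs

repunit-spec : ∀ p k → repunit (suc p) k ℕ.* p ℕ.+ 1 ≡ suc p ℕ.^ k
repunit-spec p zero    = ≡.refl
repunit-spec p (suc k) = ≡.trans
  (solveℕ 3 (λ r q p → (r :+: q) :*: p :+: conℕ 1 :=: (r :*: p :+: conℕ 1) :+: p :*: q) ≡.refl
    (repunit (suc p) k) (suc p ℕ.^ k) p)
  (≡.cong (ℕ._+ p ℕ.* suc p ℕ.^ k) (repunit-spec p k))

-- Read q = p^α, d = p - 1, r = 1 + p + ... + p^(α-1) and c = n/p^α. Then q c - c = r d c, so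
-- neither division in `exponent` leaves a remainder.
exact-quotients : ∀ q d r c .{{_ : NonZero q}} .{{_ : NonZero d}} → r ℕ.* d ℕ.+ 1 ≡ q →
                  (q ℕ.* c ∸ q ℕ.* c ℕ./ q) ℕ./ d ≡ r ℕ.* c
exact-quotients q d r c ≡.refl = begin
  (q ℕ.* c ∸ q ℕ.* c ℕ./ q) ℕ./ d
    ≡⟨ ≡.cong (λ m → (q ℕ.* c ∸ m) ℕ./ d) (≡.trans (≡.cong (ℕ._/ q) (ℕ.*-comm q c)) (ℕ.m*n/n≡m c q)) ⟩
  (q ℕ.* c ∸ c) ℕ./ d
    ≡⟨ ≡.cong (λ m → (m ∸ c) ℕ./ d) (solveℕ 3 (λ r d c → (r :*: d :+: conℕ 1) :*: c :=: r :*: c :*: d :+: c)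
         ≡.refl r d c) ⟩
  (r ℕ.* c ℕ.* d ℕ.+ c ∸ c) ℕ./ d   ≡⟨ ≡.cong (ℕ._/ d) (ℕ.m+n∸n≡m (r ℕ.* c ℕ.* d) c) ⟩
  r ℕ.* c ℕ.* d ℕ./ d               ≡⟨ ℕ.m*n/n≡m (r ℕ.* c) d ⟩
  r ℕ.* c ∎
  where open ≡.≡-Reasoning

exponent-spec : ∀ n p α (p-prime : Prime p) c → n ≡ p ℕ.^ α ℕ.* c → exponent n p α p-prime ≡ repunit p α ℕ.* c
exponent-spec _ zero α p-prime c ≡.refl with () ← prime⇒nonZero p-prime
exponent-spec _ p@(suc p-1) α p-prime c ≡.refl = exact-quotients (p ℕ.^ α) p-1 (repunit p α) c
  {{ℕ.m^n≢0 p α}} {{ℕ.>-nonZero (ℕ.s≤s⁻¹ (ℕ.nonTrivial⇒n>1 p {{prime⇒nonTrivial p-prime}}))}} (repunit-spec p-1 α)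

-- Attaching a further prime power q to n raises the earlier part of the product to the power q;
-- this is the matching change of its exponents.
exponent-* : ∀ q n p α (p-prime : Prime p) → p ℕ.^ α ∣ n → exponent (q ℕ.* n) p α p-prime ≡ exponent n p α p-prime ℕ.* q
exponent-* q n p α p-prime (divides c n≡) = begin
  exponent (q ℕ.* n) p α p-prime
    ≡⟨ exponent-spec (q ℕ.* n) p α p-prime (c ℕ.* q) (≡.trans (≡.cong (q ℕ.*_) n≡)
         (solveℕ 3 (λ q c x → q :*: (c :*: x) :=: x :*: (c :*: q)) ≡.refl q c (p ℕ.^ α))) ⟩
  repunit p α ℕ.* (c ℕ.* q)  ≡⟨ ℕ.*-assoc (repunit p α) c q ⟨
  repunit p α ℕ.* c ℕ.* q    ≡⟨ ≡.cong (ℕ._* q) (exponent-spec n p α p-prime c (≡.trans n≡ (ℕ.*-comm c (p ℕ.^ α)))) ⟨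
  exponent n p α p-prime ℕ.* q ∎
  where open ≡.≡-Reasoning

parity : ∀ n → (2 ∣ n × sgn n ≡ 1ℤ) ⊎ (2 ∣ suc n × sgn n ≡ -1ℤ)
parity zero    = inj₁ (2 ∣0 , ≡.refl)
parity (suc n) with parity n
... | inj₁ (2∣n , eq) = inj₂ (∣m∣n⇒∣m+n (∣-refl {2}) 2∣n , ≡.cong ℤ.-_ eq)
... | inj₂ (2∣n , eq) = inj₁ (2∣n , ≡.cong ℤ.-_ eq)

odd-prime-sgn : ∀ {p} → Prime p → p ≢ 2 → sgn p ≡ -1ℤ
odd-prime-sgn {p} p-prime p≢2 with parity p
... | inj₂ (_ , eq) = eq
... | inj₁ (2∣p , _) with prime⇒irreducible p-prime 2∣p
...   | inj₂ 2≡p = contradiction (≡.sym 2≡p) p≢2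

sgn-odd-^ : ∀ {p} → sgn p ≡ -1ℤ → ∀ α m → sgn (p ℕ.^ α ℕ.* m) ≡ sgn m
sgn-odd-^ {p} sgn-p zero    m = ≡.cong sgn (ℕ.*-identityˡ m)
sgn-odd-^ {p} sgn-p (suc α) m = ≡.trans (≡.cong sgn (ℕ.*-assoc p (p ℕ.^ α) m))
  (≡.trans (sgn-*-odd (p ℕ.^ α ℕ.* m) {p} sgn-p) (sgn-odd-^ {p} sgn-p α m))

sgn-even : ∀ x → sgn (2 ℕ.* x) ≡ 1ℤ
sgn-even x = ≡.trans (sgn-+ x (x ℕ.+ 0)) (≡.trans (≡.cong (λ y → sgn x ℤ.* sgn y) (ℕ.+-identityʳ x)) (sgn² x))

sgn-pred : ∀ n .{{_ : NonZero n}} → -1ℤ ℤ.^ (n ∸ 1) ≡ ℤ.- sgn n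
sgn-pred (suc n) = ≡.trans (go n) (≡.sym (ℤ.neg-involutive (sgn n)))
  where
  go : ∀ n → -1ℤ ℤ.^ n ≡ sgn n
  go zero    = ≡.refl
  go (suc n) = ≡.trans (ℤ.-1*i≡-i _) (≡.cong ℤ.-_ (go n))

open import Algebra.Properties.Semiring.Exp (CommutativeRing.semiring ℤ-ring) using ()
  renaming (_^_ to _^ℤ_; ^-congˡ to ^ℤ-congˡ; ^-assocʳ to ^ℤ-assocʳ)
open import Algebra.Properties.CommutativeSemiring.Exp (CommutativeRing.commutativeSemiring ℤ-ring) using ()
  renaming (^-distrib-* to ^ℤ-distrib-*)

pos-^ : ∀ a n → (+ a) ^ℤ n ≡ + (a ℕ.^ n)
pos-^ a zero    = ≡.refl
pos-^ a (suc n) = ≡.trans (≡.cong (+ a ℤ.*_) (pos-^ a n)) (≡.sym (ℤ.pos-* a (a ℕ.^ n)))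

fromℕ-^ : ∀ a n → fromℕ a ^ℤ n ≡ + (a ℕ.^ n)
fromℕ-^ a n = ≡.trans (≡.cong (_^ℤ n) (fromℕ≡+ a)) (pos-^ a n)

module _ where
  open ≡.≡-Reasoning

  -- The odd primes are peeled off one at a time by `W-odd`, the power of 2 staying in the cofactor.
  -- Each step raises the value of that cofactor to the power p^α, so W (2^b) ends up with the
  -- exponent o, the whole odd part.
  W-odd-product : ∀ b r (p α : Fin r → ℕ) (p-prime : ∀ i → Prime (p i)) → Injective _≡_ _≡_ p →
    (∀ i → p i ≢ 2) → let o = product (tabulate (λ i → p i ℕ.^ α i)); n = o ℕ.* 2 ℕ.^ b in
    W n ≡ W (2 ℕ.^ b) ^ℤ o ℤ.* + product (tabulate (λ i → p i ℕ.^ exponent n (p i) (α i) (p-prime i)))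
  W-odd-product b zero    p α p-prime inj p≢2 = ≡.trans (≡.cong W (ℕ.*-identityˡ (2 ℕ.^ b)))
    (≡.sym (≡.trans (ℤ.*-identityʳ _) (ℤ.*-identityʳ _)))
  W-odd-product b (suc r) p α p-prime inj p≢2 = begin
    W (p₀ ℕ.^ α₀ ℕ.* o′ ℕ.* B)         ≡⟨ ≡.cong W n≡ ⟩
    W (q ℕ.* m)                        ≡⟨ W-odd p₀ (p-prime Fin.zero) (odd-prime-sgn (p-prime Fin.zero) (p≢2 Fin.zero)) m p∤m α₀ ⟩
    W m ^ℤ q ℤ.* fromℕ p₀ ^ℤ (repunit p₀ α₀ ℕ.* m)
      ≡⟨ ≡.cong₂ ℤ._*_
           (≡.trans (^ℤ-congˡ q (W-odd-product b r (p ∘ Fin.suc) (α ∘ Fin.suc) (p-prime ∘ Fin.suc) (Fin.suc-injective ∘ inj) (p≢2 ∘ Fin.suc)))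
             (^ℤ-distrib-* (W B ^ℤ o′) (+ product (tabulate g)) q))
           (fromℕ-^ p₀ (repunit p₀ α₀ ℕ.* m)) ⟩
    (W B ^ℤ o′) ^ℤ q ℤ.* (+ product (tabulate g)) ^ℤ q ℤ.* + (p₀ ℕ.^ (repunit p₀ α₀ ℕ.* m))
      ≡⟨ ≡.cong₂ (λ x y → x ℤ.* y ℤ.* + (p₀ ℕ.^ (repunit p₀ α₀ ℕ.* m)))
           (≡.trans (^ℤ-assocʳ (W B) o′ q) (≡.cong (W B ^ℤ_) (ℕ.*-comm o′ q)))
           (≡.trans (pos-^ (product (tabulate g)) q) (≡.cong +_ (≡.trans (product-tabulate-^ g q) (product-tabulate-cong rest)))) ⟩
    W B ^ℤ (q ℕ.* o′) ℤ.* + product (tabulate (h ∘ Fin.suc)) ℤ.* + (p₀ ℕ.^ (repunit p₀ α₀ ℕ.* m))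
      ≡⟨ ℤ.*-assoc (W B ^ℤ (q ℕ.* o′)) _ _ ⟩
    W B ^ℤ (q ℕ.* o′) ℤ.* (+ product (tabulate (h ∘ Fin.suc)) ℤ.* + (p₀ ℕ.^ (repunit p₀ α₀ ℕ.* m)))
      ≡⟨ ≡.cong (W B ^ℤ (q ℕ.* o′) ℤ.*_) (≡.trans (ℤ.*-comm (+ product (tabulate (h ∘ Fin.suc))) _)
           (≡.trans (≡.sym (ℤ.pos-* (p₀ ℕ.^ (repunit p₀ α₀ ℕ.* m)) (product (tabulate (h ∘ Fin.suc)))))
             (≡.cong (λ e → + (p₀ ℕ.^ e ℕ.* product (tabulate (h ∘ Fin.suc)))) (≡.sym (exponent-spec n p₀ α₀ (p-prime Fin.zero) m n≡))))) ⟩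
    W B ^ℤ (q ℕ.* o′) ℤ.* + (h Fin.zero ℕ.* product (tabulate (h ∘ Fin.suc))) ∎
    where
    p₀ = p Fin.zero
    α₀ = α Fin.zero
    B q o′ m n : ℕ
    B = 2 ℕ.^ b
    q = p₀ ℕ.^ α₀
    o′ = product (tabulate (λ i → p (Fin.suc i) ℕ.^ α (Fin.suc i)))
    m = o′ ℕ.* B
    n = q ℕ.* o′ ℕ.* B
    n≡ : n ≡ q ℕ.* m
    n≡ = ℕ.*-assoc q o′ B
    g : Fin r → ℕ
    g i = p (Fin.suc i) ℕ.^ exponent m (p (Fin.suc i)) (α (Fin.suc i)) (p-prime (Fin.suc i))
    h : Fin (suc r) → ℕ
    h i = p i ℕ.^ exponent n (p i) (α i) (p-prime i)
    rest : ∀ i → g i ℕ.^ q ≡ h (Fin.suc i)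
    rest i = ≡.trans (ℕ.^-*-assoc (p (Fin.suc i)) (exponent m (p (Fin.suc i)) (α (Fin.suc i)) (p-prime (Fin.suc i))) q) (≡.cong (p (Fin.suc i) ℕ.^_) (≡.trans
      (≡.sym (exponent-* q m (p (Fin.suc i)) (α (Fin.suc i)) (p-prime (Fin.suc i))
        (∣-trans (factor∣product (λ i → p (Fin.suc i) ℕ.^ α (Fin.suc i)) i) (m∣m*n B))))
      (≡.cong (λ n → exponent n (p (Fin.suc i)) (α (Fin.suc i)) (p-prime (Fin.suc i))) (≡.sym n≡))))
    p∤m : ¬ p₀ ∣ m
    p∤m p∣m with euclidsLemma o′ B (p-prime Fin.zero) p∣m
    ... | inj₂ p∣B = p≢2 Fin.zero (prime∣prime^ (p-prime Fin.zero) prime[2] b p∣B)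
    ... | inj₁ p∣o = prime∤product (λ i → p (Fin.suc i) ℕ.^ α (Fin.suc i)) (p-prime Fin.zero)
      (λ i p∣ → Fin.0≢1+n (inj (prime∣prime^ (p-prime Fin.zero) (p-prime (Fin.suc i)) (α (Fin.suc i)) p∣))) p∣o
    instance
      m≢0 : NonZero m
      m≢0 = ℕ.≢-nonZero λ m≡0 → p∤m (≡.subst (p₀ ∣_) (≡.sym m≡0) (p₀ ∣0))

  sgn-odd-product : ∀ r (p α : Fin r → ℕ) → (∀ i → sgn (p i) ≡ -1ℤ) → sgn (product (tabulate (λ i → p i ℕ.^ α i))) ≡ -1ℤ
  sgn-odd-product zero    p α sgn-p = ≡.refl
  sgn-odd-product (suc r) p α sgn-p = ≡.trans
    (sgn-odd-^ {p Fin.zero} (sgn-p Fin.zero) (α Fin.zero) (product (tabulate (λ i → p (Fin.suc i) ℕ.^ α (Fin.suc i)))))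
    (sgn-odd-product r (p ∘ Fin.suc) (α ∘ Fin.suc) (sgn-p ∘ Fin.suc))

  -1^ : ∀ n → -1ℤ ^ℤ n ≡ sgn n
  -1^ zero    = ≡.refl
  -1^ (suc n) = ≡.trans (ℤ.-1*i≡-i _) (≡.cong ℤ.-_ (-1^ n))

  -- The sign is the parity of n - 1. Without the prime 2, n is odd and no sign arises. Otherwise
  -- `punchIn` sets the prime 2 apart: the minus sign of its part survives the odd power o, and n -
  -- 1 is odd.
  W-formula : ∀ n .{{_ : NonZero n}} r (p α : Fin r → ℕ) (p-prime : ∀ i → Prime (p i)) → Injective _≡_ _≡_ p →
    (∀ i → 0 < α i) → n ≡ product (tabulate (λ i → p i ℕ.^ α i)) →
    W n ≡ -1ℤ ℤ.^ (n ∸ 1) ℤ.* + product (tabulate (λ i → p i ℕ.^ exponent n (p i) (α i) (p-prime i)))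
  W-formula n r p α p-prime inj α>0 n≡ with Fin.any? (λ i → p i ℕ.≟ 2)
  ... | no ¬2 = begin
    W n                          ≡⟨ ≡.cong W n≡o ⟩
    W (o ℕ.* 2 ℕ.^ 0)            ≡⟨ W-odd-product 0 r p α p-prime inj p≢2 ⟩
    W 1 ^ℤ o ℤ.* + product (tabulate (λ i → p i ℕ.^ exponent (o ℕ.* 1) (p i) (α i) (p-prime i)))
      ≡⟨ ≡.cong₂ (λ x m → x ℤ.* + product (tabulate (λ i → p i ℕ.^ exponent m (p i) (α i) (p-prime i))))
           (≡.trans (^ℤ-congˡ o W-1) (≡.trans (1^ o) (≡.sym sign))) (≡.sym n≡o) ⟩
    -1ℤ ℤ.^ (n ∸ 1) ℤ.* + product (tabulate (λ i → p i ℕ.^ exponent n (p i) (α i) (p-prime i))) ∎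
    where
    o : ℕ
    o = product (tabulate (λ i → p i ℕ.^ α i))
    n≡o : n ≡ o ℕ.* 1
    n≡o = ≡.trans n≡ (≡.sym (ℕ.*-identityʳ o))
    p≢2 : ∀ i → p i ≢ 2
    p≢2 i eq = ¬2 (i , eq)
    sign : -1ℤ ℤ.^ (n ∸ 1) ≡ 1ℤ
    sign = ≡.trans (sgn-pred n) (≡.cong ℤ.-_ (≡.trans (≡.cong sgn n≡)
      (sgn-odd-product r p α λ i → odd-prime-sgn (p-prime i) (p≢2 i))))
  W-formula n (suc r) p α p-prime inj α>0 n≡ | yes (i₀ , p≡2) = begin
    W n                          ≡⟨ ≡.cong W n≡oB ⟩
    W (o ℕ.* 2 ℕ.^ suc b)        ≡⟨ W-odd-product (suc b) r p′ α′ (p-prime ∘ punchIn i₀) (Fin.punchIn-injective i₀ _ _ ∘ inj) p≢2 ⟩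
    W (2 ℕ.^ suc b) ^ℤ o ℤ.* + product (tabulate (λ i → p′ i ℕ.^ exponent (o ℕ.* 2 ℕ.^ suc b) (p′ i) (α′ i) (p-prime (punchIn i₀ i))))
      ≡⟨ ≡.cong₂ (λ x m → x ℤ.* + product (tabulate (λ i → p′ i ℕ.^ exponent m (p′ i) (α′ i) (p-prime (punchIn i₀ i)))))
           2-part (≡.sym n≡oB) ⟩
    -1ℤ ℤ.^ (n ∸ 1) ℤ.* + h i₀ ℤ.* + product (tabulate (h ∘ punchIn i₀))
      ≡⟨ ℤ.*-assoc (-1ℤ ℤ.^ (n ∸ 1)) (+ h i₀) _ ⟩
    -1ℤ ℤ.^ (n ∸ 1) ℤ.* (+ h i₀ ℤ.* + product (tabulate (h ∘ punchIn i₀)))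
      ≡⟨ ≡.cong (-1ℤ ℤ.^ (n ∸ 1) ℤ.*_) (≡.trans (≡.sym (ℤ.pos-* (h i₀) _)) (≡.cong +_ (≡.sym (product-tabulate-punchIn h i₀)))) ⟩
    -1ℤ ℤ.^ (n ∸ 1) ℤ.* + product (tabulate h) ∎
    where
    p′ α′ : Fin r → ℕ
    p′ = p ∘ punchIn i₀
    α′ = α ∘ punchIn i₀
    o b : ℕ
    o = product (tabulate (λ i → p′ i ℕ.^ α′ i))
    -- `W-2` concerns the positive powers of 2, and α i₀ is positive.
    b = ℕ.pred (α i₀)
    h : Fin (suc r) → ℕ
    h i = p i ℕ.^ exponent n (p i) (α i) (p-prime i)
    α≡ : α i₀ ≡ suc b
    α≡ = ≡.sym (ℕ.suc-pred (α i₀) {{ℕ.>-nonZero (α>0 i₀)}})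
    p^α≡ : p i₀ ℕ.^ α i₀ ≡ 2 ℕ.^ suc b
    p^α≡ = ≡.cong₂ ℕ._^_ p≡2 α≡
    n≡p^α*o : n ≡ p i₀ ℕ.^ α i₀ ℕ.* o
    n≡p^α*o = ≡.trans n≡ (product-tabulate-punchIn (λ i → p i ℕ.^ α i) i₀)
    n≡Bo : n ≡ 2 ℕ.^ suc b ℕ.* o
    n≡Bo = ≡.trans n≡p^α*o (≡.cong (ℕ._* o) p^α≡)
    n≡oB : n ≡ o ℕ.* 2 ℕ.^ suc b
    n≡oB = ≡.trans n≡Bo (ℕ.*-comm (2 ℕ.^ suc b) o)
    p≢2 : ∀ i → p′ i ≢ 2
    p≢2 i eq = Fin.punchInᵢ≢i i₀ i (inj (≡.trans eq (≡.sym p≡2)))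
    2-part : W (2 ℕ.^ suc b) ^ℤ o ≡ -1ℤ ℤ.^ (n ∸ 1) ℤ.* + h i₀
    2-part = begin
      W (2 ℕ.^ suc b) ^ℤ o
        ≡⟨ ^ℤ-congˡ o (≡.trans (W-2 prime[2] b) (≡.trans (≡.cong ℤ.-_ (fromℕ-^ 2 (repunit 2 (suc b)))) (≡.sym (ℤ.-1*i≡-i _)))) ⟩
      (-1ℤ ℤ.* + (2 ℕ.^ repunit 2 (suc b))) ^ℤ o
        ≡⟨ ^ℤ-distrib-* -1ℤ (+ (2 ℕ.^ repunit 2 (suc b))) o ⟩
      -1ℤ ^ℤ o ℤ.* (+ (2 ℕ.^ repunit 2 (suc b))) ^ℤ o
        ≡⟨ ≡.cong₂ ℤ._*_
             (≡.trans (-1^ o) (≡.trans (sgn-odd-product r p′ α′ λ i → odd-prime-sgn (p-prime (punchIn i₀ i)) (p≢2 i)) (≡.sym sign)))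
             (≡.trans (pos-^ (2 ℕ.^ repunit 2 (suc b)) o) (≡.cong +_ (≡.trans (ℕ.^-*-assoc 2 (repunit 2 (suc b)) o)
               (≡.sym (≡.cong₂ ℕ._^_ p≡2 (≡.trans (exponent-spec n (p i₀) (α i₀) (p-prime i₀) o n≡p^α*o)
                 (≡.cong (ℕ._* o) (≡.cong₂ repunit p≡2 α≡)))))))) ⟩
      -1ℤ ℤ.^ (n ∸ 1) ℤ.* + h i₀ ∎
      where
      sign : -1ℤ ℤ.^ (n ∸ 1) ≡ -1ℤ
      sign = ≡.trans (sgn-pred n) (≡.cong ℤ.-_ (≡.trans (≡.cong sgn (≡.trans n≡Bo (ℕ.*-assoc 2 (2 ℕ.^ b) o)))
        (sgn-even (2 ℕ.^ b ℕ.* o))))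

-- The algebraic closure

-- Reduction to lowest terms obscures the numerators in ℚ, so the identity is checked on
-- unnormalised fractions with denominator 1.
/1-+ : ∀ i j → (i ℤ.+ j) ℚ./ 1 ≡ (i ℚ./ 1) ℚ.+ (j ℚ./ 1)
/1-+ i j = ℚ.toℚᵘ-injective (ℚᵘ.≃-trans (ℚ.toℚᵘ-fromℚᵘ (mkℚᵘ (i ℤ.+ j) 0)) (ℚᵘ.≃-sym (ℚᵘ.≃-trans
  (ℚ.toℚᵘ-homo-+ (i ℚ./ 1) (j ℚ./ 1)) (ℚᵘ.≃-trans
  (ℚᵘ.+-cong (ℚ.toℚᵘ-fromℚᵘ (mkℚᵘ i 0)) (ℚ.toℚᵘ-fromℚᵘ (mkℚᵘ j 0)))
  (*≡* (≡.cong (ℤ._* 1ℤ) (≡.cong₂ ℤ._+_ (ℤ.*-identityʳ i) (ℤ.*-identityʳ j))))))))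

/1-* : ∀ i j → (i ℤ.* j) ℚ./ 1 ≡ (i ℚ./ 1) ℚ.* (j ℚ./ 1)
/1-* i j = ℚ.toℚᵘ-injective (ℚᵘ.≃-trans (ℚ.toℚᵘ-fromℚᵘ (mkℚᵘ (i ℤ.* j) 0)) (ℚᵘ.≃-sym (ℚᵘ.≃-trans
  (ℚ.toℚᵘ-homo-* (i ℚ./ 1) (j ℚ./ 1))
  (ℚᵘ.*-cong (ℚ.toℚᵘ-fromℚᵘ (mkℚᵘ i 0)) (ℚ.toℚᵘ-fromℚᵘ (mkℚᵘ j 0))))))

/1-neg : ∀ i → (ℤ.- i) ℚ./ 1 ≡ ℚ.- (i ℚ./ 1)
/1-neg i = ℚ.toℚᵘ-injective (ℚᵘ.≃-trans (ℚ.toℚᵘ-fromℚᵘ (mkℚᵘ (ℤ.- i) 0)) (ℚᵘ.≃-sym (ℚᵘ.≃-trans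
  (ℚ.toℚᵘ-homo‿- (i ℚ./ 1)) (ℚᵘ.-‿cong (ℚ.toℚᵘ-fromℚᵘ (mkℚᵘ i 0))))))

module _ {c ℓ} (M : CommutativeMonoid c ℓ) where
  open CommutativeMonoid M
  open BigProduct M
  open PairProduct M
  open import Relation.Binary.Reasoning.Setoid setoid

  private
    guard : ∀ {p} {P : Set p} → Dec P → Carrier → Carrier
    guard P? x = if does P? then x else ε

    guard-yes : ∀ {p} {P : Set p} (P? : Dec P) {x} → P → guard P? x ≈ x
    guard-yes (yes _) p = refl
    guard-yes (no ¬p) p = contradiction p ¬p

    guard-no : ∀ {p} {P : Set p} (P? : Dec P) {x} → ¬ P → guard P? x ≈ ε
    guard-no (yes p) ¬p = contradiction p ¬p
    guard-no (no _)  ¬p = refl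

  prod-filter-guard : ∀ {a p} {A : Set a} {P : A → Set p} (P? : ∀ x → Dec (P x)) f xs →
                      prod f (filter P? xs) ≈ prod (λ x → guard (P? x) (f x)) xs
  prod-filter-guard P? f []       = refl
  prod-filter-guard P? f (x ∷ xs) with P? x
  ... | yes _ = ∙-congˡ (prod-filter-guard P? f xs)
  ... | no  _ = trans (prod-filter-guard P? f xs) (sym (identityˡ _))

  prod-cartesianProduct : ∀ {a b} {A : Set a} {B : Set b} (f : A × B → Carrier) xs ys →
                          prod f (cartesianProduct xs ys) ≈ prod (λ x → prod (λ y → f (x , y)) ys) xs
  prod-cartesianProduct f []       ys = refl
  prod-cartesianProduct f (x ∷ xs) ys = trans (prod-++ f (map (x ,_) ys) (cartesianProduct xs ys))
    (∙-cong (reflexive (prod-map f (x ,_) ys)) (prod-cartesianProduct f xs ys))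

  -- In a strictly increasing list, x < y holds just when x stands before y. Turning the filter into
  -- neutral factors by `guard` lets the row and the column of the first entry be split off
  -- together.
  pairs-cartesianProduct : ∀ (f : ℕ × ℕ → Carrier) {xs} → AllPairs _<_ xs →
    prod f (filter (λ (x , y) → x ℕ.<? y) (cartesianProduct xs xs)) ≈ pairs (λ x y → f (x , y)) xs
  pairs-cartesianProduct f {xs} sorted = trans
    (prod-filter-guard (λ (x , y) → x ℕ.<? y) f (cartesianProduct xs xs))
    (trans (prod-cartesianProduct (λ (x , y) → guard (x ℕ.<? y) (f (x , y))) xs xs) (go sorted))
    where
    h : ℕ → ℕ → Carrier
    h x y = guard (x ℕ.<? y) (f (x , y))
    go : ∀ {xs} → AllPairs _<_ xs → prod (λ x → prod (h x) xs) xs ≈ pairs (λ x y → f (x , y)) xs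
    go {[]}     []            = refl
    go {x ∷ xs} (x< ∷ sorted) = begin
      (h x x ∙ prod (h x) xs) ∙ prod (λ y → h y x ∙ prod (h y) xs) xs
        ≈⟨ ∙-cong (trans (∙-congʳ (guard-no (x ℕ.<? x) (ℕ.<-irrefl ≡.refl))) (identityˡ _))
             (prod-cong xs λ {y} y∈ → trans (∙-congʳ (guard-no (y ℕ.<? x) (ℕ.<-asym (All.lookup x< y∈)))) (identityˡ _)) ⟩
      prod (h x) xs ∙ prod (λ y → prod (h y) xs) xs
        ≈⟨ ∙-cong (prod-cong xs λ {y} y∈ → guard-yes (x ℕ.<? y) (All.lookup x< y∈)) (go sorted) ⟩
      prod (λ y → f (x , y)) xs ∙ pairs (λ x y → f (x , y)) xs ∎

module _ {c ℓ₁ ℓ₂} (K : AlgebraicClosureOfℚ c ℓ₁ ℓ₂) where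
  private
    module K = AlgebraicClosureOfℚ K
    module KR = CommutativeRing K.commutativeRing
    module ι = RingMorphisms.IsRingHomomorphism K.ι-isHomomorphism
    module ∏ᴷ = BigProduct KR.*-commutativeMonoid
    module Pairsᴷ = PairProduct KR.*-commutativeMonoid
    module ∏ℤ = BigProduct (CommutativeRing.*-commutativeMonoid ℤ-ring)
    module Pairsℤ = PairProduct (CommutativeRing.*-commutativeMonoid ℤ-ring)
    module Polysᴷ = Polys K.commutativeRing
    module Normsᴷ = Norms K.commutativeRing
    module NormPropertiesᴷ = NormProperties K.commutativeRing
    module Polyᴷ = Polynomial K.commutativeRing
  open import Algebra.Apartness.Properties.HeytingCommutativeRing K.heytingCommutativeRing using (1#0)
  open import Relation.Binary.Reasoning.Setoid KR.setoid

  1≉0ᴷ : ¬ KR.1# KR.≈ KR.0#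
  1≉0ᴷ 1≈0 = HeytingField.#-irrefl K.heytingField 1≈0 1#0

  ιℤ-* : ∀ i j → K.ιℤ (i ℤ.* j) KR.≈ K.ιℤ i KR.* K.ιℤ j
  ιℤ-* i j = KR.trans (KR.reflexive (≡.cong K.ι (/1-* i j))) (ι.*-homo _ _)

  ιℤ-isHomomorphism : RingMorphisms.IsRingHomomorphism (CommutativeRing.rawRing ℤ-ring) KR.rawRing K.ιℤ
  ιℤ-isHomomorphism = record
    { isSemiringHomomorphism = record
      { isNearSemiringHomomorphism = record
        { +-isMonoidHomomorphism = record
          { isMagmaHomomorphism = record
            { isRelHomomorphism = record { cong = KR.reflexive ∘ ≡.cong K.ιℤ }
            ; homo = λ i j → KR.trans (KR.reflexive (≡.cong K.ι (/1-+ i j))) (ι.+-homo _ _) }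
          ; ε-homo = ι.0#-homo }
        ; *-homo = ιℤ-* }
      ; 1#-homo = ι.1#-homo }
    ; -‿homo = λ i → KR.trans (KR.reflexive (≡.cong K.ι (/1-neg i))) (ι.-‿homo _) }

  open Homomorphism ℤ-ring K.commutativeRing K.ιℤ ιℤ-isHomomorphism using (mapᵐ; map-⟦⟧; h-norm)

  split : ℤ[X].Monic → Polyᴷ.Monic
  split f = Polyᴷ.∏ᵐ (map Polyᴷ.X-_ (K.roots f))

  ⟦split⟧ : ∀ f → Polyᴷ.⟦ mapᵐ f ⟧ Polysᴷ.≃ Polyᴷ.⟦ split f ⟧
  ⟦split⟧ f = Polysᴷ.mk (proj₂ (K.splits (mapᵐ f)))

  -- A norm depends on its arguments only as polynomials, so f and g may be replaced by the
  -- factorisations that `splits` returns, whichever roots it lists. That the factorisation of f has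
  -- the degree of f uses 1 ≠ 0 in K.
  resultant≈norm : ∀ f g → K.resultant f g KR.≈ K.ιℤ (norm f ⟦ g ⟧)
  resultant≈norm f g = begin
    K.resultant f g                                   ≈⟨ NormPropertiesᴷ.norm-∏-∏ (K.roots f) (K.roots g) ⟨
    Normsᴷ.norm (split f) Polyᴷ.⟦ split g ⟧
      ≈⟨ Normsᴷ.norm-modulus {split f} {mapᵐ f} Polyᴷ.⟦ split g ⟧
           (Polysᴷ.isMonic-unique 1≉0ᴷ (Polysᴷ.isMonic-≃ (Polysᴷ.≃-sym (⟦split⟧ f)) (Polysᴷ.isMonic-⟦⟧ (split f))) (Polysᴷ.isMonic-⟦⟧ (mapᵐ f)))
           (Polysᴷ.≃-sym (⟦split⟧ f)) ⟩
    Normsᴷ.norm (mapᵐ f) Polyᴷ.⟦ split g ⟧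
      ≈⟨ Normsᴷ.norm-cong (mapᵐ f) (Polysᴷ.≃-trans (Polysᴷ.≃-sym (⟦split⟧ g)) (Polysᴷ.≃-sym (map-⟦⟧ g))) ⟩
    Normsᴷ.norm (mapᵐ f) (map K.ιℤ ⟦ g ⟧)             ≈⟨ h-norm f ⟦ g ⟧ ⟨
    K.ιℤ (norm f ⟦ g ⟧)                               ∎

  ιℤ-prod : ∀ {a} {A : Set a} f (xs : List A) → K.ιℤ (∏ℤ.prod f xs) KR.≈ ∏ᴷ.prod (K.ιℤ ∘ f) xs
  ιℤ-prod f []       = ι.1#-homo
  ιℤ-prod f (x ∷ xs) = KR.trans (ιℤ-* (f x) (∏ℤ.prod f xs)) (KR.*-congˡ (ιℤ-prod f xs))

  ιℤ-pairs : ∀ {a} {A : Set a} f (xs : List A) → K.ιℤ (Pairsℤ.pairs f xs) KR.≈ Pairsᴷ.pairs (λ x y → K.ιℤ (f x y)) xs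
  ιℤ-pairs f []       = ι.1#-homo
  ιℤ-pairs f (x ∷ xs) = KR.trans (ιℤ-* (∏ℤ.prod (f x) xs) (Pairsℤ.pairs f xs)) (KR.*-cong (ιℤ-prod (f x) xs) (ιℤ-pairs f xs))

  ∏-resultants : ∀ n → K.∏ (map (λ (d₁ , d₂) → K.resultant (Φ d₂) (Φ d₁)) (divisorPairs n)) KR.≈ K.ιℤ (W n)
  ∏-resultants n = begin
    K.∏ (map (λ (d₁ , d₂) → K.resultant (Φ d₂) (Φ d₁)) (divisorPairs n))
      ≡⟨ ∏ᴷ.prod-map id (λ (d₁ , d₂) → K.resultant (Φ d₂) (Φ d₁)) (divisorPairs n) ⟩
    ∏ᴷ.prod (λ (d₁ , d₂) → K.resultant (Φ d₂) (Φ d₁)) (divisorPairs n)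
      ≈⟨ pairs-cartesianProduct KR.*-commutativeMonoid (λ (d₁ , d₂) → K.resultant (Φ d₂) (Φ d₁)) (divisors-sorted n) ⟩
    Pairsᴷ.pairs (λ d₁ d₂ → K.resultant (Φ d₂) (Φ d₁)) (divisors n)
      ≈⟨ Pairsᴷ.pairs-cong (divisors n) (divisors-sorted n) (λ {d₁} {d₂} _ _ _ → resultant≈norm (Φ d₂) (Φ d₁)) ⟩
    Pairsᴷ.pairs (λ d₁ d₂ → K.ιℤ (N d₂ d₁)) (divisors n)       ≈⟨ ιℤ-pairs (λ d₁ d₂ → N d₂ d₁) (divisors n) ⟨
    K.ιℤ (Pairsℤ.pairs (λ d₁ d₂ → N d₂ d₁) (divisors n))       ≡⟨ ≡.cong K.ιℤ (W≈pairs n) ⟨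
    K.ιℤ (W n) ∎

open import Data.Nat.Base using (_^_)

theoremA2 : ∀ {c ℓ₁ ℓ₂} (n : ℕ) .{{_ : NonZero n}} (r : ℕ) (p α : Fin r → ℕ)
    (p-prime : ∀ i → Prime (p i)) → Injective _≡_ _≡_ p → (∀ i → 0 < α i) →
    n ≡ product (tabulate (λ i → p i ^ α i)) →
    let
      rhs : ℤ
      rhs = -1ℤ ℤ.^ (n ∸ 1) ℤ.* + product (tabulate (λ i → p i ^ exponent n (p i) (α i) (p-prime i)))
    in
    (det (A n) ≡ rhs)
    × ((K : AlgebraicClosureOfℚ c ℓ₁ ℓ₂) (let open AlgebraicClosureOfℚ K) →
       let
         middle : Carrier
         middle = ∏ (map (λ (d₁ , d₂) → resultant (Φ d₂) (Φ d₁)) (divisorPairs n))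
       in
       (ιℤ (det (A n)) ≈ middle) × (middle ≈ ιℤ rhs))
theoremA2 n r p α p-prime inj α>0 n≡ = ≡.trans (det≡W n) W≡rhs , λ K →
  let open CommutativeRing (AlgebraicClosureOfℚ.commutativeRing K) in
  trans (reflexive (≡.cong (AlgebraicClosureOfℚ.ιℤ K) (det≡W n))) (sym (∏-resultants K n)) ,
  trans (∏-resultants K n) (reflexive (≡.cong (AlgebraicClosureOfℚ.ιℤ K) W≡rhs))
  where
  W≡rhs = W-formula n r p α p-prime inj α>0 n≡
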